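{- For every integer $t\geq 1$ there exists an integer $k=k(t)$ such that if $G\in\mathcal{C}_t$ and $x,y\in V(G)$ are non-adjacent with $N(x)\cap\operatorname{Hub}(G)=\emptyset$, then there do not exist $k$ pairwise internally vertex-disjoint paths in $G$ from $x$ to $y$.
   Context: Graphs are finite and simple; a path means an induced path. A hole is an induced cycle on at least four vertices. A theta is three internally vertex-disjoint paths between two vertices, each of length at least 2, with pairwise anticomplete interiors. A prism consists of three vertex-disjoint paths $a_i\text{ - }\dots\text{ - }b_i$ ($i=1,2,3$), each of length at least 1, with $a_1a_2a_3$ and $b_1b_2b_3$ triangles and no other edges between the paths. A wheel $(H,x)$ is a hole $H$ and a vertex $x$ with at least three neighbors in $H$; it is even if $x$ has an even number of neighbors in $H$. $\mathcal{C}$ is the class of graphs with no induced $C_4$, theta, prism or even wheel; $\mathcal{C}_t$ consists of the graphs in $\mathcal{C}$ with no clique of size $t$. A wheel $(H,x)$ is a twin wheel if $N(x)\cap H$ induces a path of length two, and a short pyramid if $|N(x)\cap H|=3$ and $x$ has exactly two adjacent neighbors in $H$; it is proper if it is neither. A vertex $x$ is a hub of $G$ if there is a hole $H$ such that $(H,x)$ is a proper wheel in $G$; $\operatorname{Hub}(G)$ is the set of hubs of $G$. -}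

module Defs where

open import Data.Nat using (ℕ; zero; suc; _≤_; _<_)
open import Data.Nat.Divisibility using (_∣_)
open import Data.Fin using (Fin; toℕ; fromℕ)
open import Data.List using (List; length; filter; allFin)
open import Data.Product using (Σ; ∃; ∃-syntax; _×_; _,_)
open import Data.Sum using (_⊎_)
open import Function.Definitions using (Injective)
open import Function.Bundles using (_⇔_)
open import Relation.Nullary using (¬_; Dec)
open import Relation.Binary.PropositionalEquality using (_≡_; _≢_)

record Graph : Set₁ where
  field
    n     : ℕ
    E     : Fin n → Fin n → Set
    E-dec : ∀ u v → Dec (E u v)
    E-sym : ∀ {u v} → E u v → E v u
    E-irr : ∀ {u} → ¬ E u u

open Graph public

V : Graph → Set
V G = Fin (n G)

PathAdj : ∀ {m} → Fin m → Fin m → Set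
PathAdj i j = suc (toℕ i) ≡ toℕ j ⊎ suc (toℕ j) ≡ toℕ i

CycAdj : ∀ {m} → Fin m → Fin m → Set
CycAdj {m} i j =
  suc (toℕ i) ≡ toℕ j ⊎ suc (toℕ j) ≡ toℕ i
  ⊎ (toℕ i ≡ 0 × suc (toℕ j) ≡ m) ⊎ (toℕ j ≡ 0 × suc (toℕ i) ≡ m)

record Path (G : Graph) (a b : V G) : Set where
  field
    len     : ℕ
    vtx     : Fin (suc len) → V G
    inj     : Injective _≡_ _≡_ vtx
    start   : vtx Fin.zero ≡ a
    end     : vtx (fromℕ len) ≡ b
    induced : ∀ i j → E G (vtx i) (vtx j) ⇔ PathAdj i j

open Path public

Interior : ∀ {G a b} (P : Path G a b) → Fin (suc (len P)) → Set
Interior P i = 0 < toℕ i × toℕ i < len P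

record Hole (G : Graph) : Set where
  field
    hlen     : ℕ
    four≤    : 4 ≤ hlen
    hvtx     : Fin hlen → V G
    hinj     : Injective _≡_ _≡_ hvtx
    hinduced : ∀ i j → E G (hvtx i) (hvtx j) ⇔ CycAdj i j

open Hole public

HasC4 : Graph → Set
HasC4 G = Σ (Hole G) λ H → hlen H ≡ 4

HasTheta : Graph → Set
HasTheta G = Σ (V G) λ a → Σ (V G) λ b → Σ (Fin 3 → Path G a b) λ P →
  (∀ r → 2 ≤ len (P r)) ×
  (∀ r s → r ≢ s → ∀ i j → Interior (P r) i → Interior (P s) j →
     vtx (P r) i ≢ vtx (P s) j × ¬ E G (vtx (P r) i) (vtx (P s) j))

HasPrism : Graph → Set
HasPrism G = Σ (Fin 3 → V G) λ a → Σ (Fin 3 → V G) λ b →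
  Σ ((r : Fin 3) → Path G (a r) (b r)) λ P →
  (∀ r → 1 ≤ len (P r)) ×
  (∀ r s → r ≢ s → E G (a r) (a s)) ×
  (∀ r s → r ≢ s → E G (b r) (b s)) ×
  (∀ r s → r ≢ s → ∀ i j →
     vtx (P r) i ≢ vtx (P s) j ×
     (E G (vtx (P r) i) (vtx (P s) j) →
        (toℕ i ≡ 0 × toℕ j ≡ 0) ⊎ (toℕ i ≡ len (P r) × toℕ j ≡ len (P s))))

nbrCount : (G : Graph) → V G → Hole G → ℕ
nbrCount G x H = length (filter (λ i → E-dec G x (hvtx H i)) (allFin (hlen H)))

IsWheel : (G : Graph) → Hole G → V G → Set
IsWheel G H x = (∀ i → hvtx H i ≢ x) × 3 ≤ nbrCount G x H

EvenWheel : (G : Graph) → Hole G → V G → Set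
EvenWheel G H x = IsWheel G H x × 2 ∣ nbrCount G x H

HasEvenWheel : Graph → Set
HasEvenWheel G = Σ (Hole G) λ H → Σ (V G) λ x → EvenWheel G H x

TwinWheel : (G : Graph) → Hole G → V G → Set
TwinWheel G H x = IsWheel G H x × nbrCount G x H ≡ 3 ×
  Σ (Fin (hlen H)) λ i → Σ (Fin (hlen H)) λ j → Σ (Fin (hlen H)) λ l →
    E G x (hvtx H i) × E G x (hvtx H j) × E G x (hvtx H l) ×
    i ≢ j × j ≢ l × i ≢ l ×
    E G (hvtx H i) (hvtx H j) × E G (hvtx H j) (hvtx H l) ×
    ¬ E G (hvtx H i) (hvtx H l)

ShortPyramid : (G : Graph) → Hole G → V G → Set
ShortPyramid G H x = IsWheel G H x × nbrCount G x H ≡ 3 ×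
  Σ (Fin (hlen H)) λ i → Σ (Fin (hlen H)) λ j → Σ (Fin (hlen H)) λ l →
    E G x (hvtx H i) × E G x (hvtx H j) × E G x (hvtx H l) ×
    i ≢ j × j ≢ l × i ≢ l ×
    E G (hvtx H i) (hvtx H j) × ¬ E G (hvtx H j) (hvtx H l) ×
    ¬ E G (hvtx H i) (hvtx H l)

ProperWheel : (G : Graph) → Hole G → V G → Set
ProperWheel G H x =
  IsWheel G H x × ¬ TwinWheel G H x × ¬ ShortPyramid G H x

IsHub : (G : Graph) → V G → Set
IsHub G x = Σ (Hole G) λ H → ProperWheel G H x

HasClique : Graph → ℕ → Set
HasClique G t = Σ (Fin t → V G) λ f →
  Injective _≡_ _≡_ f × (∀ i j → i ≢ j → E G (f i) (f j))

InC : Graph → Set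
InC G = ¬ HasC4 G × ¬ HasTheta G × ¬ HasPrism G × ¬ HasEvenWheel G

InCt : ℕ → Graph → Set
InCt t G = InC G × ¬ HasClique G t

DisjointPaths : (G : Graph) → V G → V G → ℕ → Set
DisjointPaths G x y k = Σ (Fin k → Path G x y) λ P →
  ∀ r s → r ≢ s → ∀ i j → Interior (P r) i → Interior (P s) j →
    vtx (P r) i ≢ vtx (P s) j

-- By Ramsey's theorem the neighbours X of x on the given paths, and likewise the neighbours of y,
-- may be assumed pairwise non-adjacent. Let D be the union of the paths beyond X. As G has no theta
-- and X contains no hub, a vertex with its own route to x that sees an induced path of D closed up
-- through x sees exactly two consecutive vertices of it. So three routes to x that meet in D meet in
-- a triangle. Two triangles linked by three routes give a prism or a wheel with four spokes; hence
-- two anticomplete connected subsets of D have at most two common neighbours in X.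
--
-- A minimal connected subset of D touching X is therefore like the line graph of a tree whose degrees
-- are bounded by the clique number, and a centroid of it is a triangle a b c such that a and b lead
-- to anticomplete connected sets A and B with many neighbours in X each, and c leads to x. Removing
-- few vertices of D other than y cannot separate A from B, for otherwise one of them would be a second
-- side to the component of y. So there are many bypasses from A to B avoiding a, b, c, and c sees
-- exactly two consecutive vertices α and β of each. For two of them, α ~ β′ or α′ ~ β, since otherwise
-- the triangles c α β and c α′ β′ are linked. By Ramsey's theorem this yields a large clique or a C4.

module Submission where

open import Defs
open import Data.Empty using (⊥; ⊥-elim)
open import Data.Fin using (Fin; toℕ; fromℕ<) renaming (zero to fz; suc to fs)
open import Data.Fin.Properties using (toℕ-injective; toℕ<n; toℕ-fromℕ; toℕ-fromℕ<)
import Data.Fin.Properties as Finₚ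
open import Data.List using (List; []; _∷_; _++_; length; filter; map; lookup; allFin)
open import Data.List.Membership.Propositional using (_∈_; _∉_; lose)
open import Data.List.Membership.Propositional.Properties
  using (∈-filter⁺; ∈-filter⁻; ∈-lookup; ∈-allFin; ∈-∃++; ∈-++⁺ˡ; ∈-++⁺ʳ; ∈-++⁻)
open import Data.List.Properties using (length-map; length-++; filter-notAll; length-tabulate)
open import Data.List.Relation.Unary.All using (All; []; _∷_)
import Data.List.Relation.Unary.All as All
import Data.List.Relation.Unary.All.Properties as Allₚ
open import Data.List.Relation.Unary.AllPairs using (AllPairs; []; _∷_)
import Data.List.Relation.Unary.AllPairs as AllPairs
import Data.List.Relation.Unary.AllPairs.Properties as AllPairsₚ
open import Data.List.Relation.Unary.Any using (here; there)
open import Data.List.Relation.Unary.Unique.Propositional using (Unique)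
import Data.List.Relation.Unary.Unique.Propositional.Properties as Uniqueₚ
open import Data.List.Relation.Binary.Sublist.Propositional
  using (⊆-refl; ⊆-trans; []; _∷_; _∷ʳ_) renaming (_⊆_ to _⊑_)
open import Data.List.Relation.Binary.Sublist.Propositional.Properties
  using (All-resp-⊆; filter-⊆)
open import Data.Nat using (ℕ; zero; suc; _+_; _*_; _∸_; _≤_; _<_; z≤n; s≤s; s≤s⁻¹; _≤?_)
open import Data.Nat.Divisibility using (divides)
open import Data.Nat.Induction using (<-rec)
open import Data.Nat.Properties
open import Data.Product using (Σ; ∃; ∃-syntax; _×_; _,_; proj₁; proj₂)
open import Data.Sum using (_⊎_; inj₁; inj₂; [_,_]′)
open import Level using (0ℓ) renaming (suc to lsuc; _⊔_ to _⊔ˡ_)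
open import Function using (_∘_; id; case_of_)
open import Function.Bundles using (mk⇔; module Equivalence)
open import Relation.Nullary using (¬_; Dec; yes; no; ¬?; contradiction)
open import Relation.Nullary.Decidable using (¬¬-excluded-middle; _⊎-dec_)
open import Relation.Unary using (_⊆_; _∪_; ｛_｝)
open import Relation.Binary.Definitions using (tri<; tri≈; tri>)
open import Relation.Binary.PropositionalEquality
  using (_≡_; _≢_; refl; sym; trans; cong; subst; ≢-sym)

-- The hypothesis on hubs enters where no theta is available. A vertex of X is adjacent to x, so no
-- theta joins the two; but two non-adjacent neighbours of it on a path closed up through x form
-- with x a stable triple on the hole, and such a triple makes it a hub.
--
-- The bypasses come from y, so y must survive every deletion. Each deleted vertex lies in a
-- triangle, and y lies in none because its neighbours in D and X are pairwise non-adjacent. This is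
-- the purpose of the second use of Ramsey's theorem.
--
-- The leg from c to x may run into a bypass. The last vertex of the leg that sees the bypass then
-- forms a new triangle with two vertices of it, and this triangle has a shorter leg and larger
-- sides. Hence the induction on the length of the leg, in which no count deteriorates.
--
-- No tree is ever built. Minimality gives each branch at a vertex v of the minimal set its own exit
-- in X, so three branches would make a theta from v to x. The centroid is an inclusion-minimal set
-- that one vertex cuts off and that still has many neighbours in X.

-- Classical reasoning under double negation, and bounded search

infixl 1 _>>=_

-- Sets of vertices are arbitrary predicates, so membership and reachability are decided only under
-- double negation. The arguments that do so end in ⊥, hence this bind is enough for `do` blocks.
_>>=_ : ∀ {a} {A : Set a} → ¬ ¬ A → (A → ⊥) → ⊥
m >>= k = m k

em : ∀ {a} {A : Set a} → ¬ ¬ Dec A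
em = ¬¬-excluded-middle

¬¬-∀Fin : ∀ {n} {P : Fin n → Set} → (∀ i → ¬ ¬ P i) → ¬ ¬ (∀ i → P i)
¬¬-∀Fin {zero}  _ k = k λ ()
¬¬-∀Fin {suc n} h k = do
  p  ← h fz
  ps ← ¬¬-∀Fin (h ∘ fs)
  k λ { fz → p ; (fs i) → ps i }

decide : ∀ {n} (Q : Fin n → Set) → ¬ ¬ (∀ v → Dec (Q v))
decide Q = ¬¬-∀Fin λ _ → em

¬¬-All : ∀ {A : Set} {P : A → Set} {xs} → All (¬_ ∘ ¬_ ∘ P) xs → ¬ ¬ All P xs
¬¬-All []       k = k []
¬¬-All (p ∷ ps) k = do
  q  ← p
  qs ← ¬¬-All ps
  k (q ∷ qs)

lastIndex : ∀ {Q : ℕ → Set} → (∀ i → Dec (Q i)) → ∀ n → ∃[ i ] i ≤ n × Q i →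
            ∃[ j ] j ≤ n × Q j × (∀ {k} → j < k → k ≤ n → ¬ Q k)
lastIndex Q? n e with Q? n
... | yes q = n , ≤-refl , q , λ n<k k≤n → contradiction k≤n (<⇒≱ n<k)
lastIndex Q? zero (zero , z≤n , q) | no ¬q = contradiction q ¬q
lastIndex Q? (suc n) (i , i≤n , q) | no ¬q
  with m≤n⇒m<n∨m≡n i≤n
... | inj₂ refl = contradiction q ¬q
... | inj₁ (s≤s i≤n′) with lastIndex Q? n (i , i≤n′ , q)
... | j , j≤n , qj , later = j , m≤n⇒m≤1+n j≤n , qj , λ j<k k≤1+n qk →
  [ (λ { (s≤s k≤n) → later j<k k≤n qk }) , (λ { refl → ¬q qk }) ]′ (m≤n⇒m<n∨m≡n k≤1+n)

firstIndex : ∀ {Q : ℕ → Set} → (∀ i → Dec (Q i)) → ∀ n → Q n →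
             ∃[ j ] j ≤ n × Q j × (∀ {k} → k < j → ¬ Q k)
firstIndex Q? n q with Q? 0
... | yes q₀ = 0 , z≤n , q₀ , λ ()
firstIndex Q? zero q | no ¬q₀ = contradiction q ¬q₀
firstIndex Q? (suc n) q | no ¬q₀ with firstIndex (Q? ∘ suc) n q
... | j , j≤n , qj , earlier =
  suc j , s≤s j≤n , qj , λ { {zero} _ → ¬q₀ ; {suc k} (s≤s k<j) → earlier k<j }

changeover : ∀ {P Q : ℕ → Set} n → (∀ i → i ≤ n → P i ⊎ Q i) → P 0 → ¬ P n →
             ∃[ i ] i < n × P i × Q (suc i)
changeover zero tag p₀ ¬pₙ = contradiction p₀ ¬pₙ
changeover (suc n) tag p₀ ¬pₙ with tag 1 (s≤s z≤n)
... | inj₂ q₁ = 0 , s≤s z≤n , p₀ , q₁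
... | inj₁ p₁ with changeover n (λ i i≤n → tag (suc i) (s≤s i≤n)) p₁ ¬pₙ
... | i , i<n , p , q = suc i , s≤s i<n , p , q

-- Lists, Ramsey's theorem and the pigeonhole principle

module _ {A : Set} where

  Unique-⊆⇒length≤ : ∀ {xs ys : List A} → Unique xs → (∀ {x} → x ∈ xs → x ∈ ys) →
                     length xs ≤ length ys
  Unique-⊆⇒length≤ {[]} _ _ = z≤n
  Unique-⊆⇒length≤ {x ∷ xs} {ys} (x∉xs ∷ uxs) sub with ∈-∃++ (sub (here refl))
  ... | as , bs , refl = begin
    suc (length xs)           ≤⟨ s≤s (Unique-⊆⇒length≤ uxs sub′) ⟩
    suc (length (as ++ bs)) ≡⟨ cong suc (length-++ as) ⟩
    suc (length as + length bs)   ≡⟨ sym (+-suc (length as) (length bs)) ⟩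
    length as + length (x ∷ bs)   ≡⟨ sym (length-++ as) ⟩
    length (as ++ x ∷ bs) ∎
    where
    open ≤-Reasoning
    sub′ : ∀ {z} → z ∈ xs → z ∈ (as ++ bs)
    sub′ z∈xs with ∈-++⁻ as (sub (there z∈xs))
    ... | inj₁ z∈as         = ∈-++⁺ˡ z∈as
    ... | inj₂ (here refl)  = contradiction refl (All.lookup x∉xs z∈xs)
    ... | inj₂ (there z∈bs) = ∈-++⁺ʳ as z∈bs

  length-filter-split : ∀ {P : A → Set} (P? : ∀ x → Dec (P x)) xs →
    length xs ≡ length (filter P? xs) + length (filter (¬? ∘ P?) xs)
  length-filter-split P? [] = refl
  length-filter-split P? (x ∷ xs) with P? x
  ... | yes _ = cong suc (length-filter-split P? xs)
  ... | no  _ = trans (cong suc (length-filter-split P? xs)) (sym (+-suc _ _))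

  take-⊑ : ∀ k (xs : List A) → k ≤ length xs → ∃[ ys ] ys ⊑ xs × length ys ≡ k
  take-⊑ zero xs _ = [] , minimum xs , refl
    where
    minimum : ∀ (xs : List A) → [] ⊑ xs
    minimum []       = ⊆-refl
    minimum (x ∷ xs) = x ∷ʳ minimum xs
  take-⊑ (suc k) (x ∷ xs) (s≤s k≤) with take-⊑ k xs k≤
  ... | ys , ys⊑ , refl = x ∷ ys , refl ∷ ys⊑ , refl

  AllPairs-⊑ : ∀ {R : A → A → Set} {xs ys} → ys ⊑ xs → AllPairs R xs → AllPairs R ys
  AllPairs-⊑ [] [] = []
  AllPairs-⊑ (_ ∷ʳ s)   (_ ∷ rs) = AllPairs-⊑ s rs
  AllPairs-⊑ (refl ∷ s) (r ∷ rs) = All-resp-⊆ s r ∷ AllPairs-⊑ s rs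

-- The head plus the two smaller bounds: a crude form of the Erdős-Szekeres recursion.
ram : ℕ → ℕ → ℕ
ram zero    q       = 0
ram (suc p) zero    = 0
ram (suc p) (suc q) = suc (ram p (suc q) + ram (suc p) q)

-- `R` need not be symmetric: `AllPairs` relates an entry to the later ones only. So the lemma also
-- covers relations with a direction, such as that of the α of one rung to the β of another.
ramsey : ∀ {A : Set} {R : A → A → Set} → (∀ u v → Dec (R u v)) → ∀ p q xs →
         ram p q ≤ length xs →
         (∃[ ys ] ys ⊑ xs × length ys ≡ p × AllPairs R ys) ⊎
         (∃[ ys ] ys ⊑ xs × length ys ≡ q × AllPairs (λ u v → ¬ R u v) ys)
ramsey R? zero q xs _ = inj₁ (_ , proj₁ (proj₂ (take-⊑ 0 xs z≤n)) , refl , [])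
ramsey R? (suc p) zero xs _ = inj₂ (_ , proj₁ (proj₂ (take-⊑ 0 xs z≤n)) , refl , [])
ramsey {R = R} R? (suc p) (suc q) (x ∷ xs) (s≤s bound)
  with ram p (suc q) ≤? length (filter (R? x) xs)
... | yes big with ramsey R? p (suc q) (filter (R? x) xs) big
... | inj₂ (ys , ys⊑ , eq , ap) = inj₂ (ys , x ∷ʳ ⊆-trans ys⊑ (filter-⊆ (R? x) xs) , eq , ap)
... | inj₁ (ys , ys⊑ , eq , ap) =
  inj₁ (x ∷ ys , refl ∷ ⊆-trans ys⊑ (filter-⊆ (R? x) xs) , cong suc eq ,
        All-resp-⊆ ys⊑ (Allₚ.all-filter (R? x) xs) ∷ ap)
ramsey {R = R} R? (suc p) (suc q) (x ∷ xs) (s≤s bound) | no small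
  with ramsey R? (suc p) q (filter (¬? ∘ R? x) xs) big
  where
  big : ram (suc p) q ≤ length (filter (¬? ∘ R? x) xs)
  big = +-cancelˡ-≤ (ram p (suc q)) _ _
    (≤-trans bound (≤-trans (≤-reflexive (length-filter-split (R? x) xs))
      (+-monoˡ-≤ _ (<⇒≤ (≰⇒> small)))))
... | inj₁ (ys , ys⊑ , eq , ap) =
  inj₁ (ys , x ∷ʳ ⊆-trans ys⊑ (filter-⊆ (¬? ∘ R? x) xs) , eq , ap)
... | inj₂ (ys , ys⊑ , eq , ap) =
  inj₂ (x ∷ ys , refl ∷ ⊆-trans ys⊑ (filter-⊆ (¬? ∘ R? x) xs) , cong suc eq ,
        All-resp-⊆ ys⊑ (Allₚ.all-filter (¬? ∘ R? x) xs) ∷ ap)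

-- Either the value at the head is taken often enough, or removing all entries with that value costs
-- at most one of the `t` blocks of size `suc k`.
fibre : ∀ {A B : Set} → (∀ u v → Dec (_≡_ {A = B} u v)) → (f : A → B) → ∀ t k xs →
        t * suc k ≤ length xs →
        (∃[ ys ] ys ⊑ xs × length ys ≡ t × AllPairs (λ u v → f u ≢ f v) ys) ⊎
        (∃[ b ] ∃[ ys ] ys ⊑ xs × suc k ≤ length ys × All (λ u → f u ≡ b) ys)
fibre _≟_ f zero k xs _ = inj₁ (_ , proj₁ (proj₂ (take-⊑ 0 xs z≤n)) , refl , [])
fibre _≟_ f (suc t) k (x ∷ xs) bound = split (suc k ≤? length (filter Same? (x ∷ xs)))
  where
  Same? : ∀ u → Dec (f u ≡ f x)
  Same? u = f u ≟ f x
  Other? : ∀ u → Dec (f u ≢ f x)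
  Other? u = ¬? (Same? u)
  others : List _
  others = filter Other? xs
  others-of-x∷xs : filter Other? (x ∷ xs) ≡ others
  others-of-x∷xs with Same? x
  ... | yes _    = refl
  ... | no  fx≢fx = contradiction refl fx≢fx
  split : Dec (suc k ≤ length (filter Same? (x ∷ xs))) → _
  split (yes big) =
    inj₂ (f x , _ , filter-⊆ Same? (x ∷ xs) , big , Allₚ.all-filter Same? (x ∷ xs))
  split (no small) with fibre _≟_ f t k others many
    where
    many : t * suc k ≤ length others
    many = +-cancelˡ-≤ (suc k) _ _ (begin
      suc k + t * suc k                              ≤⟨ bound ⟩
      length (x ∷ xs)                                ≡⟨ length-filter-split Same? (x ∷ xs) ⟩
      length (filter Same? (x ∷ xs)) + length (filter Other? (x ∷ xs))
                                                     ≡⟨ cong ((length (filter Same? (x ∷ xs)) +_) ∘ length) others-of-x∷xs ⟩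
      length (filter Same? (x ∷ xs)) + length others ≤⟨ +-monoˡ-≤ _ (<⇒≤ (≰⇒> small)) ⟩
      suc k + length others                          ∎)
      where open ≤-Reasoning
  ... | inj₂ (b , ys , ys⊑ , big , fib) =
    inj₂ (b , ys , x ∷ʳ ⊆-trans ys⊑ (filter-⊆ Other? xs) , big , fib)
  ... | inj₁ (ys , ys⊑ , eq , ap) =
    inj₁ (x ∷ ys , refl ∷ ⊆-trans ys⊑ (filter-⊆ Other? xs) , cong suc eq ,
          All.map ≢-sym (All-resp-⊆ ys⊑ (Allₚ.all-filter Other? xs)) ∷ ap)

-- Connectivity and induced paths

module Basics (G : Graph) where

  infix 4 _~_

  Sub : Set₁
  Sub = V G → Set

  _~_ : V G → V G → Set
  u ~ v = E G u v

  ~-sym : ∀ {u v} → u ~ v → v ~ u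
  ~-sym = E-sym G

  ~⇒≢ : ∀ {u v} → u ~ v → u ≢ v
  ~⇒≢ e refl = E-irr G e

  data Reach (S : Sub) : V G → V G → Set where
    stop : ∀ {u} → S u → Reach S u u
    step : ∀ {u w v} → S u → u ~ w → Reach S w v → Reach S u v

  Conn : Sub → Set
  Conn S = ∀ {u v} → S u → S v → Reach S u v

  Touches : Sub → Sub
  Touches S v = ∃[ u ] S u × v ~ u

  Apart : Sub → Sub → Set
  Apart S T = ∀ {u v} → S u → T v → u ≢ v × ¬ (u ~ v)

  Apart-sym : ∀ {S T} → Apart S T → Apart T S
  Apart-sym ap t s = ≢-sym (proj₁ (ap s t)) , proj₂ (ap s t) ∘ ~-sym

  Apart-∪ˡ : ∀ {S S′ T} → Apart S T → Apart S′ T → Apart (S ∪ S′) T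
  Apart-∪ˡ p q (inj₁ s) t = p s t
  Apart-∪ˡ p q (inj₂ s) t = q s t

  Apart-∪ʳ : ∀ {S T T′} → Apart S T → Apart S T′ → Apart S (T ∪ T′)
  Apart-∪ʳ p q s (inj₁ t) = p s t
  Apart-∪ʳ p q s (inj₂ t) = q s t

  source : ∀ {S u v} → Reach S u v → S u
  source (stop s)     = s
  source (step s _ _) = s

  target : ∀ {S u v} → Reach S u v → S v
  target (stop s)     = s
  target (step _ _ r) = target r

  Reach-mono : ∀ {S T u v} → S ⊆ T → Reach S u v → Reach T u v
  Reach-mono f (stop s)     = stop (f s)
  Reach-mono f (step s e r) = step (f s) e (Reach-mono f r)

  Reach-trans : ∀ {S u v w} → Reach S u v → Reach S v w → Reach S u w
  Reach-trans (stop _)     q = q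
  Reach-trans (step s e r) q = step s e (Reach-trans r q)

  snoc : ∀ {S u v w} → Reach S u v → v ~ w → S w → Reach S u w
  snoc r e s = Reach-trans r (step (target r) e (stop s))

  Reach-sym : ∀ {S u v} → Reach S u v → Reach S v u
  Reach-sym (stop s)     = stop s
  Reach-sym (step s e r) = snoc (Reach-sym r) (~-sym e) s

  Reach-within : ∀ {S T v} → (∀ {w} → Reach T w v → S w) → ∀ {u} → Reach T u v → Reach S u v
  Reach-within f r@(stop _)      = stop (f r)
  Reach-within f r@(step _ e r′) = step (f r) e (Reach-within f r′)

  Conn-via : ∀ {S r} → (∀ {u} → S u → Reach S u r) → Conn S
  Conn-via f s t = Reach-trans (f s) (Reach-sym (f t))

  Conn-component : ∀ {S r} → Conn (λ v → Reach S v r)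
  Conn-component {S} {r} = Conn-via (Reach-within id)

  -- The linking edge is asked for only once `T` has an element, so that `T` may be empty.
  Conn-grow : ∀ {S T} → Conn S → Conn T → (∀ {v} → T v → ∃[ s ] ∃[ t ] S s × T t × s ~ t) → Conn (S ∪ T)
  Conn-grow cS cT h (inj₁ u) (inj₁ v) = Reach-mono inj₁ (cS u v)
  Conn-grow cS cT h (inj₂ u) (inj₂ v) = Reach-mono inj₂ (cT u v)
  Conn-grow cS cT h (inj₁ u) (inj₂ v) = let (_ , _ , s , t , e) = h v in
    Reach-trans (Reach-mono inj₁ (cS u s)) (step (inj₁ s) e (Reach-mono inj₂ (cT t v)))
  Conn-grow cS cT h (inj₂ u) (inj₁ v) = let (_ , _ , s , t , e) = h u in
    Reach-trans (Reach-mono inj₂ (cT u t)) (step (inj₂ t) (~-sym e) (Reach-mono inj₁ (cS s v)))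

  Conn-｛｝ : ∀ {v} → Conn ｛ v ｝
  Conn-｛｝ refl refl = stop refl

  -- An induced path inside S; the values of at beyond ℓ are junk.
  record Chain (S : Sub) (a b : V G) : Set where
    field
      ℓ    : ℕ
      at     : ℕ → V G
      at-0   : at 0 ≡ a
      at-ℓ : at ℓ ≡ b
      inS    : ∀ {i} → i ≤ ℓ → S (at i)
      at-inj : ∀ {i j} → i ≤ ℓ → j ≤ ℓ → at i ≡ at j → i ≡ j
      at-adj : ∀ {i j} → i ≤ ℓ → j ≤ ℓ → at i ~ at j → suc i ≡ j ⊎ suc j ≡ i
      link   : ∀ {i} → i < ℓ → at i ~ at (suc i)

  module _ {S a b} (C : Chain S a b) where
    open Chain C

    widen : ∀ {T} → (∀ {i} → i ≤ ℓ → T (at i)) → Chain T a b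
    widen f = record
      { ℓ = ℓ ; at = at ; at-0 = at-0 ; at-ℓ = at-ℓ ; inS = f
      ; at-inj = at-inj ; at-adj = at-adj ; link = link }

    drop : ∀ m → m ≤ ℓ → Chain S (at m) b
    drop m m≤ = record
      { ℓ = ℓ ∸ m ; at = λ i → at (m + i)
      ; at-0 = cong at (+-identityʳ m)
      ; at-ℓ = trans (cong at (m+[n∸m]≡n m≤)) at-ℓ
      ; inS = λ i≤ → inS (up i≤)
      ; at-inj = λ i≤ j≤ eq → +-cancelˡ-≡ m _ _ (at-inj (up i≤) (up j≤) eq)
      ; at-adj = λ i≤ j≤ e → case at-adj (up i≤) (up j≤) e of λ
          { (inj₁ eq) → inj₁ (+-cancelˡ-≡ m _ _ (trans (+-suc m _) eq))
          ; (inj₂ eq) → inj₂ (+-cancelˡ-≡ m _ _ (trans (+-suc m _) eq)) }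
      ; link = λ {i} i< → subst (λ k → at (m + i) ~ at k) (sym (+-suc m i))
          (link (subst (_≤ ℓ) (+-suc m i) (up i<))) }
      where
      up : ∀ {i} → i ≤ ℓ ∸ m → m + i ≤ ℓ
      up i≤ = ≤-trans (+-monoʳ-≤ m i≤) (≤-reflexive (m+[n∸m]≡n m≤))

    take : ∀ m → m ≤ ℓ → Chain S a (at m)
    take m m≤ = record
      { ℓ = m ; at = at ; at-0 = at-0 ; at-ℓ = refl
      ; inS = λ i≤ → inS (≤-trans i≤ m≤)
      ; at-inj = λ i≤ j≤ → at-inj (≤-trans i≤ m≤) (≤-trans j≤ m≤)
      ; at-adj = λ i≤ j≤ → at-adj (≤-trans i≤ m≤) (≤-trans j≤ m≤)
      ; link = λ i< → link (≤-trans i< m≤) }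

    cons : ∀ {u} → S u → u ~ a → (∀ {i} → i ≤ ℓ → u ≢ at i) →
           (∀ {i} → suc i ≤ ℓ → ¬ (u ~ at (suc i))) → Chain S u b
    cons {u} su e fresh far = record
      { ℓ = suc ℓ ; at = at′ ; at-0 = refl ; at-ℓ = at-ℓ
      ; inS = λ { {zero} _ → su ; {suc i} (s≤s i≤) → inS i≤ }
      ; at-inj = inj′ ; at-adj = adj′
      ; link = λ { {zero} _ → subst (u ~_) (sym at-0) e ; {suc i} (s≤s i<) → link i< } }
      where
      at′ : ℕ → V G
      at′ zero    = u
      at′ (suc i) = at i
      inj′ : ∀ {i j} → i ≤ suc ℓ → j ≤ suc ℓ → at′ i ≡ at′ j → i ≡ j
      inj′ {zero}  {zero}  _ _ _ = refl
      inj′ {zero}  {suc j} _ (s≤s j≤) eq = contradiction eq (fresh j≤)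
      inj′ {suc i} {zero}  (s≤s i≤) _ eq = contradiction (sym eq) (fresh i≤)
      inj′ {suc i} {suc j} (s≤s i≤) (s≤s j≤) eq = cong suc (at-inj i≤ j≤ eq)
      adj′ : ∀ {i j} → i ≤ suc ℓ → j ≤ suc ℓ → at′ i ~ at′ j → suc i ≡ j ⊎ suc j ≡ i
      adj′ {zero} {zero} _ _ e = contradiction refl (~⇒≢ e)
      adj′ {zero} {suc zero} _ _ _ = inj₁ refl
      adj′ {zero} {suc (suc j)} _ (s≤s j≤) e = contradiction e (far j≤)
      adj′ {suc zero} {zero} _ _ _ = inj₂ refl
      adj′ {suc (suc i)} {zero} (s≤s i≤) _ e = contradiction (~-sym e) (far i≤)
      adj′ {suc i} {suc j} (s≤s i≤) (s≤s j≤) e = case adj″ of λ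
        { (inj₁ eq) → inj₁ (cong suc eq) ; (inj₂ eq) → inj₂ (cong suc eq) }
        where adj″ = at-adj i≤ j≤ e

    reverse : Chain S b a
    reverse = record
      { ℓ = ℓ ; at = λ i → at (ℓ ∸ i) ; at-0 = at-ℓ ; at-ℓ = trans (cong at (n∸n≡0 ℓ)) at-0
      ; inS = λ {i} _ → inS (m∸n≤m ℓ i)
      ; at-inj = λ {i} {j} i≤ j≤ eq → ∸-cancelˡ-≡ i≤ j≤ (at-inj (m∸n≤m ℓ i) (m∸n≤m ℓ j) eq)
      ; at-adj = λ {i} {j} i≤ j≤ e → case at-adj (m∸n≤m ℓ i) (m∸n≤m ℓ j) e of λ
          { (inj₁ eq) → inj₂ (∸-cancelˡ-≡ (step< {i} j≤ eq) i≤ (back {i} j≤ eq))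
          ; (inj₂ eq) → inj₁ (∸-cancelˡ-≡ (step< {j} i≤ eq) j≤ (back {j} i≤ eq)) }
      ; link = λ {i} i< → ~-sym (subst (λ k → at (ℓ ∸ suc i) ~ at k) (sym (+-∸-assoc 1 i<))
          (link (≤-trans (≤-reflexive (sym (+-∸-assoc 1 i<))) (m∸n≤m ℓ i)))) }
      where
      step< : ∀ {i j} → j ≤ ℓ → suc (ℓ ∸ i) ≡ ℓ ∸ j → suc j ≤ ℓ
      step< {i} {j} j≤ eq = ≤∧≢⇒< j≤ λ { refl → case trans eq (n∸n≡0 ℓ) of λ () }
      back : ∀ {i j} → j ≤ ℓ → suc (ℓ ∸ i) ≡ ℓ ∸ j → ℓ ∸ suc j ≡ ℓ ∸ i
      back {i} {j} j≤ eq = suc-injective (trans (sym (+-∸-assoc 1 (step< {i} j≤ eq))) (sym eq))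

    1≤length : a ≢ b → 1 ≤ ℓ
    1≤length a≢b = n≢0⇒n>0 λ eq → a≢b (trans (sym at-0) (trans (cong at (sym eq)) at-ℓ))

    2≤length : a ≢ b → ¬ (a ~ b) → 2 ≤ ℓ
    2≤length a≢b a≁b = ≤∧≢⇒< (1≤length a≢b) λ eq → a≁b (subst (_~ b) at-0
      (subst (at 0 ~_) (trans (cong at eq) at-ℓ) (link (≤-reflexive eq))))

    toPath : Path G a b
    toPath = record
      { len = ℓ ; vtx = at ∘ toℕ
      ; inj = λ {i} {j} eq → toℕ-injective (at-inj (bound i) (bound j) eq)
      ; start = at-0 ; end = trans (cong at (toℕ-fromℕ ℓ)) at-ℓ
      ; induced = λ i j → mk⇔ (at-adj (bound i) (bound j)) λ
          { (inj₁ eq) → subst (λ k → at (toℕ i) ~ at k) eq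
              (link (subst (_≤ ℓ) (sym eq) (bound j)))
          ; (inj₂ eq) → ~-sym (subst (λ k → at (toℕ j) ~ at k) eq
              (link (subst (_≤ ℓ) (sym eq) (bound i)))) } }
      where
      bound : (i : Fin (suc ℓ)) → toℕ i ≤ ℓ
      bound i = s≤s⁻¹ (toℕ<n i)

    Seg : ℕ → ℕ → Sub
    Seg lo hi v = ∃[ i ] lo ≤ i × i ≤ hi × at i ≡ v

    Seg-reach : ∀ {lo hi i} j → lo ≤ i → i ≤ j → j ≤ hi → hi ≤ ℓ →
                Reach (Seg lo hi) (at i) (at j)
    Seg-reach j lo≤ i≤j j≤hi hi≤ with m≤n⇒m<n∨m≡n i≤j
    ... | inj₂ refl = stop (_ , lo≤ , j≤hi , refl)
    Seg-reach (suc j) lo≤ i≤j j≤hi hi≤ | inj₁ (s≤s i≤j′) =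
      snoc (Seg-reach j lo≤ i≤j′ (≤-trans (n≤1+n j) j≤hi) hi≤)
           (link (≤-trans j≤hi hi≤)) (_ , ≤-trans lo≤ i≤j , j≤hi , refl)

    Seg-Conn : ∀ {lo hi} → hi ≤ ℓ → Conn (Seg lo hi)
    Seg-Conn hi≤ (i , lo≤i , i≤ , refl) (j , lo≤j , j≤ , refl) with ≤-total i j
    ... | inj₁ i≤j = Seg-reach j lo≤i i≤j j≤ hi≤
    ... | inj₂ j≤i = Reach-sym (Seg-reach i lo≤j j≤i i≤ hi≤)

    Seg⊆S : ∀ {lo hi} → hi ≤ ℓ → Seg lo hi ⊆ S
    Seg⊆S hi≤ (i , _ , i≤ , refl) = inS (≤-trans i≤ hi≤)

    crossing : ∀ {P Q : Sub} → S ⊆ (P ∪ Q) → P a → ¬ P b →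
               ∃[ i ] i < ℓ × P (at i) × Q (at (suc i))
    crossing tag pa ¬pb =
      changeover ℓ (λ i i≤ → tag (inS i≤)) (subst _ (sym at-0) pa) (¬pb ∘ subst _ at-ℓ)

    -- Where the path leaves `P` it can only step to `m`, because no edge joins `P` to `Q`.
    visits : ∀ {P Q : Sub} {m} → (∀ {v} → S v → P v ⊎ (v ≡ m ⊎ Q v)) → Apart P Q →
             P a → Q b → ∃[ i ] i ≤ ℓ × at i ≡ m
    visits tag ap pa qb
      with crossing tag pa (λ pb → proj₁ (ap pb qb) refl)
    ... | i , i< , _ , inj₁ eq = suc i , i< , eq
    ... | i , i< , p , inj₂ q  = contradiction (link i<) (proj₂ (ap p q))

  singleton : ∀ {S : Sub} {u} → S u → Chain S u u
  singleton {u = u} s = record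
    { ℓ = 0 ; at = λ _ → u ; at-0 = refl ; at-ℓ = refl ; inS = λ _ → s
    ; at-inj = λ { z≤n z≤n _ → refl } ; at-adj = λ _ _ e → contradiction refl (~⇒≢ e)
    ; link = λ () }

  abstract
    -- Of the shortened rest, only the part from the last vertex that equals or sees `u` is kept; so
    -- `u` is its first vertex or gets exactly one edge to it.
    shortcut : ∀ {S u v} → Reach S u v → Chain S u v
    shortcut (stop s) = singleton s
    shortcut {S} {u} {v} (step {w = w} su e r)
      with shortcut r
    ... | C with lastIndex (λ i → (u Finₚ.≟ Chain.at C i) ⊎-dec E-dec G u (Chain.at C i))
                 (Chain.ℓ C) (0 , z≤n , inj₂ (subst (u ~_) (sym (Chain.at-0 C)) e))
    ... | j , j≤ , inj₁ eq , _ = subst (λ z → Chain S z v) (sym eq) (drop C j j≤)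
    ... | j , j≤ , inj₂ e′ , later = cons (drop C j j≤) su e′ fresh far
      where
      open Chain C
      up : ∀ {i} → i ≤ ℓ ∸ j → j + i ≤ ℓ
      up i≤ = ≤-trans (+-monoʳ-≤ j i≤) (≤-reflexive (m+[n∸m]≡n j≤))
      far : ∀ {i} → suc i ≤ ℓ ∸ j → ¬ (u ~ at (j + suc i))
      far {i} i< e″ = later (m<m+n j (s≤s z≤n)) (up i<) (inj₂ e″)
      fresh : ∀ {i} → i ≤ ℓ ∸ j → u ≢ at (j + i)
      fresh {zero}  _  eq =
        ~⇒≢ e′ (trans eq (cong at (+-identityʳ j)))
      fresh {suc i} i< eq = later (m<m+n j (s≤s z≤n)) (up i<) (inj₁ eq)

  list-clique : ∀ {vs} → AllPairs _~_ vs → HasClique G (length vs)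
  list-clique {vs} ap = lookup vs , injective , adj ap
    where
    adj : ∀ {vs} → AllPairs _~_ vs → ∀ i j → i ≢ j → lookup vs i ~ lookup vs j
    adj (r ∷ rs) fz     fz     i≢j = contradiction refl i≢j
    adj (r ∷ rs) fz     (fs j) _   = All.lookup r (∈-lookup j)
    adj (r ∷ rs) (fs i) fz     _   = ~-sym (All.lookup r (∈-lookup i))
    adj (r ∷ rs) (fs i) (fs j) i≢j = adj rs i j (i≢j ∘ cong fs)
    injective : ∀ {i j} → lookup vs i ≡ lookup vs j → i ≡ j
    injective {i} {j} eq with i Finₚ.≟ j
    ... | yes p = p
    ... | no i≢j = contradiction eq (~⇒≢ (adj ap i j i≢j))

  module _ {a b} (P : Path G a b) where

    private
      idx : ℕ → Fin (suc (len P))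
      -- Indices beyond the end are clamped to the last vertex.
      idx i = fromℕ< (s≤s (m⊓n≤n i (len P)))

    toℕ-idx : ∀ {i} → i ≤ len P → toℕ (idx i) ≡ i
    toℕ-idx {i} i≤ = trans (toℕ-fromℕ< (s≤s (m⊓n≤n i (len P)))) (m≤n⇒m⊓n≡m i≤)

    fromPath : Chain (λ v → ∃[ i ] vtx P i ≡ v) a b
    fromPath = record
      { ℓ = len P ; at = vtx P ∘ idx ; at-0 = start P
      ; at-ℓ = trans (cong (vtx P) (toℕ-injective (trans (toℕ-idx ≤-refl) (sym (toℕ-fromℕ (len P)))))) (end P)
      ; inS = λ {i} _ → idx i , refl
      ; at-inj = λ i≤ j≤ eq → trans (sym (toℕ-idx i≤)) (trans (cong toℕ (inj P eq)) (toℕ-idx j≤))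
      ; at-adj = λ {i} {j} i≤ j≤ e → case Equivalence.to (induced P (idx i) (idx j)) e of λ
          { (inj₁ eq) → inj₁ (trans (cong suc (sym (toℕ-idx i≤))) (trans eq (toℕ-idx j≤)))
          ; (inj₂ eq) → inj₂ (trans (cong suc (sym (toℕ-idx j≤))) (trans eq (toℕ-idx i≤))) }
      ; link = λ {i} i< → Equivalence.from (induced P (idx i) (idx (suc i)))
          (inj₁ (trans (cong suc (toℕ-idx (<⇒≤ i<))) (sym (toℕ-idx i<)))) }

    at-interior : ∀ {i} → 0 < i → i < len P → ∃[ k ] Interior P k × vtx P k ≡ Chain.at fromPath i
    at-interior {i} 0<i i< = idx i ,
      (subst (0 <_) (sym (toℕ-idx (<⇒≤ i<))) 0<i , subst (_< len P) (sym (toℕ-idx (<⇒≤ i<))) i<) , refl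

-- Thetas, holes, wheels and prisms obtained from walks

module Forbidden (G : Graph) (inC : InC G) where
  open Basics G

  Link : Sub → V G → V G → Set
  Link S v x = ∃[ p ] ∃[ q ] v ~ p × Reach S p q × q ~ x

  extend : ∀ {S T u v x} → S ⊆ T → T v → u ~ v → Link S v x → Link T u x
  extend f tv e (p , q , e₁ , r , e₂) = _ , q , e , step tv e₁ (Reach-mono f r) , e₂

  -- Only a link from v to x is asked of each set: shortcutting it gives an induced path.
  no-theta : ∀ {v x} → v ≢ x → ¬ (v ~ x) → (S : Fin 3 → Sub) →
    (∀ r → Link (S r) v x × ¬ S r v × ¬ S r x) →
    (∀ r s → r ≢ s → Apart (S r) (S s)) → ⊥
  no-theta {v} {x} v≢x v≁x S links apart =
    proj₁ (proj₂ inC) (v , x , P , long , apart′)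
    where
    T : Fin 3 → Sub
    T r w = S r w ⊎ (w ≡ v ⊎ w ≡ x)
    C : ∀ r → Chain (T r) v x
    C r with links r
    ... | (p , q , e₁ , ρ , e₂) , _ = shortcut
      (step (inj₂ (inj₁ refl)) e₁ (snoc (Reach-mono inj₁ ρ) e₂ (inj₂ (inj₂ refl))))
    module C r = Chain (C r)
    P : Fin 3 → Path G v x
    P r = toPath (C r)
    long : ∀ r → 2 ≤ C.ℓ r
    long r = 2≤length (C r) v≢x v≁x
    interior : ∀ r i → 0 < i → i < C.ℓ r → S r (C.at r i)
    interior r i 0<i i<ℓ with C.inS r (<⇒≤ i<ℓ)
    ... | inj₁ s = s
    ... | inj₂ (inj₁ eq) = contradiction
      (C.at-inj r z≤n (<⇒≤ i<ℓ) (trans (C.at-0 r) (sym eq))) (<⇒≢ 0<i)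
    ... | inj₂ (inj₂ eq) = contradiction
      (C.at-inj r (<⇒≤ i<ℓ) ≤-refl (trans eq (sym (C.at-ℓ r)))) (<⇒≢ i<ℓ)
    apart′ : ∀ r s → r ≢ s → ∀ i j → Interior (P r) i → Interior (P s) j →
             vtx (P r) i ≢ vtx (P s) j × ¬ E G (vtx (P r) i) (vtx (P s) j)
    apart′ r s r≢s i j (0<i , i<) (0<j , j<) =
      apart r s r≢s (interior r (toℕ i) 0<i i<) (interior s (toℕ j) 0<j j<)

  three : ∀ {a} {A : Set a} → A → A → A → Fin 3 → A
  three p q r fz           = p
  three p q r (fs fz)      = q
  three p q r (fs (fs fz)) = r

  pairs : ∀ {a} {R : Fin 3 → Fin 3 → Set a} → (∀ {i j} → R i j → R j i) →
          R fz (fs fz) → R fz (fs (fs fz)) → R (fs fz) (fs (fs fz)) →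
          ∀ i j → i ≢ j → R i j
  pairs s p q r fz           fz           i≢j = contradiction refl i≢j
  pairs s p q r fz           (fs fz)      _   = p
  pairs s p q r fz           (fs (fs fz)) _   = q
  pairs s p q r (fs fz)      fz           _   = s p
  pairs s p q r (fs fz)      (fs fz)      i≢j = contradiction refl i≢j
  pairs s p q r (fs fz)      (fs (fs fz)) _   = r
  pairs s p q r (fs (fs fz)) fz           _   = s q
  pairs s p q r (fs (fs fz)) (fs fz)      _   = s r
  pairs s p q r (fs (fs fz)) (fs (fs fz)) i≢j = contradiction refl i≢j

  no-theta₃ : ∀ {v x} → v ≢ x → ¬ (v ~ x) → ∀ {S₁ S₂ S₃ : Sub} →
    Link S₁ v x × ¬ S₁ v × ¬ S₁ x →
    Link S₂ v x × ¬ S₂ v × ¬ S₂ x →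
    Link S₃ v x × ¬ S₃ v × ¬ S₃ x →
    Apart S₁ S₂ → Apart S₁ S₃ → Apart S₂ S₃ → ⊥
  no-theta₃ v≢x v≁x {S₁} {S₂} {S₃} l₁ l₂ l₃ a₁₂ a₁₃ a₂₃ =
    no-theta v≢x v≁x S
      (λ { fz → l₁ ; (fs fz) → l₂ ; (fs (fs fz)) → l₃ })
      (pairs {R = λ i j → Apart (S i) (S j)} (λ p {_} {_} → Apart-sym p) a₁₂ a₁₃ a₂₃)
    where S = three S₁ S₂ S₃

  module _ {S a b} (C : Chain S a b) {z : V G} where
    open Chain C

    -- `z` receives index 0 and `at i` index `suc i`, so the wrap-around cases of `CycAdj` belong to
    -- the edge between `z` and the end of the path.
    closeHole : 2 ≤ ℓ → z ~ a → z ~ b → (∀ {i} → i ≤ ℓ → z ~ at i → i ≡ 0 ⊎ i ≡ ℓ) →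
                (∀ {i} → i ≤ ℓ → z ≢ at i) → Hole G
    closeHole 2≤ℓ za zb ends fresh = record
      { hlen = suc (suc ℓ) ; four≤ = s≤s (s≤s 2≤ℓ) ; hvtx = cyc ∘ toℕ
      ; hinj = λ {i} {j} eq → toℕ-injective (cyc-inj (bound i) (bound j) eq)
      ; hinduced = λ i j → mk⇔ (cyc-adj (bound i) (bound j)) λ
          { (inj₁ eq) → subst (λ k → cyc (toℕ i) ~ cyc k) eq
              (cyc-link (subst (_≤ suc ℓ) (sym eq) (bound j)))
          ; (inj₂ (inj₁ eq)) → ~-sym (subst (λ k → cyc (toℕ j) ~ cyc k) eq
              (cyc-link (subst (_≤ suc ℓ) (sym eq) (bound i))))
          ; (inj₂ (inj₂ (inj₁ (eq , eq′)))) → closing eq (suc-injective eq′)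
          ; (inj₂ (inj₂ (inj₂ (eq , eq′)))) → ~-sym (closing eq (suc-injective eq′)) } }
      where
      bound : (i : Fin (suc (suc ℓ))) → toℕ i ≤ suc ℓ
      bound i = s≤s⁻¹ (toℕ<n i)
      cyc : ℕ → V G
      cyc zero    = z
      cyc (suc i) = at i
      cyc-inj : ∀ {i j} → i ≤ suc ℓ → j ≤ suc ℓ → cyc i ≡ cyc j → i ≡ j
      cyc-inj {zero}  {zero}  _ _ _ = refl
      cyc-inj {zero}  {suc j} _ (s≤s j≤) eq = contradiction eq (fresh j≤)
      cyc-inj {suc i} {zero}  (s≤s i≤) _ eq = contradiction (sym eq) (fresh i≤)
      cyc-inj {suc i} {suc j} (s≤s i≤) (s≤s j≤) eq = cong suc (at-inj i≤ j≤ eq)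
      cyc-link : ∀ {i} → i < suc ℓ → cyc i ~ cyc (suc i)
      cyc-link {zero}  _        = subst (z ~_) (sym at-0) za
      cyc-link {suc i} (s≤s i<) = link i<
      closing : ∀ {i j} → i ≡ 0 → j ≡ suc ℓ → cyc i ~ cyc j
      closing refl refl = subst (z ~_) (sym at-ℓ) zb
      cyc-adj : ∀ {i j} → i ≤ suc ℓ → j ≤ suc ℓ → cyc i ~ cyc j →
        suc i ≡ j ⊎ suc j ≡ i ⊎ (i ≡ 0 × suc j ≡ suc (suc ℓ)) ⊎ (j ≡ 0 × suc i ≡ suc (suc ℓ))
      cyc-adj {zero} {zero} _ _ e = contradiction refl (~⇒≢ e)
      cyc-adj {zero} {suc j} _ (s≤s j≤) e with ends j≤ e
      ... | inj₁ refl = inj₁ refl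
      ... | inj₂ refl = inj₂ (inj₂ (inj₁ (refl , refl)))
      cyc-adj {suc i} {zero} (s≤s i≤) _ e with ends i≤ (~-sym e)
      ... | inj₁ refl = inj₂ (inj₁ refl)
      ... | inj₂ refl = inj₂ (inj₂ (inj₂ (refl , refl)))
      cyc-adj {suc i} {suc j} (s≤s i≤) (s≤s j≤) e with at-adj i≤ j≤ e
      ... | inj₁ eq = inj₁ (cong suc eq)
      ... | inj₂ eq = inj₂ (inj₁ (cong suc eq))

  no-C4 : ∀ {p q r s} → p ~ r → p ~ s → q ~ r → q ~ s →
          p ≢ q → ¬ (p ~ q) → r ≢ s → ¬ (r ~ s) → ⊥
  no-C4 {p} {q} {r} {s} pr ps qr qs p≢q p≁q r≢s r≁s = proj₁ inC
    (closeHole C (s≤s (s≤s z≤n)) (~-sym ps) (~-sym qs)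
      (λ { {0} _ _ → inj₁ refl ; {1} _ e → contradiction (~-sym e) r≁s ; {2} _ _ → inj₂ refl
         ; {suc (suc (suc _))} (s≤s (s≤s ())) })
      (λ { {0} _ → ≢-sym (~⇒≢ ps) ; {1} _ → ≢-sym r≢s ; {2} _ → ≢-sym (~⇒≢ qs)
         ; {suc (suc (suc _))} (s≤s (s≤s ())) }) , refl)
    where
    Q : Sub
    Q _ = p ≡ p
    C : Chain Q p q
    C = cons (cons (singleton {Q} {q} refl) {r} refl (~-sym qr) (λ { z≤n → ~⇒≢ (~-sym qr) }) (λ ()))
      {p} refl pr (λ { {0} _ → ~⇒≢ pr ; {1} _ → p≢q ; {suc (suc _)} (s≤s ()) })
      (λ { {0} _ → p≁q ; {suc _} (s≤s ()) })

  module _ (H : Hole G) (s : V G) where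
    nbr? : ∀ i → Dec (s ~ hvtx H i)
    nbr? i = E-dec G s (hvtx H i)

    count≥ : ∀ {ks} → Unique ks → All (λ i → s ~ hvtx H i) ks → length ks ≤ nbrCount G s H
    count≥ uks all = Unique-⊆⇒length≤ uks λ k∈ →
      ∈-filter⁺ nbr? (∈-allFin _) (All.lookup all k∈)

    count≤ : ∀ ks → (∀ i → s ~ hvtx H i → i ∈ ks) → nbrCount G s H ≤ length ks
    count≤ ks f = Unique-⊆⇒length≤
      (Uniqueₚ.filter⁺ nbr? (Uniqueₚ.allFin⁺ (hlen H)))
      λ k∈ → f _ (proj₂ (∈-filter⁻ nbr? {xs = allFin (hlen H)} k∈))

    -- In a twin wheel and in a short pyramid the centre has exactly three neighbours on the hole,
    -- and two of them are adjacent. With a count of three the stable triple would be all of them,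
    -- so the wheel is neither.
    stable-triple⇒hub : (∀ i → hvtx H i ≢ s) → (k : Fin 3 → Fin (hlen H)) →
      (∀ r → s ~ hvtx H (k r)) →
      (∀ r r′ → r ≢ r′ → k r ≢ k r′ × ¬ (hvtx H (k r) ~ hvtx H (k r′))) → IsHub G s
    stable-triple⇒hub s∉H k nbr stable = H , (s∉H , count≥ distinct nbrs) ,
      (λ { (_ , c≡3 , i , j , _ , si , sj , _ , i≢j , _ , _ , ij , _) → no-edge c≡3 si sj i≢j ij }) ,
      (λ { (_ , c≡3 , i , j , _ , si , sj , _ , i≢j , _ , _ , ij , _) → no-edge c≡3 si sj i≢j ij })
      where
      ks : List (Fin (hlen H))
      ks = k fz ∷ k (fs fz) ∷ k (fs (fs fz)) ∷ []
      distinct : Unique ks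
      distinct = (proj₁ (stable _ _ λ ()) ∷ proj₁ (stable _ _ λ ()) ∷ []) ∷
                 (proj₁ (stable _ _ λ ()) ∷ []) ∷ [] ∷ []
      nbrs : All (λ i → s ~ hvtx H i) ks
      nbrs = nbr _ ∷ nbr _ ∷ nbr _ ∷ []
      listed : nbrCount G s H ≡ 3 → ∀ {i} → s ~ hvtx H i → ∃[ r ] i ≡ k r
      listed c≡3 {i} si with i Finₚ.≟ k fz | i Finₚ.≟ k (fs fz) | i Finₚ.≟ k (fs (fs fz))
      ... | yes eq | _ | _ = _ , eq
      ... | _ | yes eq | _ = _ , eq
      ... | _ | _ | yes eq = _ , eq
      ... | no n₁ | no n₂ | no n₃ =
        contradiction (count≥ ((n₁ ∷ n₂ ∷ n₃ ∷ []) ∷ distinct) (si ∷ nbrs))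
          (<⇒≱ (s≤s (≤-reflexive c≡3)))
      no-edge : nbrCount G s H ≡ 3 → ∀ {i j} → s ~ hvtx H i → s ~ hvtx H j → i ≢ j →
                ¬ (hvtx H i ~ hvtx H j)
      no-edge c≡3 si sj i≢j ij with listed c≡3 si | listed c≡3 sj
      ... | r , refl | r′ , refl with r Finₚ.≟ r′
      ... | yes refl = i≢j refl
      ... | no r≢r′  = proj₂ (stable r r′ r≢r′) ij

  -- z is adjacent to exactly the four ends of two paths that close up to a hole.
  module FourWheel {z p₁ q₁ p₃ q₃ : V G} {S T : Sub}
    (zp₁ : z ~ p₁) (zq₁ : z ~ q₁) (zp₃ : z ~ p₃) (zq₃ : z ~ q₃)
    (pp : p₁ ~ p₃) (qq : q₁ ~ q₃) (p₁≢q₁ : p₁ ≢ q₁) (p₃≢q₃ : p₃ ≢ q₃)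
    (ρ : Reach S p₁ q₁) (σ : Reach T p₃ q₃)
    (z∉S : ¬ S z) (z∉T : ¬ T z)
    (zS : ∀ {u} → S u → z ~ u → u ≡ p₁ ⊎ u ≡ q₁)
    (zT : ∀ {u} → T u → z ~ u → u ≡ p₃ ⊎ u ≡ q₃)
    (ST : ∀ {u v} → S u → T v → u ≢ v × (u ~ v → (u ≡ p₁ × v ≡ p₃) ⊎ (u ≡ q₁ × v ≡ q₃)))
    where

    R : Chain T p₃ q₃
    R = shortcut σ
    module R = Chain R

    ℓ-pos : 0 < R.ℓ
    ℓ-pos = 1≤length R p₃≢q₃

    Tail : Sub
    Tail = Seg R 1 R.ℓ

    ∈Tail⇒T : Tail ⊆ T
    ∈Tail⇒T = Seg⊆S R ≤-refl

    p₃∉Tail : ∀ {v} → Tail v → v ≢ p₃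
    p₃∉Tail (i , 1≤i , i≤ , refl) eq = contradiction
      (R.at-inj i≤ z≤n (trans eq (sym R.at-0))) (≢-sym (<⇒≢ 1≤i))

    U : Sub
    U = S ∪ Tail

    -- The hole is closed at `p₃`. Without `p₃`, the only possible edge between the two paths is
    -- `q₁ q₃`, so an induced path from `p₁` to the second vertex of `R` has to use it.
    C : Chain U p₁ (R.at 1)
    C = shortcut (Reach-trans (Reach-mono inj₁ ρ)
      (step (inj₁ (target ρ)) (subst (q₁ ~_) (sym R.at-ℓ) qq)
        (Reach-mono inj₂ (Reach-sym (Seg-reach R R.ℓ ≤-refl ℓ-pos ≤-refl ≤-refl)))))
    module C = Chain C

    first-in-Tail : Tail (R.at 1)
    first-in-Tail = 1 , ≤-refl , ℓ-pos , refl

    p₃~first : p₃ ~ R.at 1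
    p₃~first = subst (_~ R.at 1) R.at-0 (R.link ℓ-pos)

    p₃-nbr : ∀ {v} → U v → p₃ ~ v → v ≡ p₁ ⊎ v ≡ R.at 1
    p₃-nbr (inj₁ s) e with proj₂ (ST s (source σ)) (~-sym e)
    ... | inj₁ (eq , _) = inj₁ eq
    ... | inj₂ (_ , eq) = contradiction eq p₃≢q₃
    p₃-nbr (inj₂ (i , 1≤i , i≤ , refl)) e
      with R.at-adj z≤n i≤ (subst (_~ R.at i) (sym R.at-0) e)
    ... | inj₁ refl = inj₂ refl
    ... | inj₂ ()

    long : 2 ≤ C.ℓ
    long = 2≤length C (proj₁ edge) λ e → case proj₂ edge e of λ
      { (inj₁ (_ , eq)) → p₃∉Tail first-in-Tail eq ; (inj₂ (eq , _)) → p₁≢q₁ eq }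
      where edge = ST (source ρ) (∈Tail⇒T first-in-Tail)

    ends : ∀ {i} → i ≤ C.ℓ → p₃ ~ C.at i → i ≡ 0 ⊎ i ≡ C.ℓ
    ends i≤ e with p₃-nbr (C.inS i≤) e
    ... | inj₁ eq = inj₁ (C.at-inj i≤ z≤n (trans eq (sym C.at-0)))
    ... | inj₂ eq = inj₂ (C.at-inj i≤ ≤-refl (trans eq (sym C.at-ℓ)))

    fresh : ∀ {i} → i ≤ C.ℓ → p₃ ≢ C.at i
    fresh i≤ eq with C.inS i≤
    ... | inj₁ s = proj₁ (ST s (source σ)) (sym eq)
    ... | inj₂ t = p₃∉Tail t (sym eq)

    H : Hole G
    H = closeHole C long (~-sym pp) p₃~first ends fresh

    across : ∃[ i ] i < C.ℓ × C.at i ≡ q₁ × C.at (suc i) ≡ q₃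
    across with crossing C id (source ρ)
                  (λ s → proj₁ (ST s (∈Tail⇒T first-in-Tail)) refl)
    ... | i , i< , s , t with proj₂ (ST s (∈Tail⇒T t)) (C.link i<)
    ... | inj₁ (_ , eq)   = contradiction eq (p₃∉Tail t)
    ... | inj₂ (eq , eq′) = i , i< , eq , eq′

    contra : ⊥
    contra = let (m , m< , at-m , at-sm) = across in finish m m< at-m at-sm
      where
      finish : ∀ m → m < C.ℓ → C.at m ≡ q₁ → C.at (suc m) ≡ q₃ → ⊥
      finish m m< at-m at-sm = proj₂ (proj₂ (proj₂ inC))
        (H , z , (z∉H , ≤-trans (n≤1+n 3) (count≥ H z distinct nbrs)) ,
         divides 2 (≤-antisym (count≤ H z ks complete) (count≥ H z distinct nbrs)))
        where
        0<m : 0 < m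
        0<m = n≢0⇒n>0 λ eq → p₁≢q₁
          (trans (sym C.at-0) (trans (cong C.at (sym eq)) at-m))

        k₁ k₂ : Fin (suc (suc C.ℓ))
        k₁ = fromℕ< (s≤s (s≤s (<⇒≤ m<)))
        k₂ = fromℕ< (s≤s (s≤s m<))

        k₁≡ : toℕ k₁ ≡ suc m
        k₁≡ = toℕ-fromℕ< (s≤s (s≤s (<⇒≤ m<)))
        k₂≡ : toℕ k₂ ≡ suc (suc m)
        k₂≡ = toℕ-fromℕ< (s≤s (s≤s m<))

        ks : List (Fin (suc (suc C.ℓ)))
        ks = fz ∷ fs fz ∷ k₁ ∷ k₂ ∷ []

        differ : ∀ {n} {i j : Fin n} {a b} → toℕ i ≡ a → toℕ j ≡ b → a ≢ b → i ≢ j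
        differ refl refl a≢b refl = a≢b refl

        distinct : Unique ks
        distinct =
          (differ refl refl (λ ()) ∷ differ refl k₁≡ (λ ()) ∷ differ refl k₂≡ (λ ()) ∷ []) ∷
          (differ refl k₁≡ (λ eq → <⇒≢ 0<m (suc-injective eq)) ∷ differ refl k₂≡ (λ ()) ∷ []) ∷
          (differ k₁≡ k₂≡ (<⇒≢ ≤-refl) ∷ []) ∷ [] ∷ []

        vertex : ℕ → V G
        vertex zero    = p₃
        vertex (suc i) = C.at i

        hvtx-vertex : ∀ i {j} → toℕ i ≡ j → hvtx H i ≡ vertex j
        hvtx-vertex fz     refl = refl
        hvtx-vertex (fs i) refl = refl

        z~ : ∀ i {j v} → toℕ i ≡ j → vertex j ≡ v → z ~ v → z ~ hvtx H i
        z~ i eq eq′ e = subst (z ~_) (sym (trans (hvtx-vertex i eq) eq′)) e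

        nbrs : All (λ i → z ~ hvtx H i) ks
        nbrs = zp₃ ∷ z~ (fs fz) refl C.at-0 zp₁ ∷ z~ k₁ k₁≡ at-m zq₁ ∷ z~ k₂ k₂≡ at-sm zq₃ ∷ []

        z∉H : ∀ i → hvtx H i ≢ z
        z∉H fz eq = ~⇒≢ zp₃ (sym eq)
        z∉H (fs i) eq with C.inS (s≤s⁻¹ (toℕ<n i))
        ... | inj₁ s = z∉S (subst S eq s)
        ... | inj₂ t = z∉T (∈Tail⇒T (subst Tail eq t))

        complete : ∀ i → z ~ hvtx H i → i ∈ ks
        complete fz _ = here refl
        complete (fs i) e = locate (C.inS i≤)
          where
          i≤ : toℕ i ≤ C.ℓ
          i≤ = s≤s⁻¹ (toℕ<n i)
          same : ∀ {j v} → j ≤ C.ℓ → C.at (toℕ i) ≡ v → C.at j ≡ v → toℕ i ≡ j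
          same j≤ eq eq′ = C.at-inj i≤ j≤ (trans eq (sym eq′))
          locate : U (C.at (toℕ i)) → fs i ∈ ks
          locate (inj₁ s) with zS s e
          ... | inj₁ eq = there (here (toℕ-injective (cong suc (same z≤n eq C.at-0))))
          ... | inj₂ eq = there (there (here (toℕ-injective
                  (trans (cong suc (same (<⇒≤ m<) eq at-m)) (sym k₁≡)))))
          locate (inj₂ t) with zT (∈Tail⇒T t) e
          ... | inj₁ eq = contradiction eq (p₃∉Tail t)
          ... | inj₂ eq = there (there (there (here (toℕ-injective
                  (trans (cong suc (same m< eq at-sm)) (sym k₂≡))))))

  -- When p i ≡ q i for some i, the two triangles share a vertex, which then is the centre
  -- of a wheel with exactly four spokes instead of the middle path of a prism.
  module _ (p q : Fin 3 → V G) (U : Fin 3 → Sub)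
    (ρ : ∀ i → Reach (U i) (p i) (q i))
    (pp : ∀ i j → i ≢ j → p i ~ p j) (qq : ∀ i j → i ≢ j → q i ~ q j)
    (edges : ∀ i j → i ≢ j → ∀ {u v} → U i u → U j v →
             u ≢ v × (u ~ v → (u ≡ p i × v ≡ p j) ⊎ (u ≡ q i × v ≡ q j)))
    (one : ∀ i j → i ≢ j → p i ≡ q i → p j ≢ q j)
    where

    private
      prism : (∀ i → p i ≢ q i) → ⊥
      prism p≢q = proj₁ (proj₂ (proj₂ inC)) (p , q , (λ i → toPath (C i)) , long , pp , qq , between)
        where
        C : ∀ i → Chain (U i) (p i) (q i)
        C i = shortcut (ρ i)
        module C i = Chain (C i)
        long : ∀ i → 1 ≤ C.ℓ i
        long i = 1≤length (C i) (p≢q i)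
        between : ∀ r s → r ≢ s → ∀ i j →
          C.at r (toℕ i) ≢ C.at s (toℕ j) ×
          (C.at r (toℕ i) ~ C.at s (toℕ j) →
           (toℕ i ≡ 0 × toℕ j ≡ 0) ⊎ (toℕ i ≡ C.ℓ r × toℕ j ≡ C.ℓ s))
        between r s r≢s i j with edges r s r≢s (C.inS r i≤) (C.inS s j≤)
          where
          i≤ = s≤s⁻¹ (toℕ<n i)
          j≤ = s≤s⁻¹ (toℕ<n j)
        ... | ≢ , adj = ≢ , λ e → case adj e of λ
          { (inj₁ (eq , eq′)) → inj₁
              ( C.at-inj r i≤ z≤n (trans eq (sym (C.at-0 r)))
              , C.at-inj s j≤ z≤n (trans eq′ (sym (C.at-0 s))))
          ; (inj₂ (eq , eq′)) → inj₂
              ( C.at-inj r i≤ ≤-refl (trans eq (sym (C.at-ℓ r)))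
              , C.at-inj s j≤ ≤-refl (trans eq′ (sym (C.at-ℓ s)))) }
          where
          i≤ = s≤s⁻¹ (toℕ<n i)
          j≤ = s≤s⁻¹ (toℕ<n j)

      wheel : ∀ i j k → i ≢ j → i ≢ k → j ≢ k → p i ≡ q i → ⊥
      wheel i j k i≢j i≢k j≢k eq = FourWheel.contra {z = p i} {S = U j} {T = U k}
        (pp i j i≢j) (subst (_~ q j) (sym eq) (qq i j i≢j))
        (pp i k i≢k) (subst (_~ q k) (sym eq) (qq i k i≢k))
        (pp j k j≢k) (qq j k j≢k)
        (one i j i≢j eq) (one i k i≢k eq) (ρ j) (ρ k)
        (λ s → proj₁ (edges i j i≢j (source (ρ i)) s) refl)
        (λ s → proj₁ (edges i k i≢k (source (ρ i)) s) refl)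
        (λ s e → [ inj₁ ∘ proj₂ , inj₂ ∘ proj₂ ]′ (proj₂ (edges i j i≢j (source (ρ i)) s) e))
        (λ s e → [ inj₁ ∘ proj₂ , inj₂ ∘ proj₂ ]′ (proj₂ (edges i k i≢k (source (ρ i)) s) e))
        (edges j k j≢k)

    no-linked-triangles : ⊥
    no-linked-triangles
      with p fz Finₚ.≟ q fz | p (fs fz) Finₚ.≟ q (fs fz) | p (fs (fs fz)) Finₚ.≟ q (fs (fs fz))
    ... | yes eq | _ | _ = wheel fz (fs fz) (fs (fs fz)) (λ ()) (λ ()) (λ ()) eq
    ... | _ | yes eq | _ = wheel (fs fz) fz (fs (fs fz)) (λ ()) (λ ()) (λ ()) eq
    ... | _ | _ | yes eq = wheel (fs (fs fz)) fz (fs fz) (λ ()) (λ ()) (λ ()) eq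
    ... | no n₁ | no n₂ | no n₃ = prism λ { fz → n₁ ; (fs fz) → n₂ ; (fs (fs fz)) → n₃ }

-- X plays the role of N(x), and D the part of the graph in which routes from X continue.
record Apex (G : Graph) : Set₁ where
  open Basics G
  field
    inC      : InC G
    x        : V G
    D X      : Sub
    x~X      : ∀ {u} → X u → x ~ u
    X-stable : ∀ {u v} → X u → X v → ¬ (u ~ v)
    X-no-hub : ∀ {u} → X u → ¬ IsHub G u
    x∉D      : ∀ {u} → D u → x ≢ u × ¬ (x ~ u)
    D-one-X  : ∀ {d u v} → D d → X u → X v → d ~ u → d ~ v → u ≡ v

-- A vertex that sees an induced path closed up through `x`

module Touching (G : Graph) (𝒜 : Apex G) where
  open Basics G public
  open Apex 𝒜 public
  open Forbidden G inC public

  D∩X : ∀ {u v} → D u → X v → u ≢ v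
  D∩X d xv refl = proj₂ (x∉D d) (x~X xv)

  -- A link from v to x whose last vertex o is the only neighbour of x in S.
  record Arm (v : V G) (S : Sub) : Set where
    field
      p o    : V G
      v~p    : v ~ p
      reach  : Reach S p o
      x~o    : x ~ o
      unique : ∀ {u} → S u → x ~ u → u ≡ o
      x∉     : ¬ S x

  module _ {T a b} (F : Chain T a b) where
    open Chain F

    -- F, O₁ and O₂ close up to a hole through x, and s has its own route to x through Λ. If s had
    -- one neighbour f on F, then f and x would span a theta; if s had two non-adjacent ones, then
    -- s and x would, unless s is itself a neighbour of x, and then s would be a hub.
    module Touch {O₁ O₂ Λ : Sub} (A₁ : Arm a O₁) (A₂ : Arm b O₂)
      (x∉F : ∀ {i} → i ≤ ℓ → x ≢ at i × ¬ (x ~ at i))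
      (O₁O₂ : Apart O₁ O₂)
      (O₁F : ∀ {i u} → i ≤ ℓ → O₁ u → u ≢ at i × (u ~ at i → i ≡ 0))
      (O₂F : ∀ {i u} → i ≤ ℓ → O₂ u → u ≢ at i × (u ~ at i → i ≡ ℓ))
      (ΛO₁ : Apart Λ O₁) (ΛO₂ : Apart Λ O₂)
      (ΛF : ∀ {i u} → i ≤ ℓ → Λ u → u ≢ at i × ¬ (u ~ at i))
      (x∉Λ : ¬ Λ x)
      {s : V G} (s∉F : ∀ {i} → i ≤ ℓ → s ≢ at i) (x≢s : x ≢ s)
      (sO₁ : Apart ｛ s ｝ O₁) (sO₂ : Apart ｛ s ｝ O₂)
      (leg : (¬ (x ~ s) × Link Λ s x × ¬ Λ s) ⊎ (x ~ s × ¬ IsHub G s))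
      where

      private
        module A₁ = Arm A₁
        module A₂ = Arm A₂

        L R : ℕ → Sub
        L i v = (∃[ j ] j < i × j ≤ ℓ × at j ≡ v) ⊎ O₁ v
        R i v = (∃[ j ] i < j × j ≤ ℓ × at j ≡ v) ⊎ O₂ v

        LR : ∀ {i k} → i ≤ k → k ≤ ℓ → Apart (L i) (R k)
        LR i≤k k≤ (inj₁ (j , j<i , j≤ , refl)) (inj₁ (j′ , k<j′ , j′≤ , refl)) =
          (λ eq → <⇒≢ (≤-trans j<i (≤-trans i≤k (<⇒≤ k<j′))) (at-inj j≤ j′≤ eq)) ,
          (λ e → case at-adj j≤ j′≤ e of λ
            { (inj₁ refl) → <⇒≱ k<j′ (≤-trans j<i i≤k)
            ; (inj₂ refl) → <⇒≱ (≤-trans j<i i≤k) (≤-trans (<⇒≤ k<j′) (n≤1+n _)) })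
        LR i≤k k≤ (inj₁ (j , j<i , j≤ , refl)) (inj₂ o) =
          ≢-sym (proj₁ (O₂F j≤ o)) ,
          λ e → <⇒≢ (≤-trans j<i (≤-trans i≤k k≤)) (proj₂ (O₂F j≤ o) (~-sym e))
        LR i≤k k≤ (inj₂ o) (inj₁ (j′ , k<j′ , j′≤ , refl)) =
          proj₁ (O₁F j′≤ o) , λ e → <⇒≢ (≤-trans (s≤s z≤n) k<j′) (sym (proj₂ (O₁F j′≤ o) e))
        LR i≤k k≤ (inj₂ o) (inj₂ o′) = O₁O₂ o o′

        L-mono : ∀ {i k} → i ≤ k → L i ⊆ L k
        L-mono i≤k (inj₁ (j , j<i , w)) = inj₁ (j , ≤-trans j<i i≤k , w)
        L-mono i≤k (inj₂ o) = inj₂ o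

        R-mono : ∀ {i k} → i ≤ k → R k ⊆ R i
        R-mono i≤k (inj₁ (j , k<j , w)) = inj₁ (j , ≤-trans (s≤s i≤k) k<j , w)
        R-mono i≤k (inj₂ o) = inj₂ o

        linkL : ∀ {i} → i ≤ ℓ → Link (L i) (at i) x
        linkL {zero} _ = A₁.p , A₁.o , subst (_~ A₁.p) (sym at-0) A₁.v~p ,
          Reach-mono inj₂ A₁.reach , ~-sym A₁.x~o
        linkL {suc i} i< = extend (L-mono (n≤1+n i)) (inj₁ (i , ≤-refl , <⇒≤ i< , refl))
          (~-sym (link i<)) (linkL (<⇒≤ i<))

        linkR : ∀ {i} d → i + d ≡ ℓ → Link (R i) (at i) x
        linkR {i} zero eq = A₂.p , A₂.o ,
          subst (_~ A₂.p) (sym (trans (cong at (trans (sym (+-identityʳ i)) eq)) at-ℓ)) A₂.v~p ,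
          Reach-mono inj₂ A₂.reach , ~-sym A₂.x~o
        linkR {i} (suc d) eq = extend (R-mono (n≤1+n i)) (inj₁ (suc i , ≤-refl , i< , refl))
          (link i<) (linkR d (trans (sym (+-suc i d)) eq))
          where
          i< : i < ℓ
          i< = ≤-trans (m≤m+n (suc i) d) (≤-reflexive (trans (sym (+-suc i d)) eq))

        linkR′ : ∀ {i} → i ≤ ℓ → Link (R i) (at i) x
        linkR′ {i} i≤ = linkR (ℓ ∸ i) (m+[n∸m]≡n i≤)

        x∉L : ∀ {i} → ¬ L i x
        x∉L (inj₁ (j , _ , j≤ , eq)) = proj₁ (x∉F j≤) (sym eq)
        x∉L (inj₂ o) = A₁.x∉ o

        x∉R : ∀ {i} → ¬ R i x
        x∉R (inj₁ (j , _ , j≤ , eq)) = proj₁ (x∉F j≤) (sym eq)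
        x∉R (inj₂ o) = A₂.x∉ o

        at∉L : ∀ {i} → i ≤ ℓ → ¬ L i (at i)
        at∉L i≤ (inj₁ (j , j<i , j≤ , eq)) = <⇒≢ j<i (at-inj j≤ i≤ eq)
        at∉L i≤ (inj₂ o) = proj₁ (O₁F i≤ o) refl

        at∉R : ∀ {i} → i ≤ ℓ → ¬ R i (at i)
        at∉R i≤ (inj₁ (j , i<j , j≤ , eq)) = <⇒≢ i<j (sym (at-inj j≤ i≤ eq))
        at∉R i≤ (inj₂ o) = proj₁ (O₂F i≤ o) refl

        s∉L : ∀ {i} → ¬ L i s
        s∉L (inj₁ (j , _ , j≤ , eq)) = s∉F j≤ (sym eq)
        s∉L (inj₂ o) = proj₁ (sO₁ refl o) refl

        s∉R : ∀ {i} → ¬ R i s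
        s∉R (inj₁ (j , _ , j≤ , eq)) = s∉F j≤ (sym eq)
        s∉R (inj₂ o) = proj₁ (sO₂ refl o) refl

        LΛ : ∀ {i} → Apart (L i) Λ
        LΛ (inj₁ (j , _ , j≤ , refl)) λu = ≢-sym (proj₁ (ΛF j≤ λu)) , proj₂ (ΛF j≤ λu) ∘ ~-sym
        LΛ (inj₂ o) λu = Apart-sym ΛO₁ o λu

        RΛ : ∀ {i} → Apart (R i) Λ
        RΛ (inj₁ (j , _ , j≤ , refl)) λu = ≢-sym (proj₁ (ΛF j≤ λu)) , proj₂ (ΛF j≤ λu) ∘ ~-sym
        RΛ (inj₂ o) λu = Apart-sym ΛO₂ o λu

        at≢x : ∀ {i} → i ≤ ℓ → at i ≢ x
        at≢x i≤ = ≢-sym (proj₁ (x∉F i≤))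

        at≁x : ∀ {i} → i ≤ ℓ → ¬ (at i ~ x)
        at≁x i≤ = proj₂ (x∉F i≤) ∘ ~-sym

        no-single : ∀ {i} → i ≤ ℓ → s ~ at i →
                    (∀ {j} → j ≤ ℓ → s ~ at j → j ≡ i) → ⊥
        no-single {i} i≤ si only = no-theta₃ (at≢x i≤) (at≁x i≤)
          {L i} {R i} {｛ s ｝ ∪ Λ}
          (linkL i≤ , at∉L i≤ , x∉L) (linkR′ i≤ , at∉R i≤ , x∉R)
          (leg-link leg , [ s∉F i≤ , (λ u → proj₁ (ΛF i≤ u) refl) ]′ ,
            [ ≢-sym x≢s , x∉Λ ]′)
          (LR ≤-refl i≤) (Apart-∪ʳ (Apart-sym sL) LΛ) (Apart-∪ʳ (Apart-sym sR) RΛ)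
          where
          leg-link : (¬ (x ~ s) × Link Λ s x × ¬ Λ s) ⊎ (x ~ s × ¬ IsHub G s) →
                     Link (｛ s ｝ ∪ Λ) (at i) x
          leg-link (inj₁ (_ , l , _)) = extend inj₂ (inj₁ refl) (~-sym si) l
          leg-link (inj₂ (xs , _)) = s , s , ~-sym si , stop (inj₁ refl) , ~-sym xs
          sL : Apart ｛ s ｝ (L i)
          sL refl (inj₁ (j , j<i , j≤ , refl)) = s∉F j≤ , λ e → <⇒≢ j<i (only j≤ e)
          sL refl (inj₂ o) = sO₁ refl o
          sR : Apart ｛ s ｝ (R i)
          sR refl (inj₁ (j , i<j , j≤ , refl)) = s∉F j≤ , λ e → <⇒≢ i<j (sym (only j≤ e))
          sR refl (inj₂ o) = sO₂ refl o

        M : Sub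
        M v = L (suc ℓ) v ⊎ O₂ v

        around : ∀ {i} → i ≤ ℓ → ∀ {v} → M v → L i v ⊎ (v ≡ at i ⊎ R i v)
        around {i} i≤ (inj₁ (inj₁ (j , _ , j≤ , refl))) with <-cmp j i
        ... | tri< j<i _ _ = inj₁ (inj₁ (j , j<i , j≤ , refl))
        ... | tri≈ _ refl _ = inj₂ (inj₁ refl)
        ... | tri> _ _ i<j = inj₂ (inj₂ (inj₁ (j , i<j , j≤ , refl)))
        around i≤ (inj₁ (inj₂ o)) = inj₁ (inj₂ o)
        around i≤ (inj₂ o) = inj₂ (inj₂ (inj₂ o))

        C : Chain M A₁.o A₂.o
        C = shortcut (Reach-trans
          (Reach-sym (step at0∈M (subst (_~ A₁.p) (sym at-0) A₁.v~p)
            (Reach-mono (inj₁ ∘ inj₂) A₁.reach)))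
          (Reach-trans
            (Reach-mono (λ { (j , _ , j≤ , eq) → inj₁ (inj₁ (j , s≤s j≤ , j≤ , eq)) })
              (Seg-reach F {0} {ℓ} ℓ z≤n z≤n ≤-refl ≤-refl))
            (step (inj₁ (inj₁ (ℓ , ≤-refl , ≤-refl , refl)))
              (subst (_~ A₂.p) (sym at-ℓ) A₂.v~p) (Reach-mono inj₂ A₂.reach))))
          where
          at0∈M : M (at 0)
          at0∈M = inj₁ (inj₁ (0 , s≤s z≤n , z≤n , refl))
        module C = Chain C

        ends : ∀ {i} → i ≤ C.ℓ → x ~ C.at i → i ≡ 0 ⊎ i ≡ C.ℓ
        ends i≤ e with C.inS i≤
        ... | inj₁ (inj₁ (j , _ , j≤ , eq)) =
          contradiction (subst (x ~_) (sym eq) e) (proj₂ (x∉F j≤))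
        ... | inj₁ (inj₂ o) = inj₁ (C.at-inj i≤ z≤n (trans (A₁.unique o e) (sym C.at-0)))
        ... | inj₂ o = inj₂ (C.at-inj i≤ ≤-refl (trans (A₂.unique o e) (sym C.at-ℓ)))

        x∉C : ∀ {i} → i ≤ C.ℓ → x ≢ C.at i
        x∉C i≤ eq with C.inS i≤
        ... | inj₁ l = x∉L (subst (L (suc ℓ)) (sym eq) l)
        ... | inj₂ o = A₂.x∉ (subst O₂ (sym eq) o)

        H : Hole G
        H = closeHole C
          (2≤length C (proj₁ (O₁O₂ (target A₁.reach) (target A₂.reach)))
            (proj₂ (O₁O₂ (target A₁.reach) (target A₂.reach))))
          A₁.x~o A₂.x~o ends x∉C

        s∉H : ∀ i → hvtx H i ≢ s
        s∉H fz eq = x≢s eq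
        s∉H (fs i) eq with C.inS (s≤s⁻¹ (toℕ<n i))
        ... | inj₁ l = s∉L (subst (L (suc ℓ)) eq l)
        ... | inj₂ o = proj₁ (sO₂ refl o) (sym eq)

        -- Although `C` arises by shortcutting, it cannot skip `at i`: without that vertex `M` falls
        -- into the anticomplete sets `L i` and `R i`.
        position : ∀ {i} → i ≤ ℓ → ∃[ k ] hvtx H (fs k) ≡ at i
        position i≤ with visits C (around i≤) (LR ≤-refl i≤)
                           (inj₂ (target A₁.reach)) (inj₂ (target A₂.reach))
        ... | k , k≤ , eq = fromℕ< (s≤s k≤) , trans (cong C.at (toℕ-fromℕ< (s≤s k≤))) eq

        spread-hub : ∀ {i k} → i ≤ ℓ → k ≤ ℓ → x ~ s → s ~ at i → s ~ at k →
                     at i ≢ at k → ¬ (at i ~ at k) → IsHub G s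
        spread-hub {i} {k} i≤ k≤ xs si sk i≢k i≁k
          with position i≤ | position k≤
        ... | m , eq | m′ , eq′ = stable-triple⇒hub H s s∉H (three fz (fs m) (fs m′))
          (λ { fz → ~-sym xs ; (fs fz) → subst (s ~_) (sym eq) si
             ; (fs (fs fz)) → subst (s ~_) (sym eq′) sk })
          (pairs {R = λ i j → three fz (fs m) (fs m′) i ≢ three fz (fs m) (fs m′) j ×
                              ¬ (hvtx H (three fz (fs m) (fs m′) i) ~ hvtx H (three fz (fs m) (fs m′) j))}
            (λ (n , e) → ≢-sym n , e ∘ ~-sym)
            ((λ ()) , subst (λ v → ¬ (x ~ v)) (sym eq) (proj₂ (x∉F i≤)))
            ((λ ()) , subst (λ v → ¬ (x ~ v)) (sym eq′) (proj₂ (x∉F k≤)))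
            ((λ e → i≢k (trans (sym eq) (trans (cong (hvtx H) e) eq′))) ,
              λ e → i≁k (subst (_~ at k) eq (subst (hvtx H (fs m) ~_) eq′ e))))

        -- `i` and `suc k` are at least two apart, which makes `L (suc i)` and `R k` anticomplete
        -- although they contain `at i` and `at (suc k)`.
        no-spread : ∀ {i k} → suc i ≤ k → suc k ≤ ℓ → s ~ at i → s ~ at (suc k) →
                    ((¬ (x ~ s) × Link Λ s x × ¬ Λ s) ⊎ (x ~ s × ¬ IsHub G s)) → ⊥
        no-spread {i} {k} i<k k<ℓ si sk (inj₁ (x≁s , lΛ , s∉Λ)) =
          no-theta₃ (≢-sym x≢s) (x≁s ∘ ~-sym) {L (suc i)} {R k} {Λ}
            (extend (L-mono (n≤1+n i)) (inj₁ (i , ≤-refl , i≤ , refl)) si (linkL i≤) , s∉L , x∉L)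
            (extend (R-mono (n≤1+n k)) (inj₁ (suc k , ≤-refl , k<ℓ , refl)) sk (linkR′ k<ℓ) , s∉R , x∉R)
            (lΛ , s∉Λ , x∉Λ)
            (LR i<k (<⇒≤ k<ℓ)) LΛ RΛ
          where
          i≤ : i ≤ ℓ
          i≤ = ≤-trans (n≤1+n i) (≤-trans i<k (<⇒≤ k<ℓ))
        no-spread {i} {k} i<k k<ℓ si sk (inj₂ (xs , ¬hub)) =
          ¬hub (spread-hub i≤ k<ℓ xs si sk
            (proj₁ (LR {suc i} {k} i<k (<⇒≤ k<ℓ) (inj₁ (i , ≤-refl , i≤ , refl)) k∈))
            (proj₂ (LR {suc i} {k} i<k (<⇒≤ k<ℓ) (inj₁ (i , ≤-refl , i≤ , refl)) k∈)))
          where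
          i≤ : i ≤ ℓ
          i≤ = ≤-trans (n≤1+n i) (≤-trans i<k (<⇒≤ k<ℓ))
          k∈ : R k (at (suc k))
          k∈ = inj₁ (suc k , ≤-refl , k<ℓ , refl)

      -- Only the first and the last vertex seen by `s` are compared: they can neither coincide nor
      -- be further apart than one step, which leaves no room for others.
      two-consecutive : ∃[ j ] j ≤ ℓ × s ~ at j →
        ∃[ i ] i < ℓ × s ~ at i × s ~ at (suc i) ×
               (∀ {j} → j ≤ ℓ → s ~ at j → j ≡ i ⊎ j ≡ suc i)
      two-consecutive (j , j≤ , sj)
        with firstIndex (λ i → E-dec G s (at i)) j sj | lastIndex (λ i → E-dec G s (at i)) ℓ (j , j≤ , sj)
      ... | i , i≤j , si , before | k , k≤ , sk , after = conclude k k≤ sk after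
        where
        i≤ : i ≤ ℓ
        i≤ = ≤-trans i≤j j≤
        conclude : ∀ k → k ≤ ℓ → s ~ at k → (∀ {m} → k < m → m ≤ ℓ → ¬ (s ~ at m)) → _
        conclude k k≤ sk after with <-cmp k i
        ... | tri< k<i _ _ = contradiction si (after k<i i≤)
        ... | tri≈ _ refl _ = ⊥-elim (no-single i≤ si λ {m} m≤ sm →
          ≤-antisym (≮⇒≥ λ i<m → after i<m m≤ sm) (≮⇒≥ λ m<i → before m<i sm))
        conclude (suc k) k≤ sk after | tri> _ _ (s≤s i≤k) with m≤n⇒m<n∨m≡n i≤k
        ... | inj₁ i<k = ⊥-elim (no-spread i<k k≤ si sk leg)
        ... | inj₂ refl = i , k≤ , si , sk , λ {m} m≤ sm → between m≤ sm
          where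
          between : ∀ {m} → m ≤ ℓ → s ~ at m → m ≡ i ⊎ m ≡ suc i
          between {m} m≤ sm with <-cmp m i
          ... | tri< m<i _ _ = contradiction sm (before m<i)
          ... | tri≈ _ eq _ = inj₁ eq
          ... | tri> _ _ i<m =
            inj₂ (≤-antisym (≮⇒≥ λ 1+i<m → after 1+i<m m≤ sm) i<m)

-- Routes meeting in a triangle, and two sides with three common neighbours

module Junctions (G : Graph) (𝒜 : Apex G) where
  open Touching G 𝒜 public

  infixl 6 _∖_
  _∖_ : Sub → V G → Sub
  (S ∖ u) v = S v × v ≢ u

  -- Half of a prism: three routes that leave a triangle and have no other edges between them.
  -- `Bound` records where the routes run, which is needed to fit two halves together.
  record Tri (u : Fin 3 → V G) (Bound : Fin 3 → Sub) : Set₁ where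
    field
      p     : Fin 3 → V G
      W     : Fin 3 → Sub
      adj   : ∀ i j → i ≢ j → p i ~ p j
      reach : ∀ i → Reach (W i) (p i) (u i)
      bound : ∀ i → W i ⊆ Bound i
      excl  : ∀ i j → i ≢ j → ∀ {v w} → W i v → W j w →
              v ≢ w × (v ~ w → v ≡ p i × w ≡ p j)

  -- The omitted ends allow arms to be attached later: a vertex whose only neighbour in `R` is `u₁`
  -- sees nothing of the second route, and nothing of the third within `R`; likewise for `u₂`.
  JunctionBound : Sub → V G → V G → V G → Fin 3 → Sub
  JunctionBound R u₁ u₂ u₃ = three (λ v → R v × v ≢ u₂) (λ v → R v × v ≢ u₁)
                                   (λ v → (R v ⊎ v ≡ u₃) × v ≢ u₁ × v ≢ u₂)

  -- Three routes to x that meet in R meet in a triangle: take an induced path of R from u₁ to u₂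
  -- and the first vertex that sees it on a path from u₃.
  module _ {R O₁ O₂ : Sub} {u₁ u₂ u₃ : V G}
    (ρ : Reach R u₁ u₂) (u₁≢u₂ : u₁ ≢ u₂)
    (x∉R : ∀ {v} → R v → x ≢ v × ¬ (x ~ v))
    (A₁ : Arm u₁ O₁) (A₂ : Arm u₂ O₂) (O₁O₂ : Apart O₁ O₂)
    (O₁R : ∀ {u v} → O₁ u → R v → u ≢ v × (u ~ v → v ≡ u₁))
    (O₂R : ∀ {u v} → O₂ u → R v → u ≢ v × (u ~ v → v ≡ u₂))
    (Xu₃ : X u₃) (u₃∉R : ∀ {v} → R v → u₃ ≢ v)
    (u₃O₁ : Apart ｛ u₃ ｝ O₁) (u₃O₂ : Apart ｛ u₃ ｝ O₂)
    {r} (u₃~r : u₃ ~ r) (σ : Reach R r u₁)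
    where

    private
      F : Chain R u₁ u₂
      F = shortcut ρ
      module F = Chain F

      Γ : Chain (R ∪ ｛ u₃ ｝) u₃ u₁
      Γ = shortcut (step (inj₂ refl) u₃~r (Reach-mono inj₁ σ))
      module Γ = Chain Γ

      Hit : ℕ → Set
      Hit i = ∃[ j ] j < suc F.ℓ × Γ.at i ~ F.at j

      Hit? : ∀ i → Dec (Hit i)
      Hit? i = anyUpTo? (λ j → E-dec G (Γ.at i) (F.at j)) (suc F.ℓ)

      module Hitting (m : ℕ) (m< : m < Γ.ℓ) (hit : Hit m) (before : ∀ {i} → i < m → ¬ Hit i) where

        -- A vertex of `Γ` on `F` would make its predecessor an earlier hit.
        Γ∉F : ∀ {i j} → i ≤ m → j ≤ F.ℓ → Γ.at i ≢ F.at j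
        Γ∉F {zero} _ j≤ eq = u₃∉R (F.inS j≤) (trans (sym Γ.at-0) eq)
        Γ∉F {suc i} {j} i<m j≤ eq = before i<m
          (j , s≤s j≤ , subst (Γ.at i ~_) eq (Γ.link (≤-trans i<m (<⇒≤ m<))))

        -- Within `R` the arm sees only the end `u` of `F`, and `Γ` has not reached `F` by index
        -- `m`.
        Γ-apart : ∀ {O u j} → j ≤ F.ℓ → F.at j ≡ u → (∀ {v w} → O v → R w → v ≢ w × (v ~ w → w ≡ u)) →
                  Apart ｛ u₃ ｝ O → ∀ {i v} → i ≤ m → O v → Γ.at i ≢ v × ¬ (Γ.at i ~ v)
        Γ-apart j≤ at-j OR u₃O {i} i≤ o with Γ.inS (≤-trans i≤ (<⇒≤ m<))
        ... | inj₁ r = ≢-sym (proj₁ (OR o r)) , λ e →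
          Γ∉F i≤ j≤ (trans (proj₂ (OR o r) (~-sym e)) (sym at-j))
        ... | inj₂ eq = subst (λ w → w ≢ _ × ¬ (w ~ _)) eq (u₃O refl o)

        x≢Γ : ∀ {i} → i ≤ m → x ≢ Γ.at i
        x≢Γ i≤ with Γ.inS (≤-trans i≤ (<⇒≤ m<))
        ... | inj₁ r  = proj₁ (x∉R r)
        ... | inj₂ eq = λ eq′ → ~⇒≢ (x~X Xu₃) (trans eq′ (sym eq))

        Λ : Sub
        Λ v = ∃[ i ] i < m × Γ.at i ≡ v

        s : V G
        s = Γ.at m

        leg : ∀ m′ → m′ ≡ m → (¬ (x ~ s) × Link Λ s x × ¬ Λ s) ⊎ (x ~ s × ¬ IsHub G s)
        -- With `m` zero, `s` is `u₃`, a member of `X`, so it needs no route of its own but must not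
        -- be a hub.
        leg zero refl = inj₂ (subst (λ v → x ~ v × ¬ IsHub G v) (sym Γ.at-0) (x~X Xu₃ , X-no-hub Xu₃))
        leg (suc k) refl = inj₁ (x≁s (Γ.inS (<⇒≤ m<)) ,
          (Γ.at k , Γ.at 0 , ~-sym (Γ.link (<⇒≤ m<)) ,
           Reach-mono (λ { (i , _ , i≤ , eq) → i , s≤s i≤ , eq })
             (Reach-sym (Seg-reach Γ {0} k z≤n z≤n ≤-refl (≤-trans (n≤1+n k) (<⇒≤ m<)))) ,
           subst (_~ x) (sym Γ.at-0) (~-sym (x~X Xu₃))) ,
          λ { (i , i< , eq) → <⇒≢ i< (Γ.at-inj (≤-trans (<⇒≤ i<) (<⇒≤ m<)) (<⇒≤ m<) eq) })
          where
          x≁s : (R ∪ ｛ u₃ ｝) s → ¬ (x ~ s)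
          x≁s (inj₁ r) = proj₂ (x∉R r)
          x≁s (inj₂ eq) _ = case Γ.at-inj z≤n (<⇒≤ m<) (trans Γ.at-0 eq) of λ ()

        triangle : Tri (three u₁ u₂ u₃) (JunctionBound R u₁ u₂ u₃)
        triangle with Touch.two-consecutive F {Λ = Λ} A₁ A₂ (x∉R ∘ F.inS) O₁O₂
          (λ i≤ o → proj₁ (O₁R o (F.inS i≤)) ,
            λ e → F.at-inj i≤ z≤n (trans (proj₂ (O₁R o (F.inS i≤)) e) (sym F.at-0)))
          (λ i≤ o → proj₁ (O₂R o (F.inS i≤)) ,
            λ e → F.at-inj i≤ ≤-refl (trans (proj₂ (O₂R o (F.inS i≤)) e) (sym F.at-ℓ)))
          (λ { (i , i< , refl) o → Γ-apart z≤n F.at-0 O₁R u₃O₁ (<⇒≤ i<) o })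
          (λ { (i , i< , refl) o → Γ-apart ≤-refl F.at-ℓ O₂R u₃O₂ (<⇒≤ i<) o })
          (λ { j≤ (i , i< , refl) → Γ∉F (<⇒≤ i<) j≤ , λ e → before i< (_ , s≤s j≤ , e) })
          (λ { (i , i< , eq) → x≢Γ (<⇒≤ i<) (sym eq) })
          (λ j≤ → Γ∉F ≤-refl j≤) (x≢Γ ≤-refl)
          (λ { refl o → Γ-apart z≤n F.at-0 O₁R u₃O₁ ≤-refl o })
          (λ { refl o → Γ-apart ≤-refl F.at-ℓ O₂R u₃O₂ ≤-refl o })
          (leg m refl)
          (let (j , j< , e) = hit in j , s≤s⁻¹ j< , e)
        ... | i , i<ℓ , si , si′ , only = record
          { p = P ; W = W
          ; adj = pairs {R = λ j k → P j ~ P k} ~-sym (F.link i<ℓ) (~-sym si) (~-sym si′)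
          ; reach = λ
              { fz → subst (Reach W₁ (F.at i)) F.at-0
                       (Reach-sym (Seg-reach F i z≤n z≤n ≤-refl (<⇒≤ i<ℓ)))
              ; (fs fz) → subst (Reach W₂ (F.at (suc i))) F.at-ℓ
                            (Seg-reach F F.ℓ ≤-refl i<ℓ ≤-refl ≤-refl)
              ; (fs (fs fz)) → subst (Reach W₃ s) Γ.at-0
                                 (Reach-sym (Seg-reach Γ m z≤n z≤n ≤-refl (<⇒≤ m<))) }
          ; bound = λ
              { fz (j , _ , j≤ , refl) → F.inS (≤-trans j≤ (<⇒≤ i<ℓ)) ,
                  λ eq → <⇒≢ (≤-trans (s≤s j≤) i<ℓ)
                    (F.at-inj (≤-trans j≤ (<⇒≤ i<ℓ)) ≤-refl (trans eq (sym F.at-ℓ)))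
              ; (fs fz) (j , i<j , j≤ , refl) → F.inS j≤ ,
                  λ eq → <⇒≢ (≤-trans (s≤s z≤n) i<j) (F.at-inj z≤n j≤ (trans F.at-0 (sym eq)))
              ; (fs (fs fz)) (j , _ , j≤ , refl) →
                  [ inj₁ , inj₂ ∘ sym ]′ (Γ.inS (≤-trans j≤ (<⇒≤ m<))) ,
                  (λ eq → Γ∉F j≤ z≤n (trans eq (sym F.at-0))) ,
                  (λ eq → Γ∉F j≤ ≤-refl (trans eq (sym F.at-ℓ))) }
          ; excl = pairs {R = λ j k → ∀ {v w} → W j v → W k w → v ≢ w × (v ~ w → v ≡ P j × w ≡ P k)}
              (λ f a b → ≢-sym (proj₁ (f b a)) ,
                 λ e → let (q , q′) = proj₂ (f b a) (~-sym e) in q′ , q)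
              excl₁₂ excl₁₃ excl₂₃ }
          where
          W₁ W₂ W₃ : Sub
          W₁ = Seg F 0 i
          W₂ = Seg F (suc i) F.ℓ
          W₃ = Seg Γ 0 m
          W : Fin 3 → Sub
          W = three W₁ W₂ W₃
          P : Fin 3 → V G
          P = three (F.at i) (F.at (suc i)) s
          excl₁₂ : ∀ {v w} → W₁ v → W₂ w → v ≢ w × (v ~ w → v ≡ F.at i × w ≡ F.at (suc i))
          excl₁₂ (j , _ , j≤i , refl) (k , i<k , k≤ , refl) =
            (λ eq → <⇒≢ (≤-trans (s≤s j≤i) i<k) (F.at-inj (≤-trans j≤i (<⇒≤ i<ℓ)) k≤ eq)) ,
            (λ e → case F.at-adj (≤-trans j≤i (<⇒≤ i<ℓ)) k≤ e of λ
              { (inj₁ refl) → let j≡i = ≤-antisym j≤i (s≤s⁻¹ i<k) in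
                  cong F.at j≡i , cong (F.at ∘ suc) j≡i
              ; (inj₂ refl) → contradiction (≤-trans i<k (≤-trans (n≤1+n k) j≤i)) (<⇒≱ ≤-refl) })
          with-s : ∀ {j k} → j ≤ F.ℓ → k ≤ m → F.at j ~ Γ.at k → (j ≡ i ⊎ j ≡ suc i) × k ≡ m
          with-s {j} {k} j≤ k≤ e with m≤n⇒m<n∨m≡n k≤
          ... | inj₁ k<m  = contradiction (j , s≤s j≤ , ~-sym e) (before k<m)
          ... | inj₂ refl = only j≤ (~-sym e) , refl
          excl₁₃ : ∀ {v w} → W₁ v → W₃ w → v ≢ w × (v ~ w → v ≡ F.at i × w ≡ s)
          excl₁₃ (j , _ , j≤i , refl) (k , _ , k≤ , refl) =
            ≢-sym (Γ∉F k≤ (≤-trans j≤i (<⇒≤ i<ℓ))) , λ e → case with-s (≤-trans j≤i (<⇒≤ i<ℓ)) k≤ e of λ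
              { (inj₁ refl , refl) → refl , refl
              ; (inj₂ refl , _) → contradiction j≤i (<⇒≱ ≤-refl) }
          excl₂₃ : ∀ {v w} → W₂ v → W₃ w → v ≢ w × (v ~ w → v ≡ F.at (suc i) × w ≡ s)
          excl₂₃ (j , i<j , j≤ , refl) (k , _ , k≤ , refl) =
            ≢-sym (Γ∉F k≤ j≤) , λ e → case with-s j≤ k≤ e of λ
              { (inj₂ refl , refl) → refl , refl
              ; (inj₁ refl , _) → contradiction i<j (<⇒≱ ≤-refl) }

    junction : Tri (three u₁ u₂ u₃) (JunctionBound R u₁ u₂ u₃)
    junction = go Γ.ℓ refl
      where
      go : ∀ l → l ≡ Γ.ℓ → Tri (three u₁ u₂ u₃) (JunctionBound R u₁ u₂ u₃)
      go zero eq = contradiction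
        (trans (sym Γ.at-0) (trans (cong Γ.at eq) Γ.at-ℓ)) (u₃∉R (source ρ))
      -- The last vertex of `Γ` is `u₁`, where `F` begins, so the vertex before it is a hit.
      go (suc n) eq with firstIndex Hit? n (0 , s≤s z≤n ,
        subst (Γ.at n ~_) (trans (trans (cong Γ.at eq) Γ.at-ℓ) (sym F.at-0)) (Γ.link (≤-reflexive eq)))
      ... | m , m≤n , hit , before =
        Hitting.triangle m (≤-trans (s≤s m≤n) (≤-reflexive eq)) hit before

  Minimal : ∀ {a} → (Sub → Set a) → Sub → Sub → Set (lsuc 0ℓ ⊔ˡ a)
  Minimal Good S M = M ⊆ S × Good M × (∀ T → T ⊆ M → Good T → ∀ {z} → M z → ¬ ¬ T z)

  -- Descent on the length of a list that contains the set: a good subset missing some `z` allows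
  -- `z` to be filtered out of the list.
  minimal : ∀ {a} (Good : Sub → Set a) {S} → Good S → ¬ ¬ Σ Sub (Minimal Good S)
  minimal Good {S} g = go (length (allFin (n G))) S (allFin (n G)) ≤-refl (λ _ → ∈-allFin _) g
    where
    go : ∀ k S vs → length vs ≤ k → (∀ {v} → S v → v ∈ vs) → Good S → ¬ ¬ Σ Sub (Minimal Good S)
    go k S vs short S∈ g done = done (S , id , g , λ T T⊆S gT {z} Sz ¬Tz →
      smaller k short T T⊆S gT Sz ¬Tz)
      where
      smaller : ∀ k → length vs ≤ k → ∀ T → T ⊆ S → Good T → ∀ {z} → S z → ¬ T z → ⊥
      smaller k short T T⊆S gT {z} Sz ¬Tz with
        ≤-trans (filter-notAll (λ v → ¬? (v Finₚ.≟ z)) vs (lose (S∈ Sz) λ z≢z → z≢z refl)) short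
      smaller (suc k) short T T⊆S gT {z} Sz ¬Tz | s≤s short′ =
        go k T (filter (λ v → ¬? (v Finₚ.≟ z)) vs) short′
          (λ Tv → ∈-filter⁺ _ (S∈ (T⊆S Tv)) (λ { refl → ¬Tz Tv })) gT
          (λ (M , M⊆T , rest) → done (M , T⊆S ∘ M⊆T , rest))

  frontier : ∀ {S P : Sub} → (∀ v → Dec (P v)) → ∀ {a b} → Reach S a b → P a → ¬ P b →
             ∃[ u ] ∃[ v ] S u × S v × P u × ¬ P v × u ~ v
  frontier P? (stop _) pa ¬pb = contradiction pa ¬pb
  frontier P? (step {w = w} s e r) pa ¬pb with P? w
  ... | yes pw = frontier P? r pw ¬pb
  ... | no ¬pw = _ , w , s , source r , pa , ¬pw , e

  -- A minimal C ⊆ S ∖ T with S ∖ C connected is a single vertex.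
  non-cut : ∀ {S T : Sub} {t z} → Conn S → Conn T → T ⊆ S → T t → S z → ¬ T z →
            ¬ ¬ (∃[ u ] S u × ¬ T u × Conn (S ∖ u))
  non-cut {S} {T} {t} {z} cS cT T⊆S Tt Sz ¬Tz k = do
    T? ← decide T
    (C , _ , (c , Cc , C⊆ , cSC) , min) ← minimal Good {λ v → S v × ¬ T v}
      (z , (Sz , ¬Tz) , id , λ (s , ¬c) (s′ , ¬c′) →
        Reach-mono (λ w → T⊆S w , λ (_ , ¬Tw) → ¬Tw w) (cT (back T? s ¬c) (back T? s′ ¬c′)))
    C? ← decide C
    let (p , u , Sp , Su , ¬Cp , ¬¬Cu , p~u) =
          frontier {P = λ v → ¬ C v} (λ v → ¬? (C? v)) (cS (T⊆S Tt) (proj₁ (C⊆ Cc)))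
            (λ Ct → proj₂ (C⊆ Ct) Tt) (λ ¬Cc → ¬Cc Cc)
    Cu ← ¬¬Cu
    yes (z′ , Cz′ , z′≢u) ← em {A = ∃[ z′ ] C z′ × z′ ≢ u}
      where no only → k (u , Su , proj₂ (C⊆ Cu) , λ (s , v≢u) (s′ , w≢u) →
              Reach-mono (λ (s″ , ¬c) → s″ , λ { refl → ¬c Cu })
                (cSC (s , λ c → only (_ , c , v≢u)) (s′ , λ c → only (_ , c , w≢u))))
    -- Given back to the complement, `u` is attached to it through `p`, so `C` without `u` would be
    -- a smaller candidate.
    min (λ v → C v × v ≢ u) proj₁
      ( z′ , (Cz′ , z′≢u) , C⊆ ∘ proj₁
      , Conn-via {r = p} λ {v} (s , ¬c) → case v Finₚ.≟ u of λ
          { (yes refl) → step (s , ¬c) (~-sym p~u) (stop (Sp , ¬Cp ∘ proj₁))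
          ; (no v≢u) → Reach-mono (λ (s , ¬c) → s , ¬c ∘ proj₁)
              (cSC (s , λ c → ¬c (c , v≢u)) (Sp , ¬Cp)) })
      Cu λ (_ , u≢u) → u≢u refl
    where
    Good : Sub → Set
    Good C = ∃[ c ] C c × C ⊆ (λ v → S v × ¬ T v) × Conn (λ v → S v × ¬ C v)
    back : (∀ v → Dec (T v)) → ∀ {v} → S v → ¬ (S v × ¬ T v) → T v
    back T? {v} s ¬c with T? v
    ... | yes t = t
    ... | no ¬t = contradiction (s , ¬t) ¬c

  arrange : ∀ (i j : Fin 3) → i ≢ j → ∃[ k ] i ≢ k × j ≢ k ×
            Σ (Fin 3 → Fin 3) λ pos → ∀ l → three i j k (pos l) ≡ l
  arrange fz           fz           i≢j = contradiction refl i≢j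
  arrange fz           (fs fz)      _   = fs (fs fz) , (λ ()) , (λ ()) ,
    three fz (fs fz) (fs (fs fz)) , λ { fz → refl ; (fs fz) → refl ; (fs (fs fz)) → refl }
  arrange fz           (fs (fs fz)) _   = fs fz , (λ ()) , (λ ()) ,
    three fz (fs (fs fz)) (fs fz) , λ { fz → refl ; (fs fz) → refl ; (fs (fs fz)) → refl }
  arrange (fs fz)      fz           _   = fs (fs fz) , (λ ()) , (λ ()) ,
    three (fs fz) fz (fs (fs fz)) , λ { fz → refl ; (fs fz) → refl ; (fs (fs fz)) → refl }
  arrange (fs fz)      (fs fz)      i≢j = contradiction refl i≢j
  arrange (fs fz)      (fs (fs fz)) _   = fz , (λ ()) , (λ ()) ,
    three (fs (fs fz)) fz (fs fz) , λ { fz → refl ; (fs fz) → refl ; (fs (fs fz)) → refl }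
  arrange (fs (fs fz)) fz           _   = fs fz , (λ ()) , (λ ()) ,
    three (fs fz) (fs (fs fz)) fz , λ { fz → refl ; (fs fz) → refl ; (fs (fs fz)) → refl }
  arrange (fs (fs fz)) (fs fz)      _   = fz , (λ ()) , (λ ()) ,
    three (fs (fs fz)) (fs fz) fz , λ { fz → refl ; (fs fz) → refl ; (fs (fs fz)) → refl }
  arrange (fs (fs fz)) (fs (fs fz)) i≢j = contradiction refl i≢j

  module _ (f : Fin 3 → V G) (Xf : ∀ i → X (f i)) (f-inj : ∀ i j → i ≢ j → f i ≢ f j) where

    -- Removing `u` leaves a connected set, so by minimality it must cost some `f i` all its
    -- neighbours in `S`.
    private-vertex : ∀ {S} → S ⊆ D → (∀ i → Touches S (f i)) →
      (∀ T → T ⊆ S → Conn T × (∀ i → Touches T (f i)) → ∀ {z} → S z → ¬ ¬ T z) →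
      ∀ {u} → S u → Conn (S ∖ u) →
      ¬ ¬ (∃[ i ] f i ~ u × (∀ {v} → S v → f i ~ v → v ≡ u))
    private-vertex {S} S⊆D touch min {u} Su c k = ¬¬-∀Fin touches λ all →
      min (S ∖ u) proj₁ (c , all) Su λ (_ , u≢u) → u≢u refl
      where
      touches : ∀ i → ¬ ¬ Touches (S ∖ u) (f i)
      touches i ¬touch = k (i , (case touch i of λ (v , Sv , e) → subst (f i ~_) (only Sv e) e) , only)
        where
        only : ∀ {v} → S v → f i ~ v → v ≡ u
        only {v} Sv e with v Finₚ.≟ u
        ... | yes eq  = eq
        ... | no v≢u = contradiction (v , (Sv , v≢u) , e) ¬touch

    module SpreadTri {S : Sub} (S⊆D : S ⊆ D) {u w : V G} {i j k : Fin 3}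
      (iu : f i ~ u) (only-u : ∀ {v} → S v → f i ~ v → v ≡ u)
      (jw : f j ~ w) (only-w : ∀ {v} → S v → f j ~ v → v ≡ w)
      (i≢j : i ≢ j) (i≢k : i ≢ k) (j≢k : j ≢ k)
      (pos : Fin 3 → Fin 3) (pos-inv : ∀ l → three i j k (pos l) ≡ l) where

      X-apart : ∀ {a b} → a ≢ b → f a ≢ f b × ¬ (f a ~ f b)
      X-apart a≢b = f-inj _ _ a≢b , X-stable (Xf _) (Xf _)

      arm : ∀ {a v} → v ~ f a → Arm v ｛ f a ｝
      arm {a} e = record
        { p = f a ; o = f a ; v~p = e ; reach = stop refl ; x~o = x~X (Xf a)
        ; unique = λ { refl _ → refl } ; x∉ = λ { refl → E-irr G (x~X (Xf a)) } }

      triangle : Conn S → Touches S (f k) → u ≢ w → S u → S w →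
                 Tri (three u w (f k)) (JunctionBound S u w (f k))
      triangle cS touch u≢w Su Sw = junction {O₁ = ｛ f i ｝} {O₂ = ｛ f j ｝} (cS Su Sw) u≢w (x∉D ∘ S⊆D)
        (arm (~-sym iu)) (arm (~-sym jw))
        (λ { refl refl → X-apart i≢j })
        (λ { refl s → ≢-sym (D∩X (S⊆D s) (Xf i)) , only-u s })
        (λ { refl s → ≢-sym (D∩X (S⊆D s) (Xf j)) , only-w s })
        (Xf k) (λ s → ≢-sym (D∩X (S⊆D s) (Xf k)))
        (λ { refl refl → X-apart (≢-sym i≢k) }) (λ { refl refl → X-apart (≢-sym j≢k) })
        (proj₂ (proj₂ touch)) (cS (proj₁ (proj₂ touch)) Su)

      module Extended (T : Tri (three u w (f k)) (JunctionBound S u w (f k))) where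
        module T = Tri T

        W : Fin 3 → Sub
        W = three (T.W fz ∪ ｛ f i ｝) (T.W (fs fz) ∪ ｛ f j ｝) (T.W (fs (fs fz)))

        excl : ∀ a b → a ≢ b → ∀ {v v′} → W a v → W b v′ → v ≢ v′ × (v ~ v′ → v ≡ T.p a × v′ ≡ T.p b)
        excl = pairs
          {R = λ a b → ∀ {v v′} → W a v → W b v′ → v ≢ v′ × (v ~ v′ → v ≡ T.p a × v′ ≡ T.p b)}
          (λ h a b → ≢-sym (proj₁ (h b a)) ,
             λ e → let (q , q′) = proj₂ (h b a) (~-sym e) in q′ , q)
          (λ { (inj₁ a) (inj₁ b) → T.excl _ _ (λ ()) a b
             ; (inj₁ a) (inj₂ refl) → let (s , v≢w) = T.bound fz a in
                 D∩X (S⊆D s) (Xf j) , λ e → contradiction (only-w s (~-sym e)) v≢w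
             ; (inj₂ refl) (inj₁ b) → let (s , v≢u) = T.bound (fs fz) b in
                 ≢-sym (D∩X (S⊆D s) (Xf i)) , λ e → contradiction (only-u s e) v≢u
             ; (inj₂ refl) (inj₂ refl) → let (ne , na) = X-apart i≢j in ne , λ e → contradiction e na })
          (λ { (inj₁ a) b → T.excl _ _ (λ ()) a b
             ; (inj₂ refl) b → case T.bound (fs (fs fz)) b of λ
                 { (inj₁ s , v≢u , _) → ≢-sym (D∩X (S⊆D s) (Xf i)) , λ e → contradiction (only-u s e) v≢u
                 ; (inj₂ refl , _) → let (ne , na) = X-apart i≢k in ne , λ e → contradiction e na } })
          (λ { (inj₁ a) b → T.excl _ _ (λ ()) a b
             ; (inj₂ refl) b → case T.bound (fs (fs fz)) b of λ
                 { (inj₁ s , _ , v≢w) → ≢-sym (D∩X (S⊆D s) (Xf j)) , λ e → contradiction (only-w s e) v≢w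
                 ; (inj₂ refl , _) → let (ne , na) = X-apart j≢k in ne , λ e → contradiction e na } })

        reach : ∀ a → Reach (W a) (T.p a) (f (three i j k a))
        reach fz           = snoc (Reach-mono inj₁ (T.reach fz)) (~-sym iu) (inj₂ refl)
        reach (fs fz)      = snoc (Reach-mono inj₁ (T.reach (fs fz))) (~-sym jw) (inj₂ refl)
        reach (fs (fs fz)) = T.reach (fs (fs fz))

        bound : ∀ a → W a ⊆ (S ∪ ｛ f (three i j k a) ｝)
        bound fz           (inj₁ w) = inj₁ (proj₁ (T.bound fz w))
        bound fz           (inj₂ w) = inj₂ w
        bound (fs fz)      (inj₁ w) = inj₁ (proj₁ (T.bound (fs fz) w))
        bound (fs fz)      (inj₂ w) = inj₂ w
        bound (fs (fs fz)) w = [ inj₁ , inj₂ ∘ sym ]′ (proj₁ (T.bound (fs (fs fz)) w))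

        pos-inj : ∀ {a b} → a ≢ b → pos a ≢ pos b
        pos-inj {a} {b} a≢b eq =
          a≢b (trans (sym (pos-inv a)) (trans (cong (three i j k) eq) (pos-inv b)))

        result : Tri f (λ a → S ∪ ｛ f a ｝)
        result = record
          { p = T.p ∘ pos ; W = W ∘ pos
          ; adj = λ a b a≢b → T.adj _ _ (pos-inj a≢b)
          ; reach = λ a → subst (λ l → Reach (W (pos a)) (T.p (pos a)) (f l)) (pos-inv a) (reach (pos a))
          ; bound = λ a {v} w → subst (λ l → (S ∪ ｛ f l ｝) v) (pos-inv a) (bound (pos a) w)
          ; excl = λ a b a≢b → excl _ _ (pos-inj a≢b) }

    -- In a minimal connected set touching all f i, two non-cut vertices are each the only
    -- neighbour of some f i, which provides the two arms of the junction.
    spread-tri : ∀ {L} → L ⊆ D → Conn L → (∀ i → Touches L (f i)) →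
                 ¬ ¬ Tri f (λ i → L ∪ ｛ f i ｝)
    spread-tri {L} L⊆D cL touchL k = do
      (S , S⊆L , (cS , touch) , min) ← minimal (λ T → Conn T × (∀ i → Touches T (f i))) {L} (cL , touchL)
      let S⊆D = λ {v} (s : S v) → L⊆D (S⊆L s)
          (a , Sa , fa) = touch fz
          (b , Sb , fb) = touch (fs fz)
          -- A vertex of `D` has at most one neighbour in `X`, so `S` has at least two vertices.
          a≢b = λ (eq : a ≡ b) → f-inj fz (fs fz) (λ ()) (D-one-X (S⊆D Sb) (Xf _) (Xf _)
                  (subst (_~ f fz) eq (~-sym fa)) (~-sym fb))
      (u , Su , a≢u , cSu) ← non-cut cS (Conn-｛｝ {a}) (λ { refl → Sa }) refl Sb a≢b
      -- Now `u` is the vertex to be kept, which makes the second non-cut vertex different from the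
      -- first.
      (w , Sw , u≢w , cSw) ← non-cut cS (Conn-｛｝ {u}) (λ { refl → Su }) refl Sa (a≢u ∘ sym)
      (i , iu , only-u) ← private-vertex S⊆D touch min Su cSu
      (j , jw , only-w) ← private-vertex S⊆D touch min Sw cSw
      let i≢j = λ (eq : i ≡ j) → u≢w (sym (only-u Sw (subst (λ l → f l ~ w) (sym eq) jw)))
          (l , i≢l , j≢l , pos , pos-inv) = arrange i j i≢j
          module S = SpreadTri S⊆D iu only-u jw only-w i≢j i≢l j≢l pos pos-inv
          module T = Tri (S.Extended.result (S.triangle cS (touch l) u≢w Su Sw))
      k record { p = T.p ; W = T.W ; adj = T.adj ; reach = T.reach ; excl = T.excl
               ; bound = λ i → [ inj₁ ∘ S⊆L , inj₂ ]′ ∘ T.bound i }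

    -- Each side contains a triangle with routes to the same three vertices `f i`, and there the
    -- routes of the two sides join.
    no-two-sides : ∀ {L₁ L₂} → L₁ ⊆ D → L₂ ⊆ D → Conn L₁ → Conn L₂ → Apart L₁ L₂ →
      (∀ i → Touches L₁ (f i)) → (∀ i → Touches L₂ (f i)) → ⊥
    no-two-sides {L₁} {L₂} L₁⊆D L₂⊆D c₁ c₂ ap t₁ t₂ = do
      T₁ ← spread-tri L₁⊆D c₁ t₁
      T₂ ← spread-tri L₂⊆D c₂ t₂
      let module P = Tri T₁
          module Q = Tri T₂
          f∈P = λ i → target (P.reach i)
          f∈Q = λ i → target (Q.reach i)
          U = λ i → P.W i ∪ Q.W i
          cross = λ i j (i≢j : i ≢ j) {v} {w} (a : P.W i v) (b : Q.W j w) →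
            across {P = P.W} {Q = Q.W} {P.p} {Q.p} P.excl Q.excl f∈P f∈Q i≢j a b (P.bound i a) (Q.bound j b)
          equal = λ i (eq : P.p i ≡ Q.p i) →
            meet (P.bound i (source (P.reach i)))
              (subst (L₂ ∪ ｛ f i ｝) (sym eq) (Q.bound i (source (Q.reach i))))
      no-linked-triangles P.p Q.p U
        (λ i → Reach-trans (Reach-mono inj₁ (P.reach i)) (Reach-mono inj₂ (Reach-sym (Q.reach i))))
        P.adj Q.adj
        (λ { i j i≢j (inj₁ a) (inj₁ b) → let (ne , h) = P.excl i j i≢j a b in ne , inj₁ ∘ h
           ; i j i≢j (inj₂ a) (inj₂ b) → let (ne , h) = Q.excl i j i≢j a b in ne , inj₂ ∘ h
           ; i j i≢j (inj₁ a) (inj₂ b) → cross i j i≢j a b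
           ; i j i≢j (inj₂ a) (inj₁ b) → let (ne , h) = cross j i (≢-sym i≢j) b a in
               ≢-sym ne , λ e → [ (λ (q , q′) → inj₁ (q′ , q)) , (λ (q , q′) → inj₂ (q′ , q)) ]′
                                  (h (~-sym e)) })
        -- A vertex common to both triangles is `f i`, since the sides are disjoint; two of them
        -- would be adjacent members of `X`.
        (λ i j i≢j eq eq′ → X-stable (Xf i) (Xf j)
          (subst (_~ f j) (equal i eq) (subst (P.p i ~_) (equal j eq′) (P.adj i j i≢j))))
      where
      meet : ∀ {i v} → (L₁ ∪ ｛ f i ｝) v → (L₂ ∪ ｛ f i ｝) v → v ≡ f i
      meet (inj₂ eq) _ = sym eq
      meet _ (inj₂ eq) = sym eq
      meet (inj₁ a) (inj₁ b) = contradiction refl (proj₁ (ap a b))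
      -- Vertices of different sides are anticomplete. Otherwise one of the two is an end `f i` or
      -- `f j`, which belongs to both families of routes, and then the pair falls under `eP` or
      -- `eQ`.
      across : ∀ {P Q : Fin 3 → Sub} {p q : Fin 3 → V G} →
        (∀ i j → i ≢ j → ∀ {v w} → P i v → P j w → v ≢ w × (v ~ w → v ≡ p i × w ≡ p j)) →
        (∀ i j → i ≢ j → ∀ {v w} → Q i v → Q j w → v ≢ w × (v ~ w → v ≡ q i × w ≡ q j)) →
        (∀ i → P i (f i)) → (∀ i → Q i (f i)) → ∀ {i j v w} → i ≢ j → P i v → Q j w →
        (L₁ ∪ ｛ f i ｝) v → (L₂ ∪ ｛ f j ｝) w →
        v ≢ w × (v ~ w → (v ≡ p i × w ≡ p j) ⊎ (v ≡ q i × w ≡ q j))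
      across eP eQ fP fQ i≢j a b (inj₁ l) (inj₁ l′) = let (ne , na) = ap l l′ in ne , λ e → contradiction e na
      across eP eQ fP fQ {j = j} i≢j a b _ (inj₂ refl) = let (ne , h) = eP _ _ i≢j a (fP j) in ne , inj₁ ∘ h
      across eP eQ fP fQ {i = i} i≢j a b (inj₂ refl) _ = let (ne , h) = eQ _ _ i≢j (fQ i) b in ne , inj₂ ∘ h

-- Counting neighbours in `X`; configurations and bypasses

module Configurations (G : Graph) (𝒜 : Apex G) where
  open Junctions G 𝒜 public

  Many : ℕ → Sub → Set
  Many k Q = ∃[ vs ] Unique vs × k ≤ length vs × All Q vs

  Heavy : ℕ → Sub → Set
  Heavy k S = Many k (λ v → X v × Touches S v)

  Many-mono : ∀ {k l Q Q′} → l ≤ k → Q ⊆ Q′ → Many k Q → Many l Q′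
  Many-mono l≤k f (vs , u , k≤ , qs) = vs , u , ≤-trans l≤k k≤ , All.map f qs

  prune : ∀ {k r} {Q : Sub} (Bad : Sub) → Many (r + k) Q → ¬ Many (suc r) (λ v → Q v × Bad v) →
          ¬ ¬ Many k (λ v → Q v × ¬ Bad v)
  prune {k} {r} Bad (vs , u , k≤ , qs) few done = do
    Bad? ← decide Bad
    let bad   = filter Bad? vs
        good  = filter (¬? ∘ Bad?) vs
        short = ≮⇒≥ λ r< → few (bad , Uniqueₚ.filter⁺ Bad? u , r< ,
                  All.zip (Allₚ.filter⁺ Bad? qs , Allₚ.all-filter Bad? vs))
    done (good , Uniqueₚ.filter⁺ (¬? ∘ Bad?) u ,
      +-cancelˡ-≤ r _ _ (≤-trans k≤ (≤-trans (≤-reflexive (length-filter-split Bad? vs))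
        (+-monoˡ-≤ _ short))) ,
      All.zip (Allₚ.filter⁺ (¬? ∘ Bad?) qs , Allₚ.all-filter (¬? ∘ Bad?) vs))

  few-common : ∀ {S T} → S ⊆ D → T ⊆ D → Conn S → Conn T → Apart S T →
               ¬ Many 3 (λ v → X v × Touches S v × Touches T v)
  few-common S⊆D T⊆D cS cT ap (u ∷ v ∷ w ∷ _ , (u≢v ∷ u≢w ∷ _) ∷ (v≢w ∷ _) ∷ _ , _ , a ∷ b ∷ c ∷ _) =
    no-two-sides f (λ i → proj₁ (all i))
      (pairs {R = λ i j → f i ≢ f j} ≢-sym u≢v u≢w v≢w) S⊆D T⊆D cS cT ap
      (λ i → proj₁ (proj₂ (all i))) (λ i → proj₂ (proj₂ (all i)))
    where
    f = three u v w
    all : ∀ i → X (f i) × _ × _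
    all fz           = a
    all (fs fz)      = b
    all (fs (fs fz)) = c
  few-common _ _ _ _ _ (_ ∷ []     , _ , s≤s () , _)
  few-common _ _ _ _ _ (_ ∷ _ ∷ [] , _ , s≤s (s≤s ()) , _)

  few-at : ∀ {d} → D d → ¬ Many 2 (λ v → X v × v ~ d)
  few-at dD (u ∷ v ∷ _ , (u≢v ∷ _) ∷ _ , _ , (Xu , ud) ∷ (Xv , vd) ∷ _) =
    u≢v (D-one-X dD Xu Xv (~-sym ud) (~-sym vd))
  few-at _ (_ ∷ [] , _ , s≤s () , _)

  -- A triangle a b c of which a leads into A, b into B, and c, along leg, to the neighbour γ of x.
  record Config (K l : ℕ) : Set₁ where
    field
      a b c γ  : V G
      A B      : Sub
      a~b      : a ~ b
      a~c      : a ~ c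
      b~c      : b ~ c
      Da       : D a
      Db       : D b
      A⊆D      : A ⊆ D
      B⊆D      : B ⊆ D
      cA       : Conn A
      cB       : Conn B
      AB       : Apart A B
      a∉A      : ¬ A a
      b∉B      : ¬ B b
      aA       : Touches A a
      bB       : Touches B b
      aB       : Apart ｛ a ｝ B
      bA       : Apart ｛ b ｝ A
      heavyA   : Heavy K A
      heavyB   : Heavy K B
      Xγ       : X γ
      -- The leg may have length zero; then `c` is `γ` and lies in `X` rather than in `D`.
      leg      : Chain (D ∪ ｛ γ ｝) c γ
      leg-len  : Chain.ℓ leg ≡ l
      legA     : ∀ {i} → i ≤ Chain.ℓ leg → Apart ｛ Chain.at leg i ｝ A
      legB     : ∀ {i} → i ≤ Chain.ℓ leg → Apart ｛ Chain.at leg i ｝ B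
      leg-a    : ∀ {i} → 0 < i → i ≤ Chain.ℓ leg → Apart ｛ Chain.at leg i ｝ ｛ a ｝
      leg-b    : ∀ {i} → 0 < i → i ≤ Chain.ℓ leg → Apart ｛ Chain.at leg i ｝ ｛ b ｝

  flip : ∀ {K l} → Config K l → Config K l
  flip 𝒞 = record
    { a = b ; b = a ; c = c ; γ = γ ; A = B ; B = A ; a~b = ~-sym a~b ; a~c = b~c ; b~c = a~c
    ; Da = Db ; Db = Da ; A⊆D = B⊆D ; B⊆D = A⊆D ; cA = cB ; cB = cA ; AB = Apart-sym AB
    ; a∉A = b∉B ; b∉B = a∉A ; aA = bB ; bB = aA ; aB = bA ; bA = aB
    ; heavyA = heavyB ; heavyB = heavyA ; Xγ = Xγ ; leg = leg ; leg-len = leg-len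
    ; legA = legB ; legB = legA ; leg-a = leg-b ; leg-b = leg-a }
    where open Config 𝒞

  module Bypassing {K l} (𝒞 : Config K l) where
    open Config 𝒞

    -- Apart from `c`, the leg is not excluded: a bypass may run into it.
    Off : Sub
    Off v = D v × (v ≢ a × v ≢ b × v ≢ c) × ¬ A v × ¬ B v

    record Bypass : Set where
      field
        f₀ f₁ : V G
        F     : Chain Off f₀ f₁
        f₀A   : Touches A f₀
        f₁B   : Touches B f₁
        onlyA : ∀ {i} → i ≤ Chain.ℓ F → Touches A (Chain.at F i) → Chain.at F i ≡ f₀
        onlyB : ∀ {i} → i ≤ Chain.ℓ F → Touches B (Chain.at F i) → Chain.at F i ≡ f₁

  flipBypass : ∀ {K l} {𝒞 : Config K l} → Bypassing.Bypass 𝒞 → Bypassing.Bypass (flip 𝒞)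
  flipBypass 𝒷 = record
    { f₀ = f₁ ; f₁ = f₀
    ; F = widen (reverse F) λ {i} _ → let (d , (p , q , r) , s , t) = Chain.inS F (m∸n≤m (Chain.ℓ F) i)
                                      in d , (q , p , r) , t , s
    ; f₀A = f₁B ; f₁B = f₀A
    ; onlyA = λ {i} _ → onlyB (m∸n≤m (Chain.ℓ F) i) ; onlyB = λ {i} _ → onlyA (m∸n≤m (Chain.ℓ F) i) }
    where open Bypassing.Bypass 𝒷

-- Exits to `x`, and why the leg must see every bypass

module Bypasses (G : Graph) (𝒜 : Apex G) where
  open Configurations G 𝒜 public

  Before : ∀ {S a b} → Chain S a b → ℕ → Sub
  Before C m v = ∃[ i ] i < m × Chain.at C i ≡ v

  Before-Conn : ∀ {S a b} (C : Chain S a b) {m} → m ≤ suc (Chain.ℓ C) → Conn (Before C m)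
  Before-Conn C {m} m≤ (i , i< , refl) (j , j< , refl) with ≤-total i j
  ... | inj₁ i≤j = Reach-mono (λ (k , _ , k≤ , eq) → k , ≤-trans (s≤s k≤) j< , eq)
    (Seg-reach C {0} {j} j z≤n i≤j ≤-refl (s≤s⁻¹ (≤-trans j< m≤)))
  ... | inj₂ j≤i = Reach-mono (λ (k , _ , k≤ , eq) → k , ≤-trans (s≤s k≤) i< , eq)
    (Reach-sym (Seg-reach C {0} {i} i z≤n j≤i ≤-refl (s≤s⁻¹ (≤-trans i< m≤))))

  arm-X : ∀ {S v z} → S ⊆ D → Conn S → Touches S v → X z → Touches S z → Arm v (S ∪ ｛ z ｝)
  arm-X {S} {v} {z} S⊆D cS (p , Sp , vp) Xz (q , Sq , zq) = record
    { p = p ; o = z ; v~p = vp ; reach = snoc (Reach-mono inj₁ (cS Sp Sq)) (~-sym zq) (inj₂ refl)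
    ; x~o = x~X Xz
    ; unique = λ { (inj₁ s) e → contradiction e (proj₂ (x∉D (S⊆D s))) ; (inj₂ refl) _ → refl }
    ; x∉ = λ { (inj₁ s) → proj₁ (x∉D (S⊆D s)) refl ; (inj₂ refl) → E-irr G (x~X Xz) } }

  module _ {K l} {𝒞 : Config K l} (𝒷 : Bypassing.Bypass 𝒞) where
    open Config 𝒞
    open Bypassing 𝒞
    open Bypass 𝒷
    private
      module F = Chain F
      module Leg = Chain leg

    On : Sub
    On = Seg F 0 F.ℓ

    LegD : Sub
    LegD = Before leg Leg.ℓ

    -- With these non-adjacencies `A` with `z₁` and `B` with `z₂` serve as two independent routes to
    -- `x`. Only `f₀` may still be seen by `z₁`, and `f₁` by `z₂`, among the vertices of the bypass.
    record Exits (z₁ z₂ : V G) : Set where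
      field
        X₁  : X z₁
        X₂  : X z₂
        z₁A : Touches A z₁
        z₂B : Touches B z₂
        z₁B : ¬ Touches B z₁
        z₂A : ¬ Touches A z₂
        z₁a : ¬ (z₁ ~ a)
        z₁b : ¬ (z₁ ~ b)
        z₂a : ¬ (z₂ ~ a)
        z₂b : ¬ (z₂ ~ b)
        z₁L : ¬ Touches LegD z₁
        z₂L : ¬ Touches LegD z₂
        z₁F : ∀ {v} → On v → v ≢ f₀ → ¬ (z₁ ~ v)
        z₂F : ∀ {v} → On v → v ≢ f₁ → ¬ (z₂ ~ v)

    LegD⊆D : LegD ⊆ D
    LegD⊆D (i , i< , refl) with Leg.inS (<⇒≤ i<)
    ... | inj₁ d  = d
    ... | inj₂ eq = contradiction (Leg.at-inj (<⇒≤ i<) ≤-refl (trans (sym eq) (sym Leg.at-ℓ))) (<⇒≢ i<)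

    Tail : Sub
    Tail = Seg F 1 F.ℓ

    Tail≢f₀ : ∀ {v} → Tail v → v ≢ f₀
    Tail≢f₀ (i , 1≤ , i≤ , refl) eq =
      <⇒≢ 1≤ (sym (F.at-inj i≤ z≤n (trans eq (sym F.at-0))))

    Off-Apart-A : ∀ {v} → On v → v ≢ f₀ → Apart A ｛ v ｝
    Off-Apart-A (i , _ , i≤ , refl) v≢f₀ Au refl =
      (λ { refl → proj₁ (proj₂ (proj₂ (F.inS i≤))) Au }) ,
      λ e → v≢f₀ (onlyA i≤ (_ , Au , ~-sym e))

    On⊆D : On ⊆ D
    On⊆D (i , _ , i≤ , refl) = proj₁ (F.inS i≤)

    Tail⊆On : Tail ⊆ On
    Tail⊆On (i , _ , i≤ , eq) = i , z≤n , i≤ , eq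

    -- At most 2 + 1 + 1 + 2 + 2 of the neighbours in X of A are unsuitable.
    exit-A : 9 ≤ K → ¬ ¬ (∃[ z ] X z × Touches A z × ¬ Touches B z × ¬ (z ~ a) × ¬ (z ~ b) ×
                           ¬ Touches LegD z × (∀ {v} → On v → v ≢ f₀ → ¬ (z ~ v)))
    exit-A 9≤K k = do
      h₁ ← prune {7} {2} (Touches B) (Many-mono 9≤K id heavyA)
             λ m → few-common A⊆D B⊆D cA cB AB (Many-mono ≤-refl (λ ((p , q) , r) → p , q , r) m)
      h₂ ← prune {6} {1} (_~ a) h₁ λ m → few-at Da (Many-mono ≤-refl (λ (((p , q) , r) , s) → p , s) m)
      h₃ ← prune {5} {1} (_~ b) h₂ λ m → few-at Db (Many-mono ≤-refl (λ ((((p , q) , r) , s) , t) → p , t) m)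
      h₄ ← prune {3} {2} (Touches LegD) h₃ λ m →
             few-common A⊆D LegD⊆D cA (Before-Conn leg (n≤1+n _))
               (λ { Av (i , i< , refl) → Apart-sym (legA (<⇒≤ i<)) Av refl })
               (Many-mono ≤-refl (λ (((((p , q) , r) , s) , t) , u) → p , q , u) m)
      h₅ ← prune {1} {2} (Touches Tail) h₄ λ m →
             few-common A⊆D (On⊆D ∘ Tail⊆On) cA (Seg-Conn F ≤-refl)
               (λ Av t → Off-Apart-A (Tail⊆On t) (Tail≢f₀ t) Av refl)
               (Many-mono ≤-refl (λ ((((((p , q) , r) , s) , t) , u) , v) → p , q , v) m)
      case h₅ of λ
        { (z ∷ _ , _ , _ , ((((((Xz , zA) , zB) , za) , zb) , zL) , zT) ∷ _) →
          k (z , Xz , zA , zB , za , zb , zL , λ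
            { (zero , _ , i≤ , refl) v≢ → contradiction F.at-0 v≢
            ; (suc i , _ , i≤ , refl) _ e → zT (_ , (suc i , s≤s z≤n , i≤ , refl) , e) })
        ; ([] , _ , () , _) }

    On-flip : On ⊆ Seg (Bypassing.Bypass.F (flipBypass 𝒷)) 0 F.ℓ
    On-flip (i , _ , i≤ , refl) = F.ℓ ∸ i , z≤n , m∸n≤m F.ℓ i , cong F.at (m∸[m∸n]≡n i≤)

    flip-On : Seg (Bypassing.Bypass.F (flipBypass 𝒷)) 0 F.ℓ ⊆ On
    flip-On (i , _ , i≤ , refl) = F.ℓ ∸ i , z≤n , m∸n≤m F.ℓ i , refl

  flipExits : ∀ {K l} {𝒞 : Config K l} {𝒷 : Bypassing.Bypass 𝒞} {z₁ z₂} →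
              Exits 𝒷 z₁ z₂ → Exits (flipBypass 𝒷) z₂ z₁
  flipExits {𝒷 = 𝒷} e = record
    { X₁ = X₂ ; X₂ = X₁ ; z₁A = z₂B ; z₂B = z₁A ; z₁B = z₂A ; z₂A = z₁B
    ; z₁a = z₂b ; z₁b = z₂a ; z₂a = z₁b ; z₂b = z₁a ; z₁L = z₂L ; z₂L = z₁L
    ; z₁F = z₂F ∘ flip-On 𝒷 ; z₂F = z₁F ∘ flip-On 𝒷 }
    where open Exits e

  exits : ∀ {K l} {𝒞 : Config K l} (𝒷 : Bypassing.Bypass 𝒞) → 9 ≤ K →
          ¬ ¬ (∃[ z₁ ] ∃[ z₂ ] Exits 𝒷 z₁ z₂)
  exits 𝒷 9≤K k = do
    (z₁ , X₁ , z₁A , z₁B , z₁a , z₁b , z₁L , z₁F) ← exit-A 𝒷 9≤K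
    (z₂ , X₂ , z₂B , z₂A , z₂b , z₂a , z₂L , z₂F) ← exit-A (flipBypass 𝒷) 9≤K
    k (z₁ , z₂ , record
      { X₁ = X₁ ; X₂ = X₂ ; z₁A = z₁A ; z₂B = z₂B ; z₁B = z₁B ; z₂A = z₂A
      ; z₁a = z₁a ; z₁b = z₁b ; z₂a = z₂a ; z₂b = z₂b ; z₁L = z₁L ; z₂L = z₂L
      ; z₁F = z₁F ; z₂F = z₂F ∘ On-flip 𝒷 })

  module ExitFacts {K l} {𝒞 : Config K l} {𝒷 : Bypassing.Bypass 𝒞} {z₁ z₂} (ex : Exits 𝒷 z₁ z₂) where
    open Config 𝒞
    open Bypassing.Bypass 𝒷
    open Exits ex
    module F = Chain F
    module Leg = Chain leg

    Leg* : Sub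
    Leg* = Seg leg 0 Leg.ℓ

    z₁z₂ : z₁ ≢ z₂ × ¬ (z₁ ~ z₂)
    z₁z₂ = (λ { refl → z₂A z₁A }) , X-stable X₁ X₂

    X-D : ∀ {z v} → X z → D v → ¬ (z ~ v) → z ≢ v × ¬ (z ~ v)
    X-D Xz d nz = ≢-sym (D∩X d Xz) , nz

    -- Before its end the leg is covered by the choice of `z`. Its end `γ` differs from `z` because
    -- it touches neither `A` nor `B`, and `z` touches one of them.
    leg-z : ∀ {z} → X z → (Touches A z ⊎ Touches B z) → ¬ Touches (LegD 𝒷) z → Apart Leg* ｛ z ｝
    leg-z Xz t zL (i , _ , i≤ , refl) refl with m≤n⇒m<n∨m≡n i≤
    ... | inj₁ i<   = D∩X (LegD⊆D 𝒷 (i , i< , refl)) Xz , λ e → zL (_ , (i , i< , refl) , ~-sym e)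
    ... | inj₂ refl = (λ eq → case t of λ
        { (inj₁ (u , Au , e)) → proj₂ (legA ≤-refl refl Au) (subst (_~ u) (sym eq) e)
        ; (inj₂ (u , Bu , e)) → proj₂ (legB ≤-refl refl Bu) (subst (_~ u) (sym eq) e) }) ,
      X-stable (subst X (sym Leg.at-ℓ) Xγ) Xz

    leg-A : Apart Leg* A
    leg-A (i , _ , i≤ , refl) Au = legA i≤ refl Au

    leg-B : Apart Leg* B
    leg-B (i , _ , i≤ , refl) Bu = legB i≤ refl Bu

    x-leg : ∀ {v} → Leg* v → x ~ v → v ≡ γ
    x-leg (i , _ , i≤ , refl) e with Leg.inS i≤
    ... | inj₁ d  = contradiction e (proj₂ (x∉D d))
    ... | inj₂ eq = sym eq

    x∉leg : ¬ Leg* x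
    x∉leg (i , _ , i≤ , eq) with Leg.inS i≤
    ... | inj₁ d   = proj₁ (x∉D d) (sym eq)
    ... | inj₂ eq′ = ~⇒≢ (x~X Xγ) (trans (sym eq) (sym eq′))

    leg-reach : Reach Leg* c γ
    leg-reach = subst (λ v → Reach Leg* v γ) Leg.at-0
      (subst (Reach Leg* (Leg.at 0)) Leg.at-ℓ (Seg-reach leg Leg.ℓ z≤n z≤n ≤-refl ≤-refl))

  -- One end of a bypass that the whole leg avoids; flipping the configuration gives the other end.
  module End {K l} {𝒞 : Config K l} {𝒷 : Bypassing.Bypass 𝒞} {z₁ z₂} (ex : Exits 𝒷 z₁ z₂)
    (leg≁F : Apart (Seg (Config.leg 𝒞) 0 (Chain.ℓ (Config.leg 𝒞))) (On 𝒷)) where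
    open Config 𝒞
    open Bypassing.Bypass 𝒷
    open Exits ex
    open ExitFacts ex public

    -- The way from `f₀` to `x` that avoids `A`: along the bypass and through `B` to `z₂`.
    O₂ : Sub
    O₂ = (λ v → On 𝒷 v × v ≢ f₀) ∪ (B ∪ ｛ z₂ ｝)

    leg-O₂ : Apart Leg* O₂
    leg-O₂ p (inj₁ (on , _)) = leg≁F p on
    leg-O₂ p (inj₂ (inj₁ Bu)) = leg-B p Bu
    leg-O₂ p (inj₂ (inj₂ eq)) = leg-z X₂ (inj₂ z₂B) z₂L p eq

    A-O₂ : Apart A O₂
    A-O₂ Au (inj₁ (on , ne))     = Off-Apart-A 𝒷 on ne Au refl
    A-O₂ Au (inj₂ (inj₁ Bu))     = AB Au Bu
    A-O₂ Au (inj₂ (inj₂ refl))   = D∩X (A⊆D Au) X₂ , λ e → z₂A (_ , Au , ~-sym e)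

    a∉leg : ¬ Leg* a
    a∉leg (zero , _ , _ , eq) = ~⇒≢ a~c (trans (sym eq) Leg.at-0)
    a∉leg (suc i , _ , i≤ , eq) = proj₁ (leg-a (s≤s z≤n) i≤ refl refl) eq

    x∉O₂ : ¬ O₂ x
    x∉O₂ (inj₁ (on , _))     = proj₁ (x∉D (On⊆D 𝒷 on)) refl
    x∉O₂ (inj₂ (inj₁ Bx))    = proj₁ (x∉D (B⊆D Bx)) refl
    x∉O₂ (inj₂ (inj₂ refl))  = E-irr G (x~X X₂)

    a∉F : ∀ {v} → On 𝒷 v → v ≢ a
    a∉F (i , _ , i≤ , refl) = proj₁ (proj₁ (proj₂ (F.inS i≤)))

    reach-z₂ : ∀ {S : Sub} → B ∪ ｛ z₂ ｝ ⊆ S → ∀ {u} → B u → Reach S u z₂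
    reach-z₂ f Bu with z₂B
    ... | w , Bw , e = Reach-mono f (snoc (Reach-mono inj₁ (cB Bu Bw)) (~-sym e) (inj₂ refl))

    tail-reach : ∀ {i} → 0 < i → i ≤ F.ℓ → Reach O₂ (F.at i) z₂
    tail-reach {i} 0<i i≤ with f₁B
    ... | w , Bw , e = Reach-trans
      (Reach-mono (λ t → inj₁ (Tail⊆On 𝒷 t , Tail≢f₀ 𝒷 t)) (Seg-reach F F.ℓ 0<i i≤ ≤-refl ≤-refl))
      (step (inj₁ ((F.ℓ , z≤n , ≤-refl , refl) ,
               Tail≢f₀ 𝒷 (F.ℓ , ≤-trans 0<i i≤ , ≤-refl , refl)))
        (subst (_~ w) (sym F.at-ℓ) e) (reach-z₂ inj₂ Bw))

    -- Such a neighbour would open a route from `a` through `B` to `x`; with the routes through `A`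
    -- and along the leg it makes a theta.
    a-F : ∀ {v} → On 𝒷 v → v ≢ f₀ → ¬ (a ~ v)
    a-F (zero , _ , _ , refl) ne _ = ne F.at-0
    a-F (suc i , _ , i≤ , refl) _ e = no-theta₃ (≢-sym (proj₁ (x∉D Da))) (proj₂ (x∉D Da) ∘ ~-sym)
      {A ∪ ｛ z₁ ｝} {Leg*} {O₂}
      (armA→link , [ a∉A , (λ eq → D∩X Da X₁ (sym eq)) ]′ ,
        [ (λ Ax → proj₁ (x∉D (A⊆D Ax)) refl) , (λ { refl → E-irr G (x~X X₁) }) ]′)
      ((c , γ , a~c , leg-reach , ~-sym (x~X Xγ)) , a∉leg , x∉leg)
      ((F.at (suc i) , z₂ , e , tail-reach (s≤s z≤n) i≤ , ~-sym (x~X X₂)) ,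
        [ (λ (on , _) → a∉F on refl) , [ (λ Ba → proj₁ (aB refl Ba) refl) , (λ eq → D∩X Da X₂ (sym eq)) ]′ ]′ ,
        x∉O₂)
      (Apart-∪ˡ (Apart-sym leg-A) (Apart-sym (leg-z X₁ (inj₁ z₁A) z₁L)))
      (Apart-∪ˡ A-O₂ z₁-O₂) leg-O₂
      where
      armA→link : Link (A ∪ ｛ z₁ ｝) a x
      armA→link = let module M = Arm (arm-X A⊆D cA aA X₁ z₁A) in M.p , M.o , M.v~p , M.reach , ~-sym M.x~o
      z₁-O₂ : Apart ｛ z₁ ｝ O₂
      z₁-O₂ refl (inj₁ (on , ne)) = X-D X₁ (On⊆D 𝒷 on) (z₁F on ne)
      z₁-O₂ refl (inj₂ (inj₁ Bu)) = X-D X₁ (B⊆D Bu) λ e → z₁B (_ , Bu , e)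
      z₁-O₂ refl (inj₂ (inj₂ refl)) = z₁z₂

    R : Sub
    R = A ∪ (｛ a ｝ ∪ ｛ f₀ ｝)

    f₀-on : On 𝒷 f₀
    f₀-on = 0 , z≤n , z≤n , F.at-0

    arm-f₀ : Arm f₀ O₂
    arm-f₀ = record
      { p = proj₁ next ; o = z₂ ; v~p = proj₁ (proj₂ next) ; reach = proj₂ (proj₂ next)
      ; x~o = x~X X₂
      ; unique = λ { (inj₁ (on , _)) e → contradiction e (proj₂ (x∉D (On⊆D 𝒷 on)))
                   ; (inj₂ (inj₁ Bu)) e → contradiction e (proj₂ (x∉D (B⊆D Bu)))
                   ; (inj₂ (inj₂ eq)) _ → sym eq }
      ; x∉ = x∉O₂ }
      where
      next : ∃[ p ] f₀ ~ p × Reach O₂ p z₂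
      next = go F.ℓ refl
        where
        go : ∀ m → m ≡ F.ℓ → ∃[ p ] f₀ ~ p × Reach O₂ p z₂
        go zero eq with f₁B
        ... | w , Bw , e = w ,
          subst (_~ w) (trans (sym F.at-ℓ) (trans (cong F.at (sym eq)) F.at-0)) e , reach-z₂ inj₂ Bw
        go (suc m) eq = F.at 1 , subst (_~ F.at 1) F.at-0 (F.link 0<) , tail-reach (s≤s z≤n) 0<
          where
          0< : 1 ≤ F.ℓ
          0< = ≤-trans (s≤s z≤n) (≤-reflexive eq)

    arm-a : Arm a Leg*
    arm-a = record
      { p = c ; o = γ ; v~p = a~c ; reach = leg-reach ; x~o = x~X Xγ ; unique = x-leg ; x∉ = x∉leg }

    R⊆D : R ⊆ D
    R⊆D (inj₁ Au)          = A⊆D Au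
    R⊆D (inj₂ (inj₁ refl)) = Da
    R⊆D (inj₂ (inj₂ refl)) = On⊆D 𝒷 f₀-on

    -- Three routes to `x` meet in `A` with `a` and `f₀` added: from `a` along the leg, from `f₀`
    -- along the bypass, and through `z₁`.
    T : Tri (three a f₀ z₁) (JunctionBound R a f₀ z₁)
    T = junction {R} {Leg*} {O₂}
      (let (u , Au , au) = aA ; (v , Av , fv) = f₀A in
        step (inj₂ (inj₁ refl)) au (snoc (Reach-mono inj₁ (cA Au Av)) (~-sym fv) (inj₂ (inj₂ refl))))
      (≢-sym (a∉F f₀-on)) (x∉D ∘ R⊆D) arm-a arm-f₀ leg-O₂
      (λ { p (inj₁ Av) → let (ne , na) = leg-A p Av in ne , λ e → contradiction e na
         ; p (inj₂ (inj₁ refl)) → (λ { refl → a∉leg p }) , λ _ → refl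
         ; p (inj₂ (inj₂ refl)) → let (ne , na) = leg≁F p f₀-on in ne , λ e → contradiction e na })
      (λ { o (inj₁ Av) → let (ne , na) = A-O₂ Av o in ≢-sym ne , λ e → contradiction (~-sym e) na
         ; o (inj₂ (inj₁ refl)) → let (ne , na) = a-O₂ o in ≢-sym ne , λ e → contradiction (~-sym e) na
         ; o (inj₂ (inj₂ refl)) → (λ { refl → f₀∉O₂ o }) , λ _ → refl })
      X₁ (λ r → ≢-sym (D∩X (R⊆D r) X₁))
      (Apart-sym {Leg*} {｛ z₁ ｝} (leg-z X₁ (inj₁ z₁A) z₁L))
      (λ { refl o → z₁-O₂ o })
      (proj₂ (proj₂ z₁A))
      (let (u , Au , au) = aA in
        snoc (Reach-mono inj₁ (cA (proj₁ (proj₂ z₁A)) Au)) (~-sym au) (inj₂ (inj₁ refl)))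
      where
      z₁-O₂ : ∀ {u} → O₂ u → z₁ ≢ u × ¬ (z₁ ~ u)
      z₁-O₂ (inj₁ (on , ne)) = X-D X₁ (On⊆D 𝒷 on) (z₁F on ne)
      z₁-O₂ (inj₂ (inj₁ Bu)) = X-D X₁ (B⊆D Bu) λ e → z₁B (_ , Bu , e)
      z₁-O₂ (inj₂ (inj₂ refl)) = z₁z₂
      a-O₂ : ∀ {u} → O₂ u → a ≢ u × ¬ (a ~ u)
      a-O₂ (inj₁ (on , ne)) = ≢-sym (a∉F on) , a-F on ne
      a-O₂ (inj₂ (inj₁ Bu)) = aB refl Bu
      a-O₂ (inj₂ (inj₂ refl)) = D∩X Da X₂ , z₂a ∘ ~-sym
      f₀∉O₂ : ¬ O₂ f₀
      f₀∉O₂ (inj₁ (_ , ne)) = ne refl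
      f₀∉O₂ (inj₂ (inj₁ Bu)) = let (i , _ , i≤ , eq) = f₀-on in
        proj₂ (proj₂ (proj₂ (F.inS i≤))) (subst B (sym eq) Bu)
      f₀∉O₂ (inj₂ (inj₂ eq)) = D∩X (On⊆D 𝒷 f₀-on) X₂ (sym eq)

    private module T = Tri T

    W₀⊆ : T.W fz ⊆ A ∪ ｛ a ｝
    W₀⊆ w with T.bound fz w
    ... | inj₁ Av , _              = inj₁ Av
    ... | inj₂ (inj₁ eq) , _       = inj₂ eq
    ... | inj₂ (inj₂ refl) , v≢f₀ = contradiction refl v≢f₀

    W₁⊆ : T.W (fs fz) ⊆ A ∪ ｛ f₀ ｝
    W₁⊆ w with T.bound (fs fz) w
    ... | inj₁ Av , _             = inj₁ Av
    ... | inj₂ (inj₁ refl) , v≢a = contradiction refl v≢a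
    ... | inj₂ (inj₂ eq) , _      = inj₂ eq

    W₂⊆ : T.W (fs (fs fz)) ⊆ A ∪ ｛ z₁ ｝
    W₂⊆ w with T.bound (fs (fs fz)) w
    ... | inj₁ (inj₁ Av) , _                 = inj₁ Av
    ... | inj₁ (inj₂ (inj₁ refl)) , v≢a , _  = contradiction refl v≢a
    ... | inj₁ (inj₂ (inj₂ refl)) , _ , v≢f₀ = contradiction refl v≢f₀
    ... | inj₂ eq , _                        = inj₂ (sym eq)

    ends-in-f₀ : ∀ i → i ≢ fs fz → ∀ {u} → (A ∪ (｛ a ｝ ∪ ｛ z₁ ｝)) u → T.W i u → ∀ {v} → On 𝒷 v →
                 u ≢ v × (u ~ v → u ≡ T.p i × v ≡ T.p (fs fz))
    ends-in-f₀ i i≢1 u∈ w {v} on with v Finₚ.≟ f₀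
    ... | yes refl = T.excl i (fs fz) i≢1 w (target (T.reach (fs fz)))
    ends-in-f₀ i i≢1 (inj₁ Au) w on | no ne =
      let (d , na) = Off-Apart-A 𝒷 on ne Au refl in d , λ e → contradiction e na
    ends-in-f₀ i i≢1 (inj₂ (inj₁ refl)) w on | no ne =
      ≢-sym (a∉F on) , λ e → contradiction e (a-F on ne)
    ends-in-f₀ i i≢1 (inj₂ (inj₂ refl)) w on | no ne =
      ≢-sym (D∩X (On⊆D 𝒷 on) X₁) , λ e → contradiction e (z₁F on ne)

    W₀-On : ∀ {u v} → T.W fz u → On 𝒷 v → u ≢ v × (u ~ v → u ≡ T.p fz × v ≡ T.p (fs fz))
    W₀-On w = ends-in-f₀ fz (λ ()) ([ inj₁ , inj₂ ∘ inj₁ ]′ (W₀⊆ w)) w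

    W₂-On : ∀ {u v} → T.W (fs (fs fz)) u → On 𝒷 v →
            u ≢ v × (u ~ v → u ≡ T.p (fs (fs fz)) × v ≡ T.p (fs fz))
    W₂-On w = ends-in-f₀ (fs (fs fz)) (λ ()) ([ inj₁ , inj₂ ∘ inj₂ ]′ (W₂⊆ w)) w

    f₁-on : On 𝒷 f₁
    f₁-on = F.ℓ , z≤n , ≤-refl , F.at-ℓ

    z₁-B : ∀ {v} → B v → z₁ ≢ v × ¬ (z₁ ~ v)
    z₁-B Bv = X-D X₁ (B⊆D Bv) λ e → z₁B (_ , Bv , e)

    W₀-far₂ : Apart (T.W fz) (B ∪ ｛ z₂ ｝)
    W₀-far₂ w v∈ with W₀⊆ w | v∈
    ... | inj₁ Au   | inj₁ Bv   = AB Au Bv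
    ... | inj₁ Au   | inj₂ refl = A-O₂ Au (inj₂ (inj₂ refl))
    ... | inj₂ refl | inj₁ Bv   = aB refl Bv
    ... | inj₂ refl | inj₂ refl = D∩X Da X₂ , z₂a ∘ ~-sym

    W₀-far₁ : ∀ {u v} → T.W fz u → (B ∪ ｛ f₁ ｝) v → u ≢ v × (u ~ v → u ≡ T.p fz × v ≡ T.p (fs fz))
    W₀-far₁ w (inj₁ Bv) = let (ne , na) = W₀-far₂ w (inj₁ Bv) in ne , λ e → contradiction e na
    W₀-far₁ w (inj₂ refl) = W₀-On w f₁-on

    W₂-far₁ : ∀ {u v} → T.W (fs (fs fz)) u → (B ∪ ｛ f₁ ｝) v →
              u ≢ v × (u ~ v → u ≡ T.p (fs (fs fz)) × v ≡ T.p (fs fz))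
    W₂-far₁ w (inj₂ refl) = W₂-On w f₁-on
    W₂-far₁ w (inj₁ Bv) with W₂⊆ w
    ... | inj₁ Au   = let (ne , na) = AB Au Bv in ne , λ e → contradiction e na
    ... | inj₂ refl = let (ne , na) = z₁-B Bv in ne , λ e → contradiction e na

    W₁⊆D : T.W (fs fz) ⊆ D
    W₁⊆D w = [ A⊆D , (λ { refl → On⊆D 𝒷 f₀-on }) ]′ (W₁⊆ w)

    W₀⊆D : T.W fz ⊆ D
    W₀⊆D w = [ A⊆D , (λ { refl → Da }) ]′ (W₀⊆ w)

    p₀≢ : ∀ {v} → (B ∪ ｛ b ｝) v → T.p fz ≢ v
    p₀≢ v∈ with W₀⊆ (source (T.reach fz)) | v∈
    ... | inj₁ Au | inj₁ Bv   = proj₁ (AB Au Bv)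
    ... | inj₁ Au | inj₂ refl = ≢-sym (proj₁ (bA refl Au))
    ... | inj₂ eq | inj₁ Bv   = proj₁ (aB eq Bv)
    ... | inj₂ eq | inj₂ refl = λ eq′ → ~⇒≢ a~b (trans eq eq′)

    p₂≢ : ∀ {v} → (B ∪ ｛ z₂ ｝) v → T.p (fs (fs fz)) ≢ v
    p₂≢ v∈ with W₂⊆ (source (T.reach (fs (fs fz)))) | v∈
    ... | inj₁ Au | inj₁ Bv   = proj₁ (AB Au Bv)
    ... | inj₁ Au | inj₂ refl = proj₁ (A-O₂ Au (inj₂ (inj₂ refl)))
    ... | inj₂ eq | inj₁ Bv   = subst (_≢ _) eq (proj₁ (z₁-B Bv))
    ... | inj₂ eq | inj₂ refl = subst (_≢ _) eq (proj₁ z₁z₂)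

  -- If the leg is apart from the bypass, there is a triangle at either end, with routes to `a`,
  -- `f₀`, `z₁` and to `b`, `f₁`, `z₂`. These are linked by the edge `a b`, by the bypass, and
  -- through `x`. The leg itself only serves as an arm in finding the triangles.
  leg-sees-bypass : ∀ {K l} {𝒞 : Config K l} {𝒷 : Bypassing.Bypass 𝒞} {z₁ z₂} → Exits 𝒷 z₁ z₂ →
    ¬ Apart (Seg (Config.leg 𝒞) 0 (Chain.ℓ (Config.leg 𝒞))) (On 𝒷)
  leg-sees-bypass {𝒞 = 𝒞} {𝒷} {z₁} {z₂} ex leg≁F =
    join (Tri.p E₁.T) (Tri.p E₂.T) (Tri.W E₁.T) (Tri.W E₂.T)
      (Tri.adj E₁.T) (Tri.adj E₂.T) (Tri.reach E₁.T) (Tri.reach E₂.T)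
      (λ i j i≢j w w′ → Tri.excl E₁.T i j i≢j w w′) (λ i j i≢j w w′ → Tri.excl E₂.T i j i≢j w w′)
      E₁.W₀-On E₁.W₂-On
      (λ w on → E₂.W₀-On w (On-flip 𝒷 on)) (λ w on → E₂.W₂-On w (On-flip 𝒷 on))
      (λ w w′ → E₁.W₀-far₂ w (E₂.W₂⊆ w′)) (λ w w′ → E₂.W₀-far₂ w (E₁.W₂⊆ w′))
      (λ w w′ → E₁.W₀-far₁ w (E₂.W₁⊆ w′)) (λ w w′ → E₂.W₀-far₁ w (E₁.W₁⊆ w′))
      (λ w w′ → E₁.W₂-far₁ w (E₂.W₁⊆ w′)) (λ w w′ → E₂.W₂-far₁ w (E₁.W₁⊆ w′))
      (λ {i} → [ x-out ∘ E₁.W₀⊆D , x-out ∘ E₁.W₁⊆D ]′) (λ {i} → [ x-out ∘ E₂.W₀⊆D , x-out ∘ E₂.W₁⊆D ]′)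
      (λ w → [ proj₁ ∘ x-out ∘ A⊆D , (λ { refl → ~⇒≢ (x~X X₁) }) ]′ (E₁.W₂⊆ w))
      (λ w → [ proj₁ ∘ x-out ∘ B⊆D , (λ { refl → ~⇒≢ (x~X X₂) }) ]′ (E₂.W₂⊆ w))
      (E₁.p₀≢ (E₂.W₀⊆ (source (Tri.reach E₂.T fz))))
      (E₁.p₂≢ (E₂.W₂⊆ (source (Tri.reach E₂.T (fs (fs fz))))))
    where
    open Config 𝒞
    open Bypassing.Bypass 𝒷
    open Exits ex
    module F = Chain F
    module E₁ = End ex leg≁F
    module E₂ = End (flipExits ex) (λ p on → leg≁F p (flip-On 𝒷 on))
    x-out : ∀ {v} → D v → x ≢ v × ¬ (x ~ v)
    x-out = x∉D
    join : (p q : Fin 3 → V G) (W V′ : Fin 3 → Sub) →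
      (∀ i j → i ≢ j → p i ~ p j) → (∀ i j → i ≢ j → q i ~ q j) →
      (∀ i → Reach (W i) (p i) (three a f₀ z₁ i)) → (∀ i → Reach (V′ i) (q i) (three b f₁ z₂ i)) →
      (∀ i j → i ≢ j → ∀ {u v} → W i u → W j v → u ≢ v × (u ~ v → u ≡ p i × v ≡ p j)) →
      (∀ i j → i ≢ j → ∀ {u v} → V′ i u → V′ j v → u ≢ v × (u ~ v → u ≡ q i × v ≡ q j)) →
      (∀ {u v} → W fz u → On 𝒷 v → u ≢ v × (u ~ v → u ≡ p fz × v ≡ p (fs fz))) →
      (∀ {u v} → W (fs (fs fz)) u → On 𝒷 v → u ≢ v × (u ~ v → u ≡ p (fs (fs fz)) × v ≡ p (fs fz))) →
      (∀ {u v} → V′ fz u → On 𝒷 v → u ≢ v × (u ~ v → u ≡ q fz × v ≡ q (fs fz))) →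
      (∀ {u v} → V′ (fs (fs fz)) u → On 𝒷 v → u ≢ v × (u ~ v → u ≡ q (fs (fs fz)) × v ≡ q (fs fz))) →
      Apart (W fz) (V′ (fs (fs fz))) → Apart (V′ fz) (W (fs (fs fz))) →
      (∀ {u v} → W fz u → V′ (fs fz) v → u ≢ v × (u ~ v → u ≡ p fz × v ≡ p (fs fz))) →
      (∀ {u v} → V′ fz u → W (fs fz) v → u ≢ v × (u ~ v → u ≡ q fz × v ≡ q (fs fz))) →
      (∀ {u v} → W (fs (fs fz)) u → V′ (fs fz) v → u ≢ v × (u ~ v → u ≡ p (fs (fs fz)) × v ≡ p (fs fz))) →
      (∀ {u v} → V′ (fs (fs fz)) u → W (fs fz) v → u ≢ v × (u ~ v → u ≡ q (fs (fs fz)) × v ≡ q (fs fz))) →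
      (∀ {u} → W fz u ⊎ W (fs fz) u → x ≢ u × ¬ (x ~ u)) →
      (∀ {u} → V′ fz u ⊎ V′ (fs fz) u → x ≢ u × ¬ (x ~ u)) →
      (∀ {u} → W (fs (fs fz)) u → x ≢ u) → (∀ {u} → V′ (fs (fs fz)) u → x ≢ u) →
      p fz ≢ q fz → p (fs (fs fz)) ≢ q (fs (fs fz)) → ⊥
    join p q W V′ pp qq rp rq eW eV W₀O W₂O V₀O V₂O W₀V₂ V₀W₂ W₀V₁ V₀W₁ W₂V₁ V₂W₁ xW xV xW₂ xV₂ n₀ n₂ =
      no-linked-triangles p q U ρ pp qq
        (pairs {R = Q} (λ h u v → let (ne , f) = h v u in ≢-sym ne ,
            λ e → [ (λ (r , s) → inj₁ (s , r)) , (λ (r , s) → inj₂ (s , r)) ]′ (f (~-sym e)))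
          Q₀₁ Q₀₂ Q₁₂)
        -- Only the middle link can be trivial, namely when the bypass is a single vertex.
        λ { fz _ _ eq _ → n₀ eq
          ; (fs (fs fz)) _ _ eq _ → n₂ eq
          ; (fs fz) fz _ _ eq → n₀ eq
          ; (fs fz) (fs fz) i≢j _ _ → i≢j refl
          ; (fs fz) (fs (fs fz)) _ _ eq → n₂ eq }
      where
      U : Fin 3 → Sub
      U = three (W fz ∪ V′ fz) ((W (fs fz) ∪ V′ (fs fz)) ∪ On 𝒷)
                ((W (fs (fs fz)) ∪ V′ (fs (fs fz))) ∪ ｛ x ｝)
      Q : Fin 3 → Fin 3 → Set
      Q i j = ∀ {u v} → U i u → U j v → u ≢ v × (u ~ v → (u ≡ p i × v ≡ p j) ⊎ (u ≡ q i × v ≡ q j))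
      ρ : ∀ i → Reach (U i) (p i) (q i)
      ρ fz = Reach-trans (Reach-mono inj₁ (rp fz))
        (step (inj₁ (target (rp fz))) a~b (Reach-mono inj₂ (Reach-sym (rq fz))))
      ρ (fs fz) = Reach-trans (Reach-mono (inj₁ ∘ inj₁) (rp (fs fz)))
        (Reach-trans (Reach-mono inj₂ along)
          (Reach-mono (inj₁ ∘ inj₂) (Reach-sym (rq (fs fz)))))
        where
        along : Reach (On 𝒷) f₀ f₁
        along = subst (λ v → Reach (On 𝒷) v f₁) F.at-0
          (subst (Reach (On 𝒷) (F.at 0)) F.at-ℓ (Seg-reach F F.ℓ z≤n z≤n ≤-refl ≤-refl))
      ρ (fs (fs fz)) = Reach-trans (Reach-mono (inj₁ ∘ inj₁) (rp (fs (fs fz))))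
        (step (inj₁ (inj₁ (target (rp (fs (fs fz)))))) (~-sym (x~X X₁))
          (step (inj₂ refl) (x~X X₂) (Reach-mono (inj₁ ∘ inj₂) (Reach-sym (rq (fs (fs fz)))))))
      left : ∀ {i j u v} → u ≢ v × (u ~ v → u ≡ p i × v ≡ p j) →
             u ≢ v × (u ~ v → (u ≡ p i × v ≡ p j) ⊎ (u ≡ q i × v ≡ q j))
      left (ne , f) = ne , inj₁ ∘ f
      right : ∀ {i j u v} → u ≢ v × (u ~ v → u ≡ q i × v ≡ q j) →
              u ≢ v × (u ~ v → (u ≡ p i × v ≡ p j) ⊎ (u ≡ q i × v ≡ q j))
      right (ne , f) = ne , inj₂ ∘ f
      never : ∀ {i j u v} → u ≢ v × ¬ (u ~ v) →
              u ≢ v × (u ~ v → (u ≡ p i × v ≡ p j) ⊎ (u ≡ q i × v ≡ q j))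
      never (ne , na) = ne , λ e → contradiction e na
      swap : ∀ {u v} {P R : Set} → u ≢ v × (u ~ v → P × R) → v ≢ u × (v ~ u → R × P)
      swap (ne , f) = ≢-sym ne , λ e → let (r , s) = f (~-sym e) in s , r
      not-x : ∀ {u} → x ≢ u × ¬ (x ~ u) → u ≢ x × ¬ (u ~ x)
      not-x (ne , na) = ≢-sym ne , na ∘ ~-sym
      Q₀₁ : Q fz (fs fz)
      Q₀₁ (inj₁ w) (inj₁ (inj₁ w′)) = left (eW _ _ (λ ()) w w′)
      Q₀₁ (inj₁ w) (inj₁ (inj₂ v))  = left (W₀V₁ w v)
      Q₀₁ (inj₁ w) (inj₂ on)        = left (W₀O w on)
      Q₀₁ (inj₂ v) (inj₁ (inj₁ w))  = right (V₀W₁ v w)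
      Q₀₁ (inj₂ v) (inj₁ (inj₂ v′)) = right (eV _ _ (λ ()) v v′)
      Q₀₁ (inj₂ v) (inj₂ on)        = right (V₀O v on)
      Q₀₂ : Q fz (fs (fs fz))
      Q₀₂ (inj₁ w) (inj₁ (inj₁ w′)) = left (eW _ _ (λ ()) w w′)
      Q₀₂ (inj₁ w) (inj₁ (inj₂ v))  = never (W₀V₂ w v)
      Q₀₂ (inj₁ w) (inj₂ refl)      = never (not-x (xW (inj₁ w)))
      Q₀₂ (inj₂ v) (inj₁ (inj₁ w))  = never (V₀W₂ v w)
      Q₀₂ (inj₂ v) (inj₁ (inj₂ v′)) = right (eV _ _ (λ ()) v v′)
      Q₀₂ (inj₂ v) (inj₂ refl)      = never (not-x (xV (inj₁ v)))
      Q₁₂ : Q (fs fz) (fs (fs fz))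
      Q₁₂ (inj₁ (inj₁ w)) (inj₁ (inj₁ w′)) = left (eW _ _ (λ ()) w w′)
      Q₁₂ (inj₁ (inj₁ w)) (inj₁ (inj₂ v))  = right (swap (V₂W₁ v w))
      Q₁₂ (inj₁ (inj₁ w)) (inj₂ refl)      = never (not-x (xW (inj₂ w)))
      Q₁₂ (inj₁ (inj₂ v)) (inj₁ (inj₁ w))  = left (swap (W₂V₁ w v))
      Q₁₂ (inj₁ (inj₂ v)) (inj₁ (inj₂ v′)) = right (eV _ _ (λ ()) v v′)
      Q₁₂ (inj₁ (inj₂ v)) (inj₂ refl)      = never (not-x (xV (inj₂ v)))
      Q₁₂ (inj₂ on) (inj₁ (inj₁ w))        = left (swap (W₂O w on))
      Q₁₂ (inj₂ on) (inj₁ (inj₂ v))        = right (swap (V₂O v on))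
      Q₁₂ (inj₂ on) (inj₂ refl)            = never (not-x (x-out (On⊆D 𝒷 on)))

-- Shortening the leg

module Shrinking (G : Graph) (𝒜 : Apex G) where
  open Bypasses G 𝒜 public

  SeesPair : ∀ {S u v} → V G → Chain S u v → Set
  SeesPair s F = ∃[ i ] i < ℓ × s ~ at i × s ~ at (suc i) ×
                        (∀ {j} → j ≤ ℓ → s ~ at j → j ≡ i ⊎ j ≡ suc i)
    where open Chain F

  module _ {K l} (𝒞 : Config K l) (𝒷 : Bypassing.Bypass 𝒞) {z₁ z₂} (ex : Exits 𝒷 z₁ z₂) where
    open Config 𝒞
    open Bypassing.Bypass 𝒷
    open Exits ex
    open ExitFacts ex

    private
      F-D : ∀ {i} → i ≤ F.ℓ → D (F.at i)
      F-D i≤ = proj₁ (F.inS i≤)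

      F∉A : ∀ {i} → i ≤ F.ℓ → ¬ A (F.at i)
      F∉A i≤ = proj₁ (proj₂ (proj₂ (F.inS i≤)))

      F∉B : ∀ {i} → i ≤ F.ℓ → ¬ B (F.at i)
      F∉B i≤ = proj₂ (proj₂ (proj₂ (F.inS i≤)))

      A~F : ∀ {i u} → i ≤ F.ℓ → A u → u ~ F.at i → i ≡ 0
      A~F i≤ Au e = F.at-inj i≤ z≤n (trans (onlyA i≤ (_ , Au , ~-sym e)) (sym F.at-0))

      B~F : ∀ {i u} → i ≤ F.ℓ → B u → u ~ F.at i → i ≡ F.ℓ
      B~F i≤ Bu e = F.at-inj i≤ ≤-refl (trans (onlyB i≤ (_ , Bu , ~-sym e)) (sym F.at-ℓ))

      avoid : ∀ {S : Sub} {u v} → ¬ S v → S u → u ≢ v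
      avoid ¬Sv Su refl = ¬Sv Su

      Hit : ℕ → Set
      Hit i = ∃[ j ] j < suc F.ℓ × Leg.at i ~ F.at j

      Hit? : ∀ i → Dec (Hit i)
      Hit? i = anyUpTo? (λ j → E-dec G (Leg.at i) (F.at j)) (suc F.ℓ)

    -- Apartness also asks for distinct vertices: a vertex of the leg on the bypass makes its
    -- predecessor a hit, and `c` itself is never on a bypass.
    unseen : ¬ (∃[ i ] i < suc Leg.ℓ × Hit i) → ⊥
    unseen none = leg-sees-bypass ex λ
      { (zero , _ , _ , refl) (j , _ , j≤ , refl) →
          (λ eq → proj₂ (proj₂ (proj₁ (proj₂ (F.inS j≤)))) (trans (sym eq) Leg.at-0)) ,
          (λ e → none (0 , s≤s z≤n , j , s≤s j≤ , e))
      ; (suc i , _ , i< , refl) (j , _ , j≤ , refl) →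
          (λ eq → none (i , s≤s (<⇒≤ i<) , j , s≤s j≤ , subst (Leg.at i ~_) eq (Leg.link i<))) ,
          (λ e → none (suc i , s≤s i< , j , s≤s j≤ , e)) }

    -- The last vertex of the leg that sees the bypass sees two consecutive vertices of it; the
    -- triangle they form carries a configuration with a shorter leg, unless that vertex is c.
    module LastHit (m : ℕ) (m≤ : m ≤ Leg.ℓ) (hit : Hit m)
      (later : ∀ {k} → m < k → k ≤ Leg.ℓ → ¬ Hit k) where

      -- A vertex of the leg on the bypass makes its successor a later hit; the last one, `γ`, lies
      -- in `X` and so not in `D`.
      leg∉F : ∀ {i j} → m ≤ i → i ≤ Leg.ℓ → j ≤ F.ℓ → Leg.at i ≢ F.at j
      leg∉F {i} {j} m≤i i≤ j≤ eq with m≤n⇒m<n∨m≡n i≤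
      ... | inj₁ i<   = later (s≤s m≤i) i< (j , s≤s j≤ , subst (Leg.at (suc i) ~_) eq (~-sym (Leg.link i<)))
      ... | inj₂ refl = D∩X (F-D j≤) Xγ (trans (sym eq) Leg.at-ℓ)

      Λ : Sub
      Λ v = ∃[ i ] m < i × i ≤ Leg.ℓ × Leg.at i ≡ v

      on-leg : Λ ⊆ Leg*
      on-leg (i , _ , i≤ , eq) = i , z≤n , i≤ , eq

      s : V G
      s = Leg.at m

      s∈leg : Leg* s
      s∈leg = m , z≤n , m≤ , refl

      exit : (¬ (x ~ s) × Link Λ s x × ¬ Λ s) ⊎ (x ~ s × ¬ IsHub G s)
      exit with m≤n⇒m<n∨m≡n m≤
      ... | inj₁ m< = inj₁ (proj₂ (x∉D (LegD⊆D 𝒷 (m , m< , refl))) ,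
        (Leg.at (suc m) , Leg.at Leg.ℓ , Leg.link m< ,
         Reach-mono (λ (i , m<i , i≤ , eq) → i , m<i , i≤ , eq)
           (Seg-reach leg Leg.ℓ ≤-refl m< ≤-refl ≤-refl) ,
         subst (_~ x) (sym Leg.at-ℓ) (~-sym (x~X Xγ))) ,
        λ (i , m<i , i≤ , eq) → <⇒≢ m<i (sym (Leg.at-inj i≤ m≤ eq)))
      ... | inj₂ refl = inj₂ (subst (λ v → x ~ v × ¬ IsHub G v) (sym Leg.at-ℓ) (x~X Xγ , X-no-hub Xγ))

      leg-z₁ : Apart Leg* (A ∪ ｛ z₁ ｝)
      leg-z₁ p (inj₁ Au) = leg-A p Au
      leg-z₁ p (inj₂ eq) = leg-z X₁ (inj₁ z₁A) z₁L p eq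

      leg-z₂ : Apart Leg* (B ∪ ｛ z₂ ｝)
      leg-z₂ p (inj₁ Bu) = leg-B p Bu
      leg-z₂ p (inj₂ eq) = leg-z X₂ (inj₂ z₂B) z₂L p eq

      pair : SeesPair s F
      pair = Touch.two-consecutive F {A ∪ ｛ z₁ ｝} {B ∪ ｛ z₂ ｝} {Λ}
        (arm-X A⊆D cA f₀A X₁ z₁A) (arm-X B⊆D cB f₁B X₂ z₂B) (λ i≤ → x∉D (F-D i≤))
        (λ { (inj₁ Au) (inj₁ Bv) → AB Au Bv
           ; (inj₁ Au) (inj₂ refl) → D∩X (A⊆D Au) X₂ , λ e → z₂A (_ , Au , ~-sym e)
           ; (inj₂ refl) (inj₁ Bv) → ≢-sym (D∩X (B⊆D Bv) X₁) , λ e → z₁B (_ , Bv , e)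
           ; (inj₂ refl) (inj₂ refl) → z₁z₂ })
        (λ { i≤ (inj₁ Au) → avoid {A} (F∉A i≤) Au , A~F i≤ Au
           ; {i} i≤ (inj₂ refl) → ≢-sym (D∩X (F-D i≤) X₁) , λ e → case i ≟ 0 of λ
               { (yes eq) → eq
               ; (no i≢0) → contradiction e (z₁F (i , z≤n , i≤ , refl)
                   λ eq → i≢0 (F.at-inj i≤ z≤n (trans eq (sym F.at-0)))) } })
        (λ { i≤ (inj₁ Bu) → avoid {B} (F∉B i≤) Bu , B~F i≤ Bu
           ; {i} i≤ (inj₂ refl) → ≢-sym (D∩X (F-D i≤) X₂) , λ e → case i ≟ F.ℓ of λ
               { (yes eq) → eq
               ; (no i≢ℓ) → contradiction e (z₂F (i , z≤n , i≤ , refl)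
                   λ eq → i≢ℓ (F.at-inj i≤ ≤-refl (trans eq (sym F.at-ℓ)))) } })
        (leg-z₁ ∘ on-leg) (leg-z₂ ∘ on-leg)
        (λ { j≤ (i , m<i , i≤ , refl) → leg∉F (<⇒≤ m<i) i≤ j≤ , λ e → later m<i i≤ (_ , s≤s j≤ , e) })
        (x∉leg ∘ on-leg)
        (λ j≤ → leg∉F ≤-refl m≤ j≤) (λ eq → x∉leg (subst Leg* (sym eq) s∈leg))
        (λ { refl → leg-z₁ s∈leg }) (λ { refl → leg-z₂ s∈leg })
        exit (let (j , j< , e) = hit in j , s≤s⁻¹ j< , e)

      -- The sides only grow, each by one piece of the bypass, so `K` is kept and the length of the
      -- leg alone measures progress.
      shrink : SeesPair s F → Config K (Leg.ℓ ∸ m)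
      shrink (i , i<ℓ , si , si′ , only) = record
        { a = F.at i ; b = F.at (suc i) ; c = s ; γ = γ ; A = A′ ; B = B′
        ; a~b = F.link i<ℓ ; a~c = ~-sym si ; b~c = ~-sym si′
        ; Da = F-D i≤ ; Db = F-D i<ℓ
        ; A⊆D = [ A⊆D , (λ { (j , j< , refl) → F-D (≤-trans (<⇒≤ j<) i≤) }) ]′
        ; B⊆D = [ B⊆D , (λ { (j , _ , j≤ , refl) → F-D j≤ }) ]′
        ; cA = Conn-grow cA (Before-Conn F (≤-trans i≤ (n≤1+n _))) λ { (j , j< , _) →
            let (u , Au , e) = f₀A in u , F.at 0 , Au , (0 , ≤-trans (s≤s z≤n) j< , refl) ,
              subst (u ~_) (sym F.at-0) (~-sym e) }
        ; cB = Conn-grow cB (Seg-Conn F ≤-refl) λ { (j , i<j , j≤ , _) →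
            let (u , Bu , e) = f₁B in u , F.at F.ℓ , Bu , (F.ℓ , ≤-trans i<j j≤ , ≤-refl , refl) ,
              subst (u ~_) (sym F.at-ℓ) (~-sym e) }
        ; AB = λ
            { (inj₁ Au) (inj₁ Bv) → AB Au Bv
            ; (inj₁ Au) (inj₂ (k , i<k , k≤ , refl)) → avoid {A} (F∉A k≤) Au ,
                λ e → <⇒≢ (≤-trans (s≤s z≤n) i<k) (sym (A~F k≤ Au e))
            ; (inj₂ (j , j<i , refl)) (inj₁ Bv) → ≢-sym (avoid {B} (F∉B (j≤ j<i)) Bv) ,
                λ e → <⇒≢ (≤-trans j<i i≤) (B~F (j≤ j<i) Bv (~-sym e))
            ; (inj₂ (j , j<i , refl)) (inj₂ (k , i<k , k≤ , refl)) → far (≤-trans (s≤s j<i) (≤-trans (n≤1+n _) i<k)) k≤ }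
        ; a∉A = [ F∉A i≤ , (λ { (j , j<i , eq) → <⇒≢ j<i (F.at-inj (j≤ j<i) i≤ eq) }) ]′
        ; b∉B = [ F∉B i<ℓ , (λ { (k , i<k , k≤ , eq) → <⇒≢ i<k (sym (F.at-inj k≤ i<ℓ eq)) }) ]′
        ; aA = reach-A i i<ℓ
        ; bB = reach-B
        ; aB = λ
            { refl (inj₁ Bv) → ≢-sym (avoid {B} (F∉B i≤) Bv) , λ e → <⇒≢ i<ℓ (B~F i≤ Bv (~-sym e))
            ; refl (inj₂ (k , i<k , k≤ , refl)) → far i<k k≤ }
        ; bA = λ
            { refl (inj₁ Au) → ≢-sym (avoid {A} (F∉A i<ℓ) Au) ,
                λ e → case A~F i<ℓ Au (~-sym e) of λ ()
            ; refl (inj₂ (j , j<i , refl)) → let (ne , na) = far (s≤s j<i) i<ℓ in ≢-sym ne , na ∘ ~-sym }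
        ; heavyA = Many-mono ≤-refl (λ (Xv , u , Au , e) → Xv , u , inj₁ Au , e) heavyA
        ; heavyB = Many-mono ≤-refl (λ (Xv , u , Bu , e) → Xv , u , inj₁ Bu , e) heavyB
        ; Xγ = Xγ ; leg = drop leg m m≤ ; leg-len = refl
        ; legA = λ
            { k≤ refl (inj₁ Au) → legA (up k≤) refl Au
            ; {k} k≤ refl (inj₂ (j , j<i , refl)) → leg∉F (m≤m+n m k) (up k≤) (j≤ j<i) , λ e →
                case sees {k} k≤ (j≤ j<i) e of λ
                  { (inj₁ eq) → <⇒≢ j<i eq ; (inj₂ eq) → <⇒≢ (≤-trans j<i (n≤1+n i)) eq } }
        ; legB = λ
            { k≤ refl (inj₁ Bu) → legB (up k≤) refl Bu
            ; {k} k≤ refl (inj₂ (j , i<j , j≤ , refl)) → leg∉F (m≤m+n m k) (up k≤) j≤ , λ e →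
                case sees {k} k≤ j≤ e of λ
                  { (inj₁ eq) → <⇒≢ (≤-trans (n≤1+n _) i<j) (sym eq) ; (inj₂ eq) → <⇒≢ i<j (sym eq) } }
        ; leg-a = λ { {k} 0<k k≤ refl refl → beyond 0<k k≤ i≤ }
        ; leg-b = λ { {k} 0<k k≤ refl refl → beyond 0<k k≤ i<ℓ } }
        where
        i≤ : i ≤ F.ℓ
        i≤ = <⇒≤ i<ℓ
        A′ B′ : Sub
        A′ = A ∪ Before F i
        B′ = B ∪ Seg F (suc (suc i)) F.ℓ
        j≤ : ∀ {j} → j < i → j ≤ F.ℓ
        j≤ j<i = ≤-trans (<⇒≤ j<i) i≤
        far : ∀ {j k} → suc j < k → k ≤ F.ℓ → F.at j ≢ F.at k × ¬ (F.at j ~ F.at k)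
        far {j} {k} 1+j<k k≤ =
          (λ eq → <⇒≢ (<⇒≤ 1+j<k) (F.at-inj j≤′ k≤ eq)) ,
          (λ e → case F.at-adj j≤′ k≤ e of λ
            { (inj₁ eq) → <⇒≢ 1+j<k eq
            ; (inj₂ eq) → <⇒≢ (≤-trans 1+j<k (≤-trans (n≤1+n k) (≤-trans (≤-reflexive eq) (n≤1+n j)))) refl })
          where
          j≤′ : j ≤ F.ℓ
          j≤′ = ≤-trans (n≤1+n j) (≤-trans (<⇒≤ 1+j<k) k≤)
        up : ∀ {k} → k ≤ Leg.ℓ ∸ m → m + k ≤ Leg.ℓ
        up k≤ = ≤-trans (+-monoʳ-≤ m k≤) (≤-reflexive (m+[n∸m]≡n m≤))
        beyond : ∀ {j k} → 0 < k → k ≤ Leg.ℓ ∸ m → j ≤ F.ℓ →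
                 Leg.at (m + k) ≢ F.at j × ¬ (Leg.at (m + k) ~ F.at j)
        beyond {j} {k} 0<k k≤ j≤ = leg∉F (m≤m+n m k) (up k≤) j≤ ,
          λ e → later (m<m+n m 0<k) (up k≤) (j , s≤s j≤ , e)
        sees : ∀ {k j} → k ≤ Leg.ℓ ∸ m → j ≤ F.ℓ → Leg.at (m + k) ~ F.at j → j ≡ i ⊎ j ≡ suc i
        sees {zero} _ j≤ e = only j≤ (subst (λ n → Leg.at n ~ _) (+-identityʳ m) e)
        sees {suc k} k≤ j≤ e = contradiction e (proj₂ (beyond (s≤s z≤n) k≤ j≤))
        reach-A : ∀ i → i < F.ℓ → Touches (A ∪ Before F i) (F.at i)
        reach-A zero _ = let (u , Au , e) = f₀A in u , inj₁ Au , subst (_~ u) (sym F.at-0) e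
        reach-A (suc k) k< = F.at k , inj₂ (k , ≤-refl , refl) , ~-sym (F.link (<⇒≤ k<))
        reach-B : Touches B′ (F.at (suc i))
        reach-B with m≤n⇒m<n∨m≡n i<ℓ
        ... | inj₁ 1+i< = F.at (suc (suc i)) , inj₂ (suc (suc i) , ≤-refl , 1+i< , refl) , F.link 1+i<
        ... | inj₂ eq = let (u , Bu , e) = f₁B in u , inj₁ Bu ,
          subst (_~ u) (trans (sym F.at-ℓ) (cong F.at (sym eq))) e

    c-sees-pair : (∀ {l′} → l′ < l → ¬ Config K l′) → SeesPair c F
    c-sees-pair shorter with anyUpTo? Hit? (suc Leg.ℓ)
    ... | no none = ⊥-elim (unseen none)
    ... | yes (i , i< , hit) with lastIndex Hit? Leg.ℓ (i , s≤s⁻¹ i< , hit)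
    ... | zero , m≤ , h , later = subst (λ v → SeesPair v F) Leg.at-0 (LastHit.pair zero m≤ h later)
    ... | suc m , m≤ , h , later = ⊥-elim (shorter
      (≤-trans (∸-monoʳ-< (s≤s z≤n) m≤) (≤-reflexive leg-len))
      (LastHit.shrink (suc m) m≤ h later (LastHit.pair (suc m) m≤ h later)))

-- Ramsey on the α's, on the β's, and then on the direction of the edges between them.
rungBound : ℕ → ℕ
rungBound t = ram t (ram t (ram 4 4))

-- 9 for the choice of exits, and the rest to keep three neighbours in X after removing a, b, c
-- and two vertices of each rung.
bulk : ℕ → ℕ
bulk t = 9 + (rungBound t + (rungBound t + 6))

-- fan z is the part in D of the path from x to y through z.
record Fan (G : Graph) (𝒜 : Apex G) : Set₁ where
  open Basics G
  open Apex 𝒜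
  field
    y            : V G
    Dy           : D y
    D-conn       : Conn D
    y-triangle   : ∀ {u v} → (D ∪ X) u → (D ∪ X) v → y ~ u → y ~ v → ¬ (u ~ v)
    fan          : V G → Sub
    fan⊆D        : ∀ {z} → X z → fan z ⊆ D
    fan-reach    : ∀ {z} → X z → ∃[ p ] z ~ p × Reach (fan z) p y
    fan-disjoint : ∀ {z z′ v} → X z → X z′ → z ≢ z′ → fan z v → fan z′ v → v ≡ y
    t            : ℕ
    no-clique    : ¬ HasClique G t

-- Many bypasses by way of `y`, and the squares they force

module Separation (G : Graph) (𝒜 : Apex G) (ℱ : Fan G 𝒜) where
  open Shrinking G 𝒜 public
  open Fan ℱ public

  Outside : List (V G) → Sub
  Outside Z v = D v × v ∉ Z

  -- A vertex other than `y` lies on at most one fan, so each member of `Z` spoils at most one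
  -- vertex of `X`.
  avoid-fans : ∀ {k} Z {Q : Sub} → y ∉ Z → Q ⊆ X → Many (length Z + k) Q →
               ¬ ¬ Many k (λ v → Q v × (∀ {w} → w ∈ Z → ¬ fan v w))
  avoid-fans [] _ _ m done = done (Many-mono ≤-refl (λ q → q , λ ()) m)
  avoid-fans (w ∷ Z) {Q} y∉ Q⊆X m done = do
    m₁ ← prune {r = 1} (λ v → fan v w) m few
    m₂ ← avoid-fans Z (y∉ ∘ there) (Q⊆X ∘ proj₁) m₁
    done (Many-mono ≤-refl
      (λ { ((q , ¬fw) , h) → q , λ { (here refl) → ¬fw ; (there w∈) → h w∈ } }) m₂)
    where
    few : ¬ Many 2 (λ v → Q v × fan v w)
    few (u ∷ v ∷ _ , (u≢v ∷ _) ∷ _ , _ , (Qu , fu) ∷ (Qv , fv) ∷ _) =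
      y∉ (here (sym (fan-disjoint (Q⊆X Qu) (Q⊆X Qv) u≢v fu fv)))
    few (_ ∷ [] , _ , s≤s () , _)

  -- Otherwise A and the component of y outside Z are two sides with three common neighbours in X.
  heavy-reaches-y : ∀ {A} Z → y ∉ Z → A ⊆ D → (∀ {v} → A v → v ∉ Z) → Conn A →
                    Heavy (length Z + 3) A → ¬ ¬ (∃[ u ] A u × Reach (Outside Z) u y)
  heavy-reaches-y {A} Z y∉ A⊆D A∌Z cA heavy k = do
    m ← avoid-fans Z y∉ proj₁ heavy
    few-common A⊆D (proj₁ ∘ source) cA Conn-component
      (λ Au r → (λ { refl → k (_ , Au , r) }) ,
                λ e → k (_ , Au , step (A⊆D Au , A∌Z Au) e r))
      (Many-mono ≤-refl (λ ((Xv , tA) , free) → Xv , tA ,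
        let (p , e , r) = fan-reach Xv in
        p , Reach-mono (λ f → fan⊆D Xv f , λ v∈ → free v∈ f) r , e) m)

  module _ {K l} (𝒞 : Config K l) where
    open Config 𝒞
    open Bypassing 𝒞
    private module Leg = Chain leg

    -- The walk is shortened to an induced path and cut at its last vertex touching `A`, and then at
    -- the first vertex from there on that touches `B`. The part between the cuts lies outside both
    -- sets, since entering one would require touching it too late or too early.
    trim : ∀ Z → a ∈ Z → b ∈ Z → c ∈ Z → ∀ {u v} → A u → B v → Reach (Outside Z) u v →
           ¬ ¬ (Σ Bypass λ 𝒷 → ∀ {i} → i ≤ Chain.ℓ (Bypass.F 𝒷) → Chain.at (Bypass.F 𝒷) i ∉ Z)
    trim Z a∈ b∈ c∈ {u} {v} Au Bv r k = do
      tA? ← decide (Touches A)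
      tB? ← decide (Touches B)
      k (cut tA? tB? (shortcut r))
      where
      cut : (∀ v → Dec (Touches A v)) → (∀ v → Dec (Touches B v)) → Chain (Outside Z) u v →
            Σ Bypass λ 𝒷 → ∀ {i} → i ≤ Chain.ℓ (Bypass.F 𝒷) → Chain.at (Bypass.F 𝒷) i ∉ Z
      cut tA? tB? C with lastIndex (tA? ∘ Chain.at C) (Chain.ℓ C)
        (1 , 1≤ , u , Au , ~-sym (subst (_~ Chain.at C 1) (Chain.at-0 C) (Chain.link C 1≤)))
        where
        1≤ : 1 ≤ Chain.ℓ C
        1≤ = 1≤length C (proj₁ (AB Au Bv))
      ... | i , i≤ , tA , after = cut′ (Chain.ℓ T) refl
        where
        module C = Chain C
        T : Chain (Outside Z) (C.at i) v
        T = drop C i i≤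
        module T = Chain T
        up : ∀ {k} → k ≤ T.ℓ → i + k ≤ C.ℓ
        up k≤ = ≤-trans (+-monoʳ-≤ i k≤) (≤-reflexive (m+[n∸m]≡n i≤))
        T∉A : ∀ {k} → k ≤ T.ℓ → ¬ A (T.at k)
        T∉A {k} k≤ Aw with m≤n⇒m<n∨m≡n (up k≤)
        ... | inj₁ k< = after (s≤s (m≤m+n i k)) k< (_ , Aw , ~-sym (C.link k<))
        ... | inj₂ eq = proj₁ (AB Aw Bv) (trans (cong C.at eq) C.at-ℓ)
        tA₀ : Touches A (T.at 0)
        tA₀ = subst (Touches A) (sym T.at-0) tA
        T₀∉B : ¬ B (T.at 0)
        T₀∉B Bw = let (w , Aw , e) = tA₀ in proj₂ (AB Aw Bw) (~-sym e)
        cut′ : ∀ n → n ≡ T.ℓ → Σ Bypass λ 𝒷 →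
               ∀ {i} → i ≤ Chain.ℓ (Bypass.F 𝒷) → Chain.at (Bypass.F 𝒷) i ∉ Z
        cut′ zero eq = contradiction (subst B (trans (sym T.at-ℓ) (cong T.at (sym eq))) Bv) T₀∉B
        cut′ (suc n) eq with firstIndex (tB? ∘ T.at) n
          (v , Bv , subst (T.at n ~_) (trans (cong T.at eq) T.at-ℓ) (T.link (≤-reflexive eq)))
        ... | j , j≤n , tB , before = record
          { f₀ = C.at i ; f₁ = T.at j ; F = F ; f₀A = tA ; f₁B = tB
          ; onlyA = λ { {zero} _ _ → T.at-0
                      ; {suc k} k≤ tw → contradiction tw
                          (after (m<m+n i (s≤s z≤n)) (up (≤-trans k≤ (<⇒≤ j<)))) }
          ; onlyB = λ {k} k≤ tw → cong T.at (≤-antisym k≤ (≮⇒≥ λ k<j → before k<j tw)) } ,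
          λ k≤ → proj₂ (T.inS (≤-trans k≤ (<⇒≤ j<)))
          where
          j< : j < T.ℓ
          j< = ≤-trans (s≤s j≤n) (≤-reflexive eq)
          T∉B : ∀ {k} → k ≤ j → ¬ B (T.at k)
          T∉B {zero} _ = T₀∉B
          T∉B {suc k} k<j Bw = before k<j (_ , Bw , T.link (≤-trans k<j (<⇒≤ j<)))
          F : Chain Off (C.at i) (T.at j)
          F = widen (take T j (<⇒≤ j<)) λ {k} k≤ →
            let (d , ∉Z) = T.inS (≤-trans k≤ (<⇒≤ j<)) in
            d , ((λ eq → ∉Z (subst (_∈ Z) (sym eq) a∈)) , (λ eq → ∉Z (subst (_∈ Z) (sym eq) b∈)) ,
                 (λ eq → ∉Z (subst (_∈ Z) (sym eq) c∈))) ,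
            T∉A (≤-trans k≤ (<⇒≤ j<)) , T∉B k≤

    record Rung : Set where
      constructor rung
      field
        bypass : Bypass
        pair   : SeesPair c (Bypass.F bypass)
      open Bypass bypass public
      module F = Chain F
      i : ℕ
      i = proj₁ pair
      i< : i < F.ℓ
      i< = proj₁ (proj₂ pair)
      α β : V G
      α = F.at i
      β = F.at (suc i)
      c~α : c ~ α
      c~α = proj₁ (proj₂ (proj₂ pair))
      c~β : c ~ β
      c~β = proj₁ (proj₂ (proj₂ (proj₂ pair)))
      only : ∀ {j} → j ≤ F.ℓ → c ~ F.at j → j ≡ i ⊎ j ≡ suc i
      only = proj₂ (proj₂ (proj₂ (proj₂ pair)))
      α~β : α ~ β
      α~β = F.link i<
      Dα : D α
      Dα = proj₁ (F.inS (<⇒≤ i<))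
      Dβ : D β
      Dβ = proj₁ (F.inS i<)
      A~F : ∀ {j u} → j ≤ F.ℓ → A u → u ~ F.at j → j ≡ 0
      A~F j≤ Au e = F.at-inj j≤ z≤n (trans (onlyA j≤ (_ , Au , ~-sym e)) (sym F.at-0))
      B~F : ∀ {j u} → j ≤ F.ℓ → B u → u ~ F.at j → j ≡ F.ℓ
      B~F j≤ Bu e = F.at-inj j≤ ≤-refl (trans (onlyB j≤ (_ , Bu , ~-sym e)) (sym F.at-ℓ))

    c∈ : (D ∪ X) c
    c∈ with Leg.inS z≤n
    ... | inj₁ d  = inj₁ (subst D Leg.at-0 d)
    ... | inj₂ eq = inj₂ (subst X (trans eq Leg.at-0) Xγ)

    cA′ : Apart ｛ c ｝ A
    cA′ refl Au = legA z≤n Leg.at-0 Au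

    cB′ : Apart ｛ c ｝ B
    cB′ refl Bu = legB z≤n Leg.at-0 Bu

    module _ (9≤K : 9 ≤ K) (shorter : ∀ {l′} → l′ < l → ¬ Config K l′) where

      -- Following R′ up to k and then R from m on gives a bypass on which c sees at most α R′ and
      -- β R; since c sees two consecutive vertices of it, these two are adjacent.
      mixed : (R R′ : Rung) → ∀ {k m} → k ≤ Rung.i R′ → Rung.i R < m → m ≤ Rung.F.ℓ R →
              Rung.F.at R′ k ≡ Rung.F.at R m ⊎ Rung.F.at R′ k ~ Rung.F.at R m →
              ¬ (Rung.α R′ ~ Rung.β R) → ⊥
      mixed R R′ {k} {m} k≤i′ i<m m≤ meet α′≁β = do
        (_ , _ , ex) ← exits 𝒷 9≤K
        let (j , j< , cj , cj′ , _) = c-sees-pair 𝒞 𝒷 ex shorter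
        clash (see (C.inS (<⇒≤ j<)) cj) (see (C.inS j<) cj′) (C.link j<)
        where
        module R = Rung R
        module R′ = Rung R′
        k≤ : k ≤ R′.F.ℓ
        k≤ = ≤-trans k≤i′ (<⇒≤ R′.i<)
        S : Sub
        S = Seg R′.F 0 k ∪ Seg R.F m R.F.ℓ
        left : Reach S R′.f₀ (R′.F.at k)
        left = Reach-mono inj₁ (subst (λ v → Reach (Seg R′.F 0 k) v (R′.F.at k)) R′.F.at-0
          (Seg-reach R′.F k z≤n z≤n ≤-refl k≤))
        right : Reach S (R.F.at m) R.f₁
        right = Reach-mono inj₂ (subst (Reach (Seg R.F m R.F.ℓ) (R.F.at m)) R.F.at-ℓ
          (Seg-reach R.F R.F.ℓ ≤-refl m≤ ≤-refl ≤-refl))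
        C : Chain S R′.f₀ R.f₁
        C = shortcut (Reach-trans left ([ (λ eq → subst (λ v → Reach S v R.f₁) (sym eq) right) ,
                                          (λ e → step (target left) e right) ]′ meet))
        module C = Chain C
        off : S ⊆ Off
        off (inj₁ (j , _ , j≤ , refl)) = R′.F.inS (≤-trans j≤ k≤)
        off (inj₂ (j , _ , j≤ , refl)) = R.F.inS j≤
        𝒷 : Bypass
        𝒷 = record
          { f₀ = R′.f₀ ; f₁ = R.f₁ ; F = widen C (off ∘ C.inS) ; f₀A = R′.f₀A ; f₁B = R.f₁B
          ; onlyA = λ j≤ → startA (C.inS j≤) ; onlyB = λ j≤ → endB (C.inS j≤) }
          where
          startA : ∀ {v} → S v → Touches A v → v ≡ R′.f₀
          startA (inj₁ (j , _ , j≤ , refl)) tv = R′.onlyA (≤-trans j≤ k≤) tv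
          startA (inj₂ (j , m≤j , j≤ , refl)) (_ , Aw , e) =
            contradiction (sym (R.A~F j≤ Aw (~-sym e))) (<⇒≢ (≤-trans (s≤s z≤n) (≤-trans i<m m≤j)))
          endB : ∀ {v} → S v → Touches B v → v ≡ R.f₁
          endB (inj₁ (j , _ , j≤ , refl)) (_ , Bw , e) =
            contradiction (R′.B~F (≤-trans j≤ k≤) Bw (~-sym e)) (<⇒≢ (≤-trans (s≤s (≤-trans j≤ k≤i′)) R′.i<))
          endB (inj₂ (j , _ , j≤ , refl)) tv = R.onlyB j≤ tv
        see : ∀ {v} → S v → c ~ v → v ≡ R′.α ⊎ v ≡ R.β
        see (inj₁ (j , _ , j≤ , refl)) e with R′.only (≤-trans j≤ k≤) e
        ... | inj₁ refl = inj₁ refl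
        ... | inj₂ refl = contradiction (≤-trans j≤ k≤i′) (<⇒≱ ≤-refl)
        see (inj₂ (j , m≤j , j≤ , refl)) e with R.only j≤ e
        ... | inj₁ refl = contradiction (≤-trans i<m m≤j) (<⇒≱ ≤-refl)
        ... | inj₂ refl = inj₂ refl
        clash : ∀ {u v} → u ≡ R′.α ⊎ u ≡ R.β → v ≡ R′.α ⊎ v ≡ R.β → u ~ v → ⊥
        clash (inj₁ refl) (inj₁ refl) e = E-irr G e
        clash (inj₁ refl) (inj₂ refl) e = α′≁β e
        clash (inj₂ refl) (inj₁ refl) e = α′≁β (~-sym e)
        clash (inj₂ refl) (inj₂ refl) e = E-irr G e

      -- The triangles c α β and c α′ β′ are linked through A, through c, and through B.
      crossed : (R R′ : Rung) → Rung.α R ≢ Rung.α R′ → Rung.β R ≢ Rung.β R′ →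
                ¬ (Rung.α R ~ Rung.β R′) → ¬ (Rung.α R′ ~ Rung.β R) → ⊥
      crossed R R′ α≢α′ β≢β′ α≁β′ α′≁β = no-linked-triangles
        (three R.α c R.β) (three R′.α c R′.β) U ρ
        (pairs {R = λ i j → three R.α c R.β i ~ three R.α c R.β j} ~-sym (~-sym R.c~α) R.α~β R.c~β)
        (pairs {R = λ i j → three R′.α c R′.β i ~ three R′.α c R′.β j} ~-sym (~-sym R′.c~α) R′.α~β R′.c~β)
        (pairs {R = Q} (λ h u v → let (ne , f) = h v u in ≢-sym ne ,
            λ e → [ (λ (r , s) → inj₁ (s , r)) , (λ (r , s) → inj₂ (s , r)) ]′ (f (~-sym e)))
          Q₀₁ Q₀₂ Q₁₂)
        λ { fz _ _ eq _ → contradiction eq α≢α′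
          ; (fs (fs fz)) _ _ eq _ → contradiction eq β≢β′
          ; (fs fz) fz _ _ → α≢α′
          ; (fs fz) (fs fz) i≢j _ → contradiction refl i≢j
          ; (fs fz) (fs (fs fz)) _ _ → β≢β′ }
        where
        module R = Rung R
        module R′ = Rung R′
        Low High : Rung → Sub
        Low r = Seg (Rung.F r) 0 (Rung.i r)
        High r = Seg (Rung.F r) (suc (Rung.i r)) (Rung.F.ℓ r)
        U : Fin 3 → Sub
        -- The middle link is the single vertex `c`, so what arises here is the wheel with centre
        -- `c` and spokes to both α and both β.
        U = three (A ∪ (Low R ∪ Low R′)) ｛ c ｝ (B ∪ (High R ∪ High R′))
        Q : Fin 3 → Fin 3 → Set
        Q i j = ∀ {u v} → U i u → U j v → u ≢ v ×
          (u ~ v → (u ≡ three R.α c R.β i × v ≡ three R.α c R.β j) ⊎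
                   (u ≡ three R′.α c R′.β i × v ≡ three R′.α c R′.β j))
        to-A : (r : Rung) {S : Sub} → Low r ⊆ S → A ⊆ S → ∃[ u ] A u × Reach S (Rung.α r) u
        to-A r f g = let (u , Au , e) = Rung.f₀A r in u , Au ,
          snoc (Reach-mono f (Reach-sym (Seg-reach (Rung.F r) (Rung.i r) z≤n z≤n ≤-refl (<⇒≤ (Rung.i< r)))))
            (subst (_~ u) (sym (Rung.F.at-0 r)) e) (g Au)
        to-B : (r : Rung) {S : Sub} → High r ⊆ S → B ⊆ S → ∃[ u ] B u × Reach S (Rung.β r) u
        to-B r f g = let (u , Bu , e) = Rung.f₁B r in u , Bu ,
          snoc (Reach-mono f (Seg-reach (Rung.F r) (Rung.F.ℓ r) ≤-refl (Rung.i< r) ≤-refl ≤-refl))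
            (subst (_~ u) (sym (Rung.F.at-ℓ r)) e) (g Bu)
        ρ : ∀ i → Reach (U i) (three R.α c R.β i) (three R′.α c R′.β i)
        ρ fz = let (_ , Au , r) = to-A R {U fz} (inj₂ ∘ inj₁) inj₁ ; (_ , Av , r′) = to-A R′ {U fz} (inj₂ ∘ inj₂) inj₁ in
          Reach-trans r (Reach-trans (Reach-mono inj₁ (cA Au Av)) (Reach-sym r′))
        ρ (fs fz) = stop refl
        ρ (fs (fs fz)) = let (_ , Bu , r) = to-B R {U (fs (fs fz))} (inj₂ ∘ inj₁) inj₁
                             (_ , Bv , r′) = to-B R′ {U (fs (fs fz))} (inj₂ ∘ inj₂) inj₁ in
          Reach-trans r (Reach-trans (Reach-mono inj₁ (cB Bu Bv)) (Reach-sym r′))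
        c∉F : (r : Rung) → ∀ {j} → j ≤ Rung.F.ℓ r → Rung.F.at r j ≢ c
        c∉F r j≤ = proj₂ (proj₂ (proj₁ (proj₂ (Rung.F.inS r j≤))))
        low-c : (r : Rung) → ∀ {u} → Low r u → u ≢ c × (u ~ c → u ≡ Rung.α r)
        low-c r (j , _ , j≤ , refl) = c∉F r (≤-trans j≤ (<⇒≤ (Rung.i< r))) , λ e →
          case Rung.only r (≤-trans j≤ (<⇒≤ (Rung.i< r))) (~-sym e) of λ
            { (inj₁ refl) → refl ; (inj₂ refl) → contradiction j≤ (<⇒≱ ≤-refl) }
        high-c : (r : Rung) → ∀ {u} → High r u → c ≢ u × (c ~ u → u ≡ Rung.β r)
        high-c r (j , i<j , j≤ , refl) = ≢-sym (c∉F r j≤) , λ e →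
          case Rung.only r j≤ e of λ
            { (inj₁ refl) → contradiction i<j (<⇒≱ ≤-refl) ; (inj₂ refl) → refl }
        A-high : (r : Rung) → ∀ {u v} → A u → High r v → u ≢ v × ¬ (u ~ v)
        A-high r Au (j , i<j , j≤ , refl) =
          (λ { refl → proj₁ (proj₂ (proj₂ (Rung.F.inS r j≤))) Au }) ,
          (λ e → <⇒≢ (≤-trans (s≤s z≤n) i<j) (sym (Rung.A~F r j≤ Au e)))
        low-B : (r : Rung) → ∀ {u v} → Low r u → B v → u ≢ v × ¬ (u ~ v)
        low-B r (j , _ , j≤ , refl) Bv =
          (λ { refl → proj₂ (proj₂ (proj₂ (Rung.F.inS r (≤-trans j≤ (<⇒≤ (Rung.i< r)))))) Bv }) ,
          (λ e → <⇒≢ (≤-trans (s≤s j≤) (Rung.i< r)) (Rung.B~F r (≤-trans j≤ (<⇒≤ (Rung.i< r))) Bv (~-sym e)))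
        low-high : (r : Rung) → ∀ {u v} → Low r u → High r v → u ≢ v × (u ~ v → u ≡ Rung.α r × v ≡ Rung.β r)
        low-high r (j , _ , j≤i , refl) (k , i<k , k≤ , refl) =
          (λ eq → <⇒≢ (≤-trans (s≤s j≤i) i<k) (Rung.F.at-inj r j≤ k≤ eq)) ,
          (λ e → case Rung.F.at-adj r j≤ k≤ e of λ
            { (inj₁ refl) → let eq = ≤-antisym j≤i (s≤s⁻¹ i<k) in
                cong (Rung.F.at r) eq , cong (Rung.F.at r ∘ suc) eq
            ; (inj₂ refl) → contradiction (≤-trans i<k (≤-trans (n≤1+n k) j≤i)) (<⇒≱ ≤-refl) })
          where
          j≤ : j ≤ Rung.F.ℓ r
          j≤ = ≤-trans j≤i (<⇒≤ (Rung.i< r))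
        low-high′ : (r r′ : Rung) → ¬ (Rung.α r′ ~ Rung.β r) →
                    ∀ {u v} → Low r′ u → High r v → u ≢ v × ¬ (u ~ v)
        low-high′ r r′ na (j , _ , j≤i , refl) (k , i<k , k≤ , refl) =
          (λ eq → mixed r r′ j≤i i<k k≤ (inj₁ eq) na) ,
          (λ e → mixed r r′ j≤i i<k k≤ (inj₂ e) na)
        never : ∀ {u v} {P : Set} → u ≢ v × ¬ (u ~ v) → u ≢ v × (u ~ v → P)
        never (ne , na) = ne , λ e → contradiction e na
        Q₀₁ : Q fz (fs fz)
        Q₀₁ (inj₁ Au) refl = let (ne , na) = cA′ refl Au in ≢-sym ne , λ e → contradiction (~-sym e) na
        Q₀₁ (inj₂ (inj₁ lo)) refl = let (ne , f) = low-c R lo in ne , λ e → inj₁ (f e , refl)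
        Q₀₁ (inj₂ (inj₂ lo)) refl = let (ne , f) = low-c R′ lo in ne , λ e → inj₂ (f e , refl)
        Q₁₂ : Q (fs fz) (fs (fs fz))
        Q₁₂ refl (inj₁ Bv) = never (cB′ refl Bv)
        Q₁₂ refl (inj₂ (inj₁ hi)) = let (ne , f) = high-c R hi in ne , λ e → inj₁ (refl , f e)
        Q₁₂ refl (inj₂ (inj₂ hi)) = let (ne , f) = high-c R′ hi in ne , λ e → inj₂ (refl , f e)
        Q₀₂ : Q fz (fs (fs fz))
        Q₀₂ (inj₁ Au) (inj₁ Bv) = never (AB Au Bv)
        Q₀₂ (inj₁ Au) (inj₂ (inj₁ hi)) = never (A-high R Au hi)
        Q₀₂ (inj₁ Au) (inj₂ (inj₂ hi)) = never (A-high R′ Au hi)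
        Q₀₂ (inj₂ (inj₁ lo)) (inj₁ Bv) = never (low-B R lo Bv)
        Q₀₂ (inj₂ (inj₂ lo)) (inj₁ Bv) = never (low-B R′ lo Bv)
        Q₀₂ (inj₂ (inj₁ lo)) (inj₂ (inj₁ hi)) = let (ne , f) = low-high R lo hi in ne , inj₁ ∘ f
        Q₀₂ (inj₂ (inj₂ lo)) (inj₂ (inj₂ hi)) = let (ne , f) = low-high R′ lo hi in ne , inj₂ ∘ f
        Q₀₂ (inj₂ (inj₁ lo)) (inj₂ (inj₂ hi)) = never (low-high′ R′ R α≁β′ lo hi)
        Q₀₂ (inj₂ (inj₂ lo)) (inj₂ (inj₁ hi)) = never (low-high′ R R′ α′≁β lo hi)

      Distinct : Rung → Rung → Set
      Distinct R R′ = (Rung.α R ≢ Rung.α R′ × Rung.α R ≢ Rung.β R′) ×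
                      (Rung.β R ≢ Rung.α R′ × Rung.β R ≢ Rung.β R′)

      used : List Rung → List (V G)
      used []       = a ∷ b ∷ c ∷ []
      used (R ∷ Rs) = Rung.α R ∷ Rung.β R ∷ used Rs

      base∈ : ∀ {v} Rs → v ∈ used [] → v ∈ used Rs
      base∈ []       v∈ = v∈
      base∈ (R ∷ Rs) v∈ = there (there (base∈ Rs v∈))

      -- Every used vertex lies in the triangle `a b c` or in a triangle `c α β`, whereas `y` lies
      -- in no triangle.
      used-misses : ∀ Rs {v} → v ∈ used Rs → ¬ A v × ¬ B v × v ≢ y
      used-misses [] (here refl) = a∉A , (λ Ba → proj₁ (aB refl Ba) refl) ,
        λ { refl → y-triangle (inj₁ Db) c∈ a~b a~c b~c }
      used-misses [] (there (here refl)) = (λ Ab → proj₁ (bA refl Ab) refl) , b∉B ,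
        λ { refl → y-triangle (inj₁ Da) c∈ (~-sym a~b) b~c a~c }
      used-misses [] (there (there (here refl))) =
        (λ Ac → proj₁ (cA′ refl Ac) refl) , (λ Bc → proj₁ (cB′ refl Bc) refl) ,
        λ { refl → y-triangle (inj₁ Da) (inj₁ Db) (~-sym a~c) (~-sym b~c) a~b }
      used-misses (R ∷ Rs) (here refl) = let (_ , _ , ∉A , ∉B) = Rung.F.inS R (<⇒≤ (Rung.i< R)) in ∉A , ∉B ,
        λ eq → y-triangle (inj₁ (Rung.Dβ R)) c∈ (subst (_~ Rung.β R) eq (Rung.α~β R))
                 (subst (_~ c) eq (~-sym (Rung.c~α R))) (~-sym (Rung.c~β R))
      used-misses (R ∷ Rs) (there (here refl)) = let (_ , _ , ∉A , ∉B) = Rung.F.inS R (Rung.i< R) in ∉A , ∉B ,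
        λ eq → y-triangle (inj₁ (Rung.Dα R)) c∈ (subst (_~ Rung.α R) eq (~-sym (Rung.α~β R)))
                 (subst (_~ c) eq (~-sym (Rung.c~β R))) (~-sym (Rung.c~α R))
      used-misses (R ∷ Rs) (there (there v∈)) = used-misses Rs v∈

      unused : ∀ Rs R → (∀ {j} → j ≤ Rung.F.ℓ R → Rung.F.at R j ∉ used Rs) → All (Distinct R) Rs
      unused []        R h = []
      unused (R′ ∷ Rs) R h =
        (((λ eq → h (<⇒≤ (Rung.i< R)) (here eq)) , (λ eq → h (<⇒≤ (Rung.i< R)) (there (here eq)))) ,
         ((λ eq → h (Rung.i< R) (here eq)) , (λ eq → h (Rung.i< R) (there (here eq))))) ∷
        unused Rs R (λ j≤ v∈ → h j≤ (there (there v∈)))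

      length-used : ∀ Rs → length (used Rs) ≡ length Rs + (length Rs + 3)
      length-used [] = refl
      length-used (R ∷ Rs) = cong suc (trans (cong suc (length-used Rs)) (sym (+-suc _ _)))

      -- After removal of all used vertices, `A` and `B` are each still joined to `y`. The walk
      -- through `y` yields a bypass disjoint from the earlier α and β.
      rungs : ∀ m → m + (m + 6) ≤ K → ¬ ¬ (∃[ Rs ] length Rs ≡ m × AllPairs Distinct Rs)
      rungs zero _ k = k ([] , refl , [])
      rungs (suc m) m≤ k = do
        (Rs , refl , ap) ← rungs m (≤-trans (+-mono-≤ (n≤1+n m) (n≤1+n (m + 6))) m≤)
        let Z = used Rs
            Z≤ = ≤-trans (≤-reflexive (trans (cong (_+ 3) (length-used Rs))
                   (trans (+-assoc m (m + 3) 3) (cong (m +_) (+-assoc m 3 3)))))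
                   (≤-trans (+-mono-≤ (n≤1+n m) (n≤1+n (m + 6))) m≤)
            y∉ = λ (v∈ : y ∈ Z) → proj₂ (proj₂ (used-misses Rs v∈)) refl
        (u , Au , r) ← heavy-reaches-y Z y∉ A⊆D (λ Av v∈ → proj₁ (used-misses Rs v∈) Av) cA
                         (Many-mono Z≤ id heavyA)
        (v , Bv , r′) ← heavy-reaches-y Z y∉ B⊆D (λ Bv v∈ → proj₁ (proj₂ (used-misses Rs v∈)) Bv) cB
                          (Many-mono Z≤ id heavyB)
        (𝒷 , free) ← trim Z (base∈ Rs (here refl)) (base∈ Rs (there (here refl)))
                       (base∈ Rs (there (there (here refl)))) Au Bv (Reach-trans r (Reach-sym r′))
        (_ , _ , ex) ← exits 𝒷 9≤K
        let R = rung 𝒷 (c-sees-pair 𝒞 𝒷 ex shorter)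
        k (R ∷ Rs , refl , unused Rs R free ∷ ap)

      Ladder : List Rung → Set
      Ladder Rs = AllPairs Distinct Rs × AllPairs (λ R R′ → ¬ (Rung.α R ~ Rung.α R′)) Rs ×
                  AllPairs (λ R R′ → ¬ (Rung.β R ~ Rung.β R′)) Rs

      -- Four rungs are needed because `AllPairs` says nothing about a rung and itself: the first
      -- two supply the α and the last two the β of the square.
      no-forward : ∀ Rs → length Rs ≡ 4 → Ladder Rs → ¬ AllPairs (λ R R′ → Rung.α R ~ Rung.β R′) Rs
      no-forward (R₁ ∷ R₂ ∷ R₃ ∷ R₄ ∷ []) _
        ((((α≢ , _) , _) ∷ _) ∷ _ ∷ ((_ , (_ , β≢)) ∷ []) ∷ _ , (α≁ ∷ _) ∷ _ , _ ∷ _ ∷ (β≁ ∷ []) ∷ _)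
        ((_ ∷ e₁₃ ∷ e₁₄ ∷ []) ∷ (e₂₃ ∷ e₂₄ ∷ []) ∷ _) =
        no-C4 e₁₃ e₁₄ e₂₃ e₂₄ α≢ α≁ β≢ β≁

      -- `crossed` replaces each missing edge by the one in the opposite direction, so the square
      -- consists of the first two β and the last two α.
      no-backward : ∀ Rs → length Rs ≡ 4 → Ladder Rs → ¬ AllPairs (λ R R′ → ¬ (Rung.α R ~ Rung.β R′)) Rs
      no-backward (R₁ ∷ R₂ ∷ R₃ ∷ R₄ ∷ []) _
        ((d₁₂ ∷ d₁₃ ∷ d₁₄ ∷ []) ∷ (d₂₃ ∷ d₂₄ ∷ []) ∷ (d₃₄ ∷ []) ∷ _ , _ ∷ _ ∷ (α≁ ∷ []) ∷ _ , (β≁ ∷ _) ∷ _)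
        ((_ ∷ n₁₃ ∷ n₁₄ ∷ []) ∷ (n₂₃ ∷ n₂₄ ∷ []) ∷ _) = do
        e₁₃ ← back R₁ R₃ d₁₃ n₁₃
        e₁₄ ← back R₁ R₄ d₁₄ n₁₄
        e₂₃ ← back R₂ R₃ d₂₃ n₂₃
        e₂₄ ← back R₂ R₄ d₂₄ n₂₄
        no-C4 e₁₃ e₂₃ e₁₄ e₂₄ (proj₁ (proj₁ d₃₄)) α≁ (proj₂ (proj₂ d₁₂)) β≁
        where
        back : ∀ R R′ → Distinct R R′ → ¬ (Rung.α R ~ Rung.β R′) → ¬ ¬ (Rung.α R′ ~ Rung.β R)
        back R R′ ((α≢ , _) , (_ , β≢)) na nb = crossed R R′ α≢ β≢ na nb

      no-long-ladder : ∀ Rs → Ladder Rs → length Rs ≢ ram 4 4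
      no-long-ladder Rs (ds , αs , βs) len =
        [ (λ (Qs , sub , len′ , es) → no-forward Qs len′ (within sub) es) ,
          (λ (Qs , sub , len′ , ns) → no-backward Qs len′ (within sub) ns) ]′
        (ramsey (λ R R′ → E-dec G (Rung.α R) (Rung.β R′)) 4 4 Rs (≤-reflexive (sym len)))
        where
        within : ∀ {Qs} → Qs ⊑ Rs → Ladder Qs
        within sub = AllPairs-⊑ sub ds , AllPairs-⊑ sub αs , AllPairs-⊑ sub βs

      too-many-rungs : ∀ {Rs} → AllPairs Distinct Rs → length Rs ≢ rungBound t
      too-many-rungs {Rs} ds len
        with ramsey (λ R R′ → E-dec G (Rung.α R) (Rung.α R′)) t _ Rs (≤-reflexive (sym len))
      ... | inj₁ (Qs , _ , len′ , αs) = no-clique (subst (HasClique G) (trans (length-map Rung.α Qs) len′)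
        (list-clique {map Rung.α Qs} (AllPairsₚ.map⁺ αs)))
      ... | inj₂ (Qs , Qs⊑ , len′ , αs)
        with ramsey (λ R R′ → E-dec G (Rung.β R) (Rung.β R′)) t _ Qs (≤-reflexive (sym len′))
      ... | inj₁ (Ps , _ , len″ , βs) = no-clique (subst (HasClique G) (trans (length-map Rung.β Ps) len″)
        (list-clique {map Rung.β Ps} (AllPairsₚ.map⁺ βs)))
      ... | inj₂ (Ps , Ps⊑ , len″ , βs) =
        no-long-ladder Ps (AllPairs-⊑ Ps⊑ (AllPairs-⊑ Qs⊑ ds) , AllPairs-⊑ Ps⊑ αs , βs) len″

  no-config : ∀ l → ¬ Config (bulk t) l
  no-config = <-rec _ λ l shorter 𝒞 → do
    (Rs , len , ds) ← rungs 𝒞 (m≤m+n 9 _) (λ l′< → shorter l′<) (rungBound t) (m≤n+m _ 9)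
    too-many-rungs 𝒞 (m≤m+n 9 _) (λ l′< → shorter l′<) ds len

-- The tree-like structure of a minimal connected set

module Existence (G : Graph) (𝒜 : Apex G) (ℱ : Fan G 𝒜) where
  open Separation G 𝒜 ℱ public

  conn-¬¬ : ∀ {S} → (∀ {u v} → S u → S v → ¬ ¬ Reach S u v) → ¬ ¬ Conn S
  conn-¬¬ {S} h k = (¬¬-∀Fin λ u → ¬¬-∀Fin λ v → each u v) λ r → k λ {u} {v} → r u v
    where
    each : ∀ u v → ¬ ¬ (S u → S v → Reach S u v)
    each u v k = k λ su sv → ⊥-elim (h su sv λ r → k λ _ _ → r)

  module Tree (zs : List (V G)) (Xzs : All X zs) (L : Sub) (L⊆D : L ⊆ D) (cL : Conn L)
    (touchL : All (Touches L) zs)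
    (minL : ∀ T → T ⊆ L → Conn T × All (Touches T) zs → ∀ {z} → L z → ¬ ¬ T z) where

    Exit : Sub → V G → Set
    Exit T e = X e × ¬ Touches T e × Touches L e

    -- Otherwise `T` would touch all of `zs`, against the minimality of `L`.
    exit : ∀ {T z} → T ⊆ L → Conn T → L z → ¬ T z → ¬ ¬ (∃ (Exit T))
    exit {T} T⊆L cT Lz ¬Tz k = ¬¬-All
      (All.zipWith (λ (Xe , touch) ¬t → k (_ , Xe , ¬t , touch)) (Xzs , touchL))
      λ all → minL T T⊆L (cT , all) Lz ¬Tz

    -- `C` is a union of components of `L` without `v`.
    Closed : Sub → V G → Set
    Closed C v = C ⊆ L × ¬ C v × (∀ {c z} → C c → L z → c ~ z → z ≡ v ⊎ C z)

    -- A walk to `v` that starts outside `C` can enter `C` only from `v`, where it may as well stop.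
    rest : ∀ {C v} → Closed C v → L v → (∀ z → Dec (C z)) → Conn (λ z → L z × ¬ C z)
    rest {C} {v} (_ , ¬Cv , closed) Lv C? = Conn-via λ (Lu , ¬Cu) → avoid (cL Lu Lv) ¬Cu
      where
      avoid : ∀ {u} → Reach L u v → ¬ C u → Reach (λ z → L z × ¬ C z) u v
      avoid (stop Lu) ¬Cu = stop (Lu , ¬Cu)
      avoid (step {w = w} Lu e r) ¬Cu with C? w
      ... | no ¬Cw = step (Lu , ¬Cu) e (avoid r ¬Cw)
      ... | yes Cw with closed Cw Lu (~-sym e)
      ... | inj₁ refl = stop (Lu , ¬Cu)
      ... | inj₂ Cu   = contradiction Cu ¬Cu

    touch-root : ∀ {C v c} → Closed C v → L v → (∀ z → Dec (C z)) → C c → Touches C v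
    touch-root (C⊆L , ¬Cv , closed) Lv C? Cc
      with frontier C? (cL (C⊆L Cc) Lv) Cc ¬Cv
    ... | p , q , _ , Lq , Cp , ¬Cq , e with closed Cp Lq e
    ... | inj₁ refl = p , Cp , ~-sym e
    ... | inj₂ Cq   = contradiction Cq ¬Cq

    component : ∀ {u r} → Closed (λ z → Reach (L ∖ u) z r) u
    component = proj₁ ∘ source , (λ r → proj₂ (source r) refl) , λ {c} {z} r Lz e → case z Finₚ.≟ _ of λ
      { (yes eq) → inj₁ eq ; (no z≢u) → inj₂ (step (Lz , z≢u) (~-sym e) r) }

    record Branch (v : V G) (C : Sub) : Set where
      field
        closed : Closed C v
        conn   : Conn C
        C?     : ∀ z → Dec (C z)
        e      : V G
        Xe     : X e
        only-C : ∀ {w} → L w → e ~ w → C w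
        eC     : Touches C e

    -- The complement of `C` in `L` is connected and smaller than `L`, so some member of `X` that
    -- touches `L` does not touch it; all neighbours of that member in `L` are in `C`.
    branch : ∀ {C v c} → Closed C v → L v → Conn C → C c → ¬ ¬ Branch v C
    branch {C} cl@(C⊆L , ¬Cv , _) Lv cC Cc k = do
      C? ← decide C
      (e , Xe , ¬t , w , Lw , ew) ← exit {λ z → L z × ¬ C z} proj₁ (rest cl Lv C?) (C⊆L Cc) (λ (_ , ¬Cc) → ¬Cc Cc)
      let only : ∀ {w} → L w → e ~ w → C w
          only = λ {w} Lw ew → case C? w of λ
            { (yes Cw) → Cw ; (no ¬Cw) → contradiction (w , (Lw , ¬Cw) , ew) ¬t }
      k record { closed = cl ; conn = cC ; C? = C? ; e = e ; Xe = Xe ; only-C = only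
               ; eC = w , only Lw ew , ew }

    module _ {v C} (b : Branch v C) (Lv : L v) where
      open Branch b

      branch-link : Link (C ∪ ｛ e ｝) v x × ¬ (C ∪ ｛ e ｝) v × ¬ (C ∪ ｛ e ｝) x
      branch-link = (let module A = Arm (arm-X (L⊆D ∘ proj₁ closed) conn
                             (touch-root closed Lv C? (proj₁ (proj₂ eC))) Xe eC) in
                       A.p , A.o , A.v~p , A.reach , ~-sym A.x~o) ,
        [ proj₁ (proj₂ closed) , (λ { refl → D∩X (L⊆D Lv) Xe refl }) ]′ ,
        [ (λ Cx → proj₁ (x∉D (L⊆D (proj₁ closed Cx))) refl) , (λ { refl → E-irr G (x~X Xe) }) ]′

    branches-apart : ∀ {v C C′} (b : Branch v C) (b′ : Branch v C′) → (∀ {z} → C z → ¬ C′ z) →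
                     Apart (C ∪ ｛ Branch.e b ｝) (C′ ∪ ｛ Branch.e b′ ｝)
    branches-apart {C = C} {C′} b b′ disjoint = go
      where
      module b = Branch b
      module b′ = Branch b′
      go : Apart (C ∪ ｛ b.e ｝) (C′ ∪ ｛ b′.e ｝)
      go (inj₁ c) (inj₁ c′) = (λ { refl → disjoint c c′ }) , λ e →
        [ (λ { refl → proj₁ (proj₂ b′.closed) c′ }) , (λ c → disjoint c c′) ]′
          (proj₂ (proj₂ b.closed) c (proj₁ b′.closed c′) e)
      go (inj₁ c) (inj₂ refl) = D∩X (L⊆D (proj₁ b.closed c)) b′.Xe ,
        λ e → disjoint c (b′.only-C (proj₁ b.closed c) (~-sym e))
      go (inj₂ refl) (inj₁ c′) = ≢-sym (D∩X (L⊆D (proj₁ b′.closed c′)) b.Xe) ,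
        λ e → disjoint (b.only-C (proj₁ b′.closed c′) e) c′
      go (inj₂ refl) (inj₂ refl) =
        (λ eq → let (w , Cw , e) = b.eC in
          disjoint Cw (b′.only-C (proj₁ b.closed Cw) (subst (_~ w) eq e))) ,
        X-stable b.Xe b′.Xe

    -- Each branch is a route from `v` to `x`. So a vertex of `L` has at most two branches, like an
    -- edge of a tree with its two ends.
    no-three-branches : ∀ {v C₁ C₂ C₃} → L v → Branch v C₁ → Branch v C₂ → Branch v C₃ →
      (∀ {z} → C₁ z → ¬ C₂ z) → (∀ {z} → C₁ z → ¬ C₃ z) → (∀ {z} → C₂ z → ¬ C₃ z) → ⊥
    no-three-branches Lv b₁ b₂ b₃ d₁₂ d₁₃ d₂₃ =
      no-theta₃ (≢-sym (proj₁ (x∉D (L⊆D Lv)))) (proj₂ (x∉D (L⊆D Lv)) ∘ ~-sym)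
        (branch-link b₁ Lv) (branch-link b₂ Lv) (branch-link b₃ Lv)
        (branches-apart b₁ b₂ d₁₂) (branches-apart b₁ b₃ d₁₃) (branches-apart b₂ b₃ d₂₃)

    Rest : V G → Sub → Sub
    Rest v C z = L z × z ≢ v × ¬ C z

    Rest-closed : ∀ {v C} → Closed C v → (∀ z → Dec (C z)) → Closed (Rest v C) v
    Rest-closed {v} {C} (_ , _ , closed) C? = proj₁ , (λ (_ , v≢v , _) → v≢v refl) , λ {c} {z} (Lc , c≢v , ¬Cc) Lz e →
      case z Finₚ.≟ v of λ
        { (yes eq) → inj₁ eq
        ; (no z≢v) → inj₂ (Lz , z≢v , λ Cz → [ c≢v , ¬Cc ]′ (closed Cz Lc (~-sym e))) }

    -- Two components of the rest would be two further branches at `v`.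
    Rest-conn : ∀ {v C} → L v → Branch v C → ¬ ¬ Conn (Rest v C)
    Rest-conn {v} {C} Lv b = conn-¬¬ λ {p} {q} Rp Rq ¬r → do
      bp ← branch {λ z → Reach R z p} (sub p) Lv Conn-component (stop Rp)
      bq ← branch {λ z → Reach R z q} (sub q) Lv Conn-component (stop Rq)
      no-three-branches Lv b bp bq
        (λ Cz r → proj₂ (proj₂ (source r)) Cz) (λ Cz r → proj₂ (proj₂ (source r)) Cz)
        (λ r r′ → ¬r (Reach-trans (Reach-sym r) r′))
      where
      R : Sub
      R = Rest v C
      sub : ∀ p → Closed (λ z → Reach R z p) v
      sub p = proj₁ ∘ source , (λ r → proj₁ (proj₂ (source r)) refl) , λ r Lz e →
        [ inj₁ , (λ Rz → inj₂ (step Rz (~-sym e) r)) ]′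
          (proj₂ (proj₂ (Rest-closed (Branch.closed b) (Branch.C? b))) (source r) Lz e)

    -- The part of L beyond u, seen from a connected set C closed at u, together with an exit to x.
    record Side (u : V G) (C : Sub) : Set where
      field
        closed : Closed C u
        C?     : ∀ z → Dec (C z)
        e      : V G
        Xe     : X e
        e∉C    : ∀ {w} → C w → ¬ (e ~ w)
        touch  : Touches (λ z → L z × ¬ C z) e
      Far : Sub
      Far z = L z × ¬ C z
      S : Sub
      S = Far ∪ ｛ e ｝

    side : ∀ {u C} → L u → Closed C u → Conn C → ¬ ¬ Side u C
    side {u} {C} Lu cl@(C⊆L , ¬Cu , _) cC k = do
      C? ← decide C
      (e , Xe , ¬t , w , Lw , ew) ← exit C⊆L cC Lu ¬Cu
      k record { closed = cl ; C? = C? ; e = e ; Xe = Xe ; e∉C = λ Cw e~w → ¬t (_ , Cw , e~w)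
               ; touch = w , (Lw , λ Cw → ¬t (w , Cw , ew)) , ew }

    module Sided {u C} (s : Side u C) (Lu : L u) where
      open Side s

      Far-u : Far u
      Far-u = Lu , proj₁ (proj₂ closed)

      reach-e : ∀ {z} → Far z → Reach S z e
      reach-e Fz = let (w , Fw , ew) = touch in
        snoc (Reach-mono inj₁ (rest closed Lu C? Fz Fw)) (~-sym ew) (inj₂ refl)

      link : ∀ {z} → z ~ u → Link S z x
      link zu = u , e , zu , reach-e Far-u , ~-sym (x~X Xe)

      x∉S : ¬ S x
      x∉S (inj₁ (Lx , _)) = proj₁ (x∉D (L⊆D Lx)) refl
      x∉S (inj₂ refl) = E-irr G (x~X Xe)

      ∉S : ∀ {z} → C z → ¬ S z
      ∉S Cz (inj₁ (_ , ¬Cz)) = ¬Cz Cz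
      ∉S Cz (inj₂ refl) = D∩X (L⊆D (proj₁ closed Cz)) Xe refl

      path : Chain S u e
      path = shortcut (reach-e Far-u)
      module path = Chain path

      1≤path : 1 ≤ path.ℓ
      1≤path = 1≤length path (D∩X (L⊆D Lu) Xe)

      -- The route to `x` for `u` itself, which therefore has to be left out.
      Stem : Sub
      Stem = Seg path 1 path.ℓ

      Stem⊆S : Stem ⊆ S
      Stem⊆S = Seg⊆S path ≤-refl

      u∉Stem : ∀ {z} → Stem z → z ≢ u
      u∉Stem (i , 1≤ , i≤ , refl) eq = <⇒≢ 1≤ (path.at-inj z≤n i≤ (trans path.at-0 (sym eq)))

      stem-link : Link Stem u x
      stem-link = path.at 1 , e , subst (_~ path.at 1) path.at-0 (path.link 1≤path) ,
        subst (Reach Stem (path.at 1)) path.at-ℓ (Seg-reach path path.ℓ ≤-refl 1≤path ≤-refl ≤-refl) ,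
        ~-sym (x~X Xe)

    -- Each part lies in the set from which the other is seen. That set is closed at `u` or `u′`, so
    -- `u u′` is the only possible edge, and its neighbours exclude the exit.
    sides : ∀ {u C u′ C′} (s : Side u C) (s′ : Side u′ C′) →
      Side.Far s′ ⊆ C → Side.Far s ⊆ C′ → ∀ {p q} → Side.S s p → Side.S s′ q →
      p ≢ q × (p ~ q → p ≡ u × q ≡ u′)
    sides s s′ f′⊆ f⊆ {p} {q} = go
      where
      module s = Side s
      module s′ = Side s′
      go : s.S p → s′.S q → _
      go (inj₁ Fp) (inj₁ Fq) = (λ { refl → proj₂ Fp (f′⊆ Fq) }) , λ e →
        [ id , (λ Cp → contradiction Cp (proj₂ Fp)) ]′ (proj₂ (proj₂ s.closed) (f′⊆ Fq) (proj₁ Fp) (~-sym e)) ,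
        [ id , (λ Cq → contradiction Cq (proj₂ Fq)) ]′ (proj₂ (proj₂ s′.closed) (f⊆ Fp) (proj₁ Fq) e)
      go (inj₁ Fp) (inj₂ refl) = D∩X (L⊆D (proj₁ Fp)) s′.Xe , λ e → contradiction (~-sym e) (s′.e∉C (f⊆ Fp))
      go (inj₂ refl) (inj₁ Fq) = ≢-sym (D∩X (L⊆D (proj₁ Fq)) s.Xe) , λ e → contradiction e (s.e∉C (f′⊆ Fq))
      go (inj₂ refl) (inj₂ refl) =
        (λ eq → let (w , Fw , ew) = s.touch in s′.e∉C (f⊆ Fw) (subst (_~ w) eq ew)) ,
        λ e → contradiction e (X-stable s.Xe s′.Xe)

    -- The neighbours M of v in E form with v a clique of the tree-like set L, and E splits into the
    -- parts beyond the members of M.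
    module Centre {v : V G} {E : Sub} (Lv : L v) (cE : Conn E) (sv : Side v E) where
      open Side sv using () renaming (closed to E-closed; C? to E?; Far to Far-v) public

      -- What remains joined to `v` when `u` is removed; its complement in `L` is the part beyond
      -- `u`.
      C₀ : V G → Sub
      C₀ u z = Reach (L ∖ u) z v

      u∉C₀ : ∀ {u} → ¬ C₀ u u
      u∉C₀ r = proj₂ (source r) refl

      sideOf : ∀ {u} → L u → ¬ ¬ Side u (C₀ u)
      sideOf Lu = side Lu component Conn-component

      E⊆L : E ⊆ L
      E⊆L = proj₁ E-closed

      E≢v : ∀ {u} → E u → u ≢ v
      E≢v Eu refl = proj₁ (proj₂ E-closed) Eu

      v∈C₀ : ∀ {u} → E u → C₀ u v
      v∈C₀ Eu = stop (Lv , ≢-sym (E≢v Eu))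

      far⊆ : ∀ {u q} (sq : Side q (C₀ q)) → L q → C₀ u q → C₀ q u → Side.Far sq ⊆ C₀ u
      far⊆ sq Lq q∈ u∈ Fz = Reach-trans
        (Reach-mono (λ (Lz , ¬Cz) → Lz , λ { refl → ¬Cz u∈ })
          (rest (Side.closed sq) Lq (Side.C? sq) Fz (Lq , u∉C₀)))
        q∈

      far-v⊆ : ∀ {w} → E w → Far-v ⊆ C₀ w
      far-v⊆ Ew Fz = Reach-mono (λ (Lz , ¬Ez) → Lz , λ { refl → ¬Ez Ew })
        (rest E-closed Lv E? Fz (Lv , λ Ev → E≢v Ev refl))

      far⊆E : ∀ {w} → E w → ∀ {z} → L z → ¬ C₀ w z → E z
      far⊆E Ew {z} Lz ¬Cz with E? z
      ... | yes Ez = Ez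
      ... | no ¬Ez = contradiction (far-v⊆ Ew (Lz , ¬Ez)) ¬Cz

      M : Sub
      M w = E w × v ~ w

      M-sees : ∀ {w w′} → M w → L w′ → w′ ~ v → w′ ≢ w → C₀ w w′
      M-sees (Ew , _) Lw′ e w′≢w = step (Lw′ , w′≢w) e (v∈C₀ Ew)

      v-theta : ∀ {u} → D u → u ≢ x × ¬ (u ~ x)
      v-theta Du = ≢-sym (proj₁ (x∉D Du)) , proj₂ (x∉D Du) ∘ ~-sym

      -- Otherwise `v` has three independent routes to `x`: beyond `w`, beyond `w′`, and away from
      -- `E`.
      M-clique : ∀ {w w′} → M w → M w′ → w ≢ w′ → ¬ ¬ (w ~ w′)
      M-clique {w} {w′} Mw@(Ew , vw) Mw′@(Ew′ , vw′) w≢w′ w≁w′ = do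
        sw  ← sideOf (E⊆L Ew)
        sw′ ← sideOf (E⊆L Ew′)
        let module W  = Sided sw (E⊆L Ew)
            module W′ = Sided sw′ (E⊆L Ew′)
            module V₀ = Sided sv Lv
            w′∈ = M-sees Mw (E⊆L Ew′) (~-sym vw′) (≢-sym w≢w′)
            w∈  = M-sees Mw′ (E⊆L Ew) (~-sym vw) w≢w′
        no-theta₃ (proj₁ (v-theta (L⊆D Lv))) (proj₂ (v-theta (L⊆D Lv)))
          {Side.S sw} {Side.S sw′} {V₀.Stem}
          (W.link vw , W.∉S (v∈C₀ Ew) , W.x∉S) (W′.link vw′ , W′.∉S (v∈C₀ Ew′) , W′.x∉S)
          (V₀.stem-link , (λ t → V₀.u∉Stem t refl) , V₀.x∉S ∘ V₀.Stem⊆S)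
          (λ p q → let (ne , f) = sides sw sw′ (far⊆ sw′ (E⊆L Ew′) w′∈ w∈) (far⊆ sw (E⊆L Ew) w∈ w′∈) p q in
            ne , λ e → case f e of λ { (refl , refl) → w≁w′ e })
          (λ p q → let (ne , f) = sides sw sv (far-v⊆ Ew) (λ (Lz , ¬Cz) → far⊆E Ew Lz ¬Cz) p (V₀.Stem⊆S q) in
            ne , λ e → V₀.u∉Stem q (proj₂ (f e)))
          (λ p q → let (ne , f) = sides sw′ sv (far-v⊆ Ew′) (λ (Lz , ¬Cz) → far⊆E Ew′ Lz ¬Cz) p (V₀.Stem⊆S q) in
            ne , λ e → V₀.u∉Stem q (proj₂ (f e)))

      -- If `g` stayed joined to `v` without `w`, then `w` would have three independent routes to
      -- `x`: back through `v`, beyond `g`, and beyond `w` itself.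
      M-neighbours : ∀ {g w} → E g → ¬ (v ~ g) → M w → g ~ w → ¬ C₀ w g
      M-neighbours {g} {w} Eg v≁g (Ew , vw) gw g∈ = do
        sg ← sideOf (E⊆L Eg)
        sw ← sideOf (E⊆L Ew)
        let module Γ  = Sided sg (E⊆L Eg)
            module W  = Sided sw (E⊆L Ew)
            module V₀ = Sided sv Lv
            w∈ : C₀ g w
            w∈ = step (E⊆L Ew , ≢-sym (~⇒≢ gw)) (~-sym vw) (v∈C₀ Eg)
        no-theta₃ (proj₁ (v-theta (L⊆D (E⊆L Ew)))) (proj₂ (v-theta (L⊆D (E⊆L Ew))))
          {Side.S sv} {Side.S sg} {W.Stem}
          (V₀.link (~-sym vw) , V₀.∉S Ew , V₀.x∉S)
          (Γ.link (~-sym gw) , Γ.∉S w∈ , Γ.x∉S)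
          (W.stem-link , (λ t → W.u∉Stem t refl) , W.x∉S ∘ W.Stem⊆S)
          (λ p q → let (ne , f) = sides sv sg (λ (Lz , ¬Cz) → far⊆E Eg Lz ¬Cz) (far-v⊆ Eg) p q in
            ne , λ e → case f e of λ { (refl , refl) → v≁g e })
          (λ p q → let (ne , f) = sides sv sw (λ (Lz , ¬Cz) → far⊆E Ew Lz ¬Cz) (far-v⊆ Ew) p (W.Stem⊆S q) in
            ne , λ e → W.u∉Stem q (proj₂ (f e)))
          (λ p q → let (ne , f) = sides sg sw (far⊆ sw (E⊆L Ew) w∈ g∈) (far⊆ sg (E⊆L Eg) g∈ w∈) p (W.Stem⊆S q) in
            ne , λ e → W.u∉Stem q (proj₂ (f e)))

      -- Followed backwards along a walk ending in `M`: a new vertex adjacent to `v` is its own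
      -- witness, and any other stays beyond the witness of its successor, by `M-neighbours` if that
      -- successor is the witness and by closedness if not.
      cover : ∀ {e} → E e → ¬ ¬ (∃[ w ] M w × ¬ C₀ w e)
      cover {e} Ee = let (m , Em , vm) = touch-root E-closed Lv E? Ee in go Em vm (cE Ee Em)
        where
        go : ∀ {m} → E m → v ~ m → ∀ {e} → Reach E e m → ¬ ¬ (∃[ w ] M w × ¬ C₀ w e)
        go Em vm (stop _) k = k (_ , (Em , vm) , u∉C₀)
        go Em vm (step {u = e} {w = z} Ee ez r) k = do
          (w , Mw , z∉) ← go Em vm r
          no v≁e ← em {A = v ~ e}
            where yes ve → k (e , (Ee , ve) , u∉C₀)
          yes e∈ ← em {A = C₀ w e}
            where no e∉ → k (w , Mw , e∉)
          [ (λ { refl → M-neighbours Ee v≁e Mw ez e∈ }) , z∉ ]′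
            (proj₂ (proj₂ component) e∈ (E⊆L (source r)) ez)

      A : V G → Sub
      A w = Rest w (C₀ w)

      A⊆E : ∀ {w} → E w → A w ⊆ E
      A⊆E Ew (Lz , _ , z∉) = far⊆E Ew Lz z∉

      A-branch : ∀ {w z} → E w → A w z → ¬ ¬ Branch w (A w)
      A-branch {w} Ew Az k = do
        bw ← branch component (E⊆L Ew) Conn-component (v∈C₀ Ew)
        cA ← Rest-conn (E⊆L Ew) bw
        bA ← branch (Rest-closed component (Branch.C? bw)) (E⊆L Ew) cA Az
        k bA

      -- Each member of `X` touching `E` does so beyond some member of `M`. As `M` is a clique,
      -- fewer than `t` members occur, so many of these vertices share one.
      concentrate : ∀ k → Many (t * suc k) (λ z → X z × Touches E z) → ¬ ¬ (∃[ w ] M w × Heavy k (A w))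
      concentrate k (zs′ , uzs , big , qs) done = (¬¬-∀Fin choose) λ f → split f (fibre Finₚ._≟_ (proj₁ ∘ f) t k zs′ big)
        where
        Chosen : V G → V G → Set
        Chosen z w = Touches E z → M w × ∃[ u ] L u × ¬ C₀ w u × z ~ u
        choose : ∀ z → ¬ ¬ ∃ (Chosen z)
        choose z k = do
          yes (u , Eu , zu) ← em {A = Touches E z}
            -- No condition applies to such a `z`; `v` is a default value.
            where no none → k (v , λ touch → contradiction touch none)
          (w , Mw , u∉) ← cover Eu
          k (w , λ _ → Mw , u , E⊆L Eu , u∉ , zu)
        clique : ∀ (f : V G → V G) {ys} → AllPairs (λ p q → f p ≢ f q) ys → All (M ∘ f) ys →
                 AllPairs (λ p q → f p ~ f q) ys
        clique f [] [] = []
        clique f (n ∷ ns) (m ∷ ms) =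
          All.zipWith (λ (ne , m′) → adjacent m m′ ne) (n , ms) ∷ clique f ns ms
          where
          adjacent : ∀ {p q} → M p → M q → p ≢ q → p ~ q
          adjacent {p} {q} Mp Mq ne with E-dec G p q
          ... | yes e = e
          ... | no ¬e = ⊥-elim (M-clique Mp Mq ne ¬e)
        split : (f : ∀ z → ∃ (Chosen z)) →
          (∃[ ys ] ys ⊑ zs′ × length ys ≡ t × AllPairs (λ p q → proj₁ (f p) ≢ proj₁ (f q)) ys) ⊎
          (∃[ w ] ∃[ ys ] ys ⊑ zs′ × suc k ≤ length ys × All (λ z → proj₁ (f z) ≡ w) ys) → ⊥
        split f (inj₁ (ys , ys⊑ , len′ , ap)) = no-clique
          (subst (HasClique G) (trans (length-map (proj₁ ∘ f) ys) len′)
            (list-clique {map (proj₁ ∘ f) ys} (AllPairsₚ.map⁺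
              (clique (proj₁ ∘ f) ap (All.map (λ {z} (_ , touch) → proj₁ (proj₂ (f z) touch)) (All-resp-⊆ ys⊑ qs))))))
        split f (inj₂ (w , [] , _ , () , _))
        split f (inj₂ (w , ys@(y₀ ∷ _) , ys⊑ , big′ , eqs@(eq₀ ∷ _))) = do
          -- `A w` omits `w`, and at most one of these vertices is adjacent to `w`.
          m ← prune {k} {1} {λ z → X z × ∃[ u ] L u × ¬ C₀ w u × z ~ u} (_~ w)
                (ys , AllPairs-⊑ ys⊑ uzs , big′ ,
                 All.zipWith (λ {z} (eq , Xz , touch) → Xz , proj₂ (at-w eq touch)) (eqs , All-resp-⊆ ys⊑ qs))
                λ m → few-at (L⊆D (E⊆L (proj₁ Mw))) (Many-mono ≤-refl (λ ((Xz , _) , e) → Xz , e) m)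
          done (w , Mw , Many-mono ≤-refl
            (λ { ((Xz , u , Lu , u∉ , zu) , z≁w) → Xz , u , (Lu , (λ { refl → z≁w zu }) , u∉) , zu }) m)
          where
          at-w : ∀ {z} → proj₁ (f z) ≡ w → Touches E z → M w × ∃[ u ] L u × ¬ C₀ w u × z ~ u
          at-w {z} refl = proj₂ (f z)
          Mw : M w
          Mw with All-resp-⊆ ys⊑ qs
          ... | (_ , touch) ∷ _ = proj₁ (at-w eq₀ touch)

      -- An induced path from `w` through `v` to a vertex beyond is closed up through `x`, with
      -- `A w` as the arm at `w` and `e` as the arm at the other end. Since `z` sees its first
      -- vertex `w`, it sees exactly `w` and the next vertex, `v`.
      module Probe {w z : V G} (Mw : M w) (bA : Branch w (A w)) (Xz : X z) (zw : z ~ w)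
        (z≁A : ¬ Touches (A w) z) {e : V G} (Xe : X e) (touch : Touches Far-v e)
        (e≁A : ¬ Touches (A w) e) (e≁w : ¬ (e ~ w)) where

        private module bA = Branch bA
        Lw : L w
        Lw = E⊆L (proj₁ Mw)

        Way : Sub
        Way u = (u ≡ w ⊎ Far-v u) ⊎ u ≡ e

        C : Chain Way w e
        C = shortcut (step (inj₁ (inj₁ refl)) (~-sym (proj₂ Mw))
          (let (u , Fu , eu) = touch in
            snoc (Reach-mono (inj₁ ∘ inj₂) (rest E-closed Lv E? (Lv , λ Ev → E≢v Ev refl) Fu))
                 (~-sym eu) (inj₂ refl)))
        module C = Chain C

        way-L : ∀ {u} → u ≡ w ⊎ Far-v u → L u
        way-L (inj₁ refl) = Lw
        way-L (inj₂ (Lu , _)) = Lu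

        2≤ : 2 ≤ C.ℓ
        2≤ = 2≤length C (D∩X (L⊆D Lw) Xe) (e≁w ∘ ~-sym)

        last : ℕ
        last = C.ℓ ∸ 1

        1+last : suc last ≡ C.ℓ
        1+last = m+[n∸m]≡n (<⇒≤ 2≤)

        <ℓ : ∀ {i} → i ≤ last → i < C.ℓ
        <ℓ i≤ = ≤-trans (s≤s i≤) (≤-reflexive 1+last)

        before-e : ∀ {i} → i < C.ℓ → C.at i ≡ w ⊎ Far-v (C.at i)
        before-e i< with C.inS (<⇒≤ i<)
        ... | inj₁ u  = u
        ... | inj₂ eq = contradiction (C.at-inj (<⇒≤ i<) ≤-refl (trans eq (sym C.at-ℓ))) (<⇒≢ i<)

        F : Chain (λ u → u ≡ w ⊎ Far-v u) w (C.at last)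
        F = widen (take C last (<⇒≤ (<ℓ ≤-refl))) λ i≤ → before-e (<ℓ i≤)

        -- `E` is closed at `v`, so `v` is the only neighbour of `w` outside `E`.
        second : C.at 1 ≡ v
        second with before-e 2≤
        ... | inj₁ eq = case C.at-inj (<⇒≤ 2≤) z≤n (trans eq (sym C.at-0)) of λ ()
        ... | inj₂ (Lu , ¬Eu) = [ id , (λ Eu → contradiction Eu ¬Eu) ]′
          (proj₂ (proj₂ E-closed) (proj₁ Mw) Lu (subst (_~ C.at 1) C.at-0 (C.link (<⇒≤ 2≤))))

        A-way : ∀ {u p} → A w p → u ≡ w ⊎ Far-v u → p ≢ u × (p ~ u → u ≡ w)
        A-way Ap (inj₁ refl) = proj₁ (proj₂ Ap) , λ _ → refl
        A-way Ap (inj₂ (Lu , ¬Eu)) = (λ { refl → ¬Eu (A⊆E (proj₁ Mw) Ap) }) , λ e →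
          [ id , (λ Au → contradiction (A⊆E (proj₁ Mw) Au) ¬Eu) ]′ (proj₂ (proj₂ bA.closed) Ap Lu e)

        eA≁w : ¬ (bA.e ~ w)
        eA≁w e′ = proj₁ (proj₂ bA.closed) (bA.only-C Lw e′)

        pair : SeesPair z F
        pair = Touch.two-consecutive F {A w ∪ ｛ bA.e ｝} {｛ e ｝} {λ _ → ⊥}
          (arm-X (L⊆D ∘ proj₁) bA.conn (touch-root bA.closed Lw bA.C? (proj₁ (proj₂ bA.eC))) bA.Xe bA.eC)
          (record { p = e ; o = e
                  ; v~p = subst (C.at last ~_) (trans (cong C.at 1+last) C.at-ℓ) (C.link (<ℓ ≤-refl))
                  ; reach = stop refl ; x~o = x~X Xe ; unique = λ { refl _ → refl }
                  ; x∉ = λ { refl → E-irr G (x~X Xe) } })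
          (λ i≤ → x∉D (L⊆D (way-L (before-e (<ℓ i≤)))))
          (λ { (inj₁ Ap) refl → D∩X (L⊆D (proj₁ Ap)) Xe , λ pe → e≁A (_ , Ap , ~-sym pe)
             ; (inj₂ refl) refl → (λ { refl → e≁A bA.eC }) , X-stable bA.Xe Xe })
          (λ { i≤ (inj₁ Ap) → let (ne , f) = A-way Ap (before-e (<ℓ i≤)) in
                 ne , λ e′ → C.at-inj (<⇒≤ (<ℓ i≤)) z≤n (trans (f e′) (sym C.at-0))
             ; i≤ (inj₂ refl) → ≢-sym (D∩X (L⊆D (way-L (before-e (<ℓ i≤)))) bA.Xe) ,
                 λ e′ → let Aat = bA.only-C (way-L (before-e (<ℓ i≤))) e′ in
                   contradiction refl (proj₁ (A-way Aat (before-e (<ℓ i≤)))) })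
          (λ { {i} i≤ refl → ≢-sym (D∩X (L⊆D (way-L (before-e (<ℓ i≤)))) Xe) , λ e′ →
                 case C.at-adj ≤-refl (<⇒≤ (<ℓ i≤)) (subst (_~ C.at i) (sym C.at-ℓ) e′) of λ
                   { (inj₁ eq) → contradiction (<⇒≤ (<ℓ i≤)) (<⇒≱ (≤-reflexive eq))
                   ; (inj₂ eq) → suc-injective (trans eq (sym 1+last)) } })
          (λ ()) (λ ()) (λ _ ()) (λ ())
          (λ i≤ → ≢-sym (D∩X (L⊆D (way-L (before-e (<ℓ i≤)))) Xz)) (~⇒≢ (x~X Xz))
          (λ { refl (inj₁ Ap) → ≢-sym (D∩X (L⊆D (proj₁ Ap)) Xz) , λ e′ → z≁A (_ , Ap , e′)
             ; refl (inj₂ refl) → (λ { refl → eA≁w zw }) , X-stable Xz bA.Xe })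
          (λ { refl refl → (λ { refl → e≁w zw }) , X-stable Xz Xe })
          (inj₂ (x~X Xz , X-no-hub Xz))
          (0 , z≤n , subst (z ~_) (sym C.at-0) zw)

        starts : proj₁ pair ≡ 0
        starts = [ sym , (λ ()) ]′ (proj₂ (proj₂ (proj₂ (proj₂ pair))) z≤n (subst (z ~_) (sym C.at-0) zw))

        z~v : z ~ v
        z~v = subst (z ~_) (trans (cong (C.at ∘ suc) starts) second) (proj₁ (proj₂ (proj₂ (proj₂ pair))))

        only-v : ∀ {j} → j < C.ℓ → z ~ C.at j → C.at j ≡ w ⊎ C.at j ≡ v
        only-v {j} j< e′ = [ (λ eq → inj₁ (trans (cong C.at (trans eq starts)) C.at-0)) ,
                             (λ eq → inj₂ (trans (cong C.at (trans eq (cong suc starts))) second)) ]′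
          (proj₂ (proj₂ (proj₂ (proj₂ pair))) (s≤s⁻¹ (≤-trans j< (≤-reflexive (sym 1+last)))) e′)

-- The centroid, and the configuration at it

-- `t * suc (bulk t)` is what `concentrate` needs to leave a part of weight `bulk t`. The outer
-- `suc` makes the bound visibly positive, so that a heavy set yields a witness.
pendantBound : ℕ → ℕ
pendantBound t = suc (t * suc (bulk t))

-- If more than `t * suc (pendantBound t)` members touched `E`, a part beyond some member of `M`
-- would be pendant. So `suc (bulk t)` members miss `E`, and at most one of them is adjacent to `v`.
leafBound : ℕ → ℕ
leafBound t = t * suc (pendantBound t) + suc (bulk t)

-- The sum of three lower bounds: one for the argument at the centroid, one for the initial pendant
-- set, which loses at most one member at the deleted vertex, and 2 to give `L` two vertices.
neighbourBound : ℕ → ℕ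
neighbourBound t = leafBound t + (suc (pendantBound t) + 2)

module Contradiction (G : Graph) (𝒜 : Apex G) (ℱ : Fan G 𝒜) where
  open Existence G 𝒜 ℱ public

  some : ∀ {k Q} → Many (suc k) Q → ∃ Q
  some (_ ∷ _ , _ , _ , q ∷ _) = _ , q
  some ([] , _ , () , _)

  module _ (zs : List (V G)) (Xzs : All X zs) (L : Sub) (L⊆D : L ⊆ D) (cL : Conn L)
    (touchL : All (Touches L) zs)
    (minL : ∀ T → T ⊆ L → Conn T × All (Touches T) zs → ∀ {z} → L z → ¬ ¬ T z) where
    open Tree zs Xzs L L⊆D cL touchL minL

    -- A minimal pendant set E is a centroid of L: none of the parts of E beyond a member of M is
    -- pendant, so one of them is still heavy, and so is the rest of L.
    Pendant : Sub → Set
    Pendant E = ∃[ v ] L v × Closed E v × Conn E × Heavy (pendantBound t) E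

    module _ {v E} (Lv : L v) (cE : Conn E) (heavyE : Heavy (pendantBound t) E) (sv : Side v E)
      (minE : ∀ T → T ⊆ E → Pendant T → ∀ {z} → E z → ¬ ¬ T z) where
      open Centre Lv cE sv
      private module sv = Side sv

      B : Sub
      B = Rest v E

      B-Far : B ⊆ sv.Far
      B-Far (Lz , _ , ¬Ez) = Lz , ¬Ez

      -- `A w` omits `w`, so it would be a smaller pendant set, cut off by `w`.
      light : ∀ {w} → M w → ¬ Heavy (pendantBound t) (A w)
      light {w} (Ew , _) hA = do
        let (_ , _ , _ , Az , _) = some hA
        bA ← A-branch Ew Az
        minE (A w) (A⊆E Ew) (w , E⊆L Ew , Branch.closed bA , Branch.conn bA , hA) Ew
          λ (_ , w≢w , _) → w≢w refl

      module Assemble {w} (Mw : M w) (heavyA : Heavy (bulk t) (A w)) (heavyB : Heavy (bulk t) B)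
        (bA : Branch w (A w)) (bB : Branch v B) (sw : Side w (C₀ w)) where

        private
          module bA = Branch bA
          module bB = Branch bB
        Ew : E w
        Ew = proj₁ Mw
        Lw : L w
        Lw = E⊆L Ew

        A-Far : A w ⊆ Side.Far sw
        A-Far (Lz , _ , z∉) = Lz , z∉

        outside-E : ∀ {u z} → E u → B z → u ≢ z × ¬ (u ~ z)
        outside-E Eu (Lz , z≢v , ¬Ez) = (λ { refl → ¬Ez Eu }) ,
          λ e → [ z≢v , ¬Ez ]′ (proj₂ (proj₂ E-closed) Eu Lz e)

        v-A : ∀ {u} → A w u → v ≢ u × ¬ (v ~ u)
        v-A Au = (λ { refl → proj₂ (proj₂ Au) (v∈C₀ Ew) }) , λ e →
          [ (λ eq → E≢v Ew (sym eq)) , (λ Av → proj₂ (proj₂ Av) (v∈C₀ Ew)) ]′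
            (proj₂ (proj₂ bA.closed) Au Lv (~-sym e))

        config : ∀ {c γ} → w ~ c → v ~ c → X γ → (leg : Chain (D ∪ ｛ γ ｝) c γ) →
          (∀ {i} → i ≤ Chain.ℓ leg → Apart ｛ Chain.at leg i ｝ (A w)) →
          (∀ {i} → i ≤ Chain.ℓ leg → Apart ｛ Chain.at leg i ｝ B) →
          (∀ {i} → 0 < i → i ≤ Chain.ℓ leg → Apart ｛ Chain.at leg i ｝ ｛ w ｝) →
          (∀ {i} → 0 < i → i ≤ Chain.ℓ leg → Apart ｛ Chain.at leg i ｝ ｛ v ｝) → ⊥
        config {c} {γ} wc vc Xγ leg legA legB leg-w leg-v = no-config _ record
          { a = w ; b = v ; c = c ; γ = γ ; A = A w ; B = B
          ; a~b = ~-sym (proj₂ Mw) ; a~c = wc ; b~c = vc ; Da = L⊆D Lw ; Db = L⊆D Lv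
          ; A⊆D = L⊆D ∘ proj₁ ; B⊆D = L⊆D ∘ proj₁ ; cA = bA.conn ; cB = bB.conn
          ; AB = λ Au Bz → outside-E (A⊆E Ew Au) Bz
          ; a∉A = λ Aw → proj₁ (proj₂ Aw) refl ; b∉B = λ Bv → proj₁ (proj₂ Bv) refl
          ; aA = touch-root bA.closed Lw bA.C? (proj₁ (proj₂ bA.eC))
          ; bB = touch-root bB.closed Lv bB.C? (proj₁ (proj₂ bB.eC))
          ; aB = λ { refl Bz → outside-E Ew Bz } ; bA = λ { refl Au → v-A Au }
          ; heavyA = heavyA ; heavyB = heavyB ; Xγ = Xγ ; leg = leg ; leg-len = refl
          ; legA = legA ; legB = legB ; leg-a = leg-w ; leg-b = leg-v }

        -- A second member `w′` of `M` completes the triangle with `w` and `v`; the leg is the path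
        -- beyond `w′` to its exit.
        two-spokes : ∀ {w′} → M w′ → w′ ≢ w → ⊥
        two-spokes {w′} Mw′@(Ew′ , vw′) w′≢w = do
          sw′ ← sideOf (E⊆L Ew′)
          ww′ ← M-clique Mw Mw′ (≢-sym w′≢w)
          let module W′ = Sided sw′ (E⊆L Ew′)
              module P = Chain W′.path
              w′∈ = M-sees Mw (E⊆L Ew′) (~-sym vw′) w′≢w
              w∈  = M-sees Mw′ Lw (~-sym (proj₂ Mw)) (≢-sym w′≢w)
              near-w : ∀ {i u} → i ≤ P.ℓ → Side.S sw u → P.at i ≢ u × (P.at i ~ u → P.at i ≡ w′ × u ≡ w)
              near-w = λ i≤ Su → sides sw′ sw (far⊆ sw Lw w∈ w′∈) (far⊆ sw′ (E⊆L Ew′) w′∈ w∈) (P.inS i≤) Su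
              near-v : ∀ {i u} → i ≤ P.ℓ → Side.S sv u → P.at i ≢ u × (P.at i ~ u → P.at i ≡ w′ × u ≡ v)
              near-v = λ i≤ Su → sides sw′ sv (far-v⊆ Ew′) (λ (Lz , ¬Cz) → far⊆E Ew′ Lz ¬Cz) (P.inS i≤) Su
              late : ∀ {i} → 0 < i → i ≤ P.ℓ → P.at i ≢ w′
              late = λ 0<i i≤ eq → <⇒≢ 0<i (P.at-inj z≤n i≤ (trans P.at-0 (sym eq)))
          config ww′ vw′ (Side.Xe sw′)
            (widen W′.path λ i≤ → [ inj₁ ∘ L⊆D ∘ proj₁ , inj₂ ]′ (P.inS i≤))
            (λ { i≤ refl Au → let (ne , f) = near-w i≤ (inj₁ (A-Far Au)) in
                   ne , λ e → proj₁ (proj₂ Au) (proj₂ (f e)) })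
            (λ { i≤ refl Bu → let (ne , f) = near-v i≤ (inj₁ (B-Far Bu)) in
                   ne , λ e → proj₁ (proj₂ Bu) (proj₂ (f e)) })
            (λ { 0<i i≤ refl refl → let (ne , f) = near-w i≤ (inj₁ (Lw , u∉C₀)) in
                   ne , λ e → late 0<i i≤ (proj₁ (f e)) })
            (λ { 0<i i≤ refl refl → let (ne , f) = near-v i≤ (inj₁ (Sided.Far-u sv Lv)) in
                   ne , λ e → late 0<i i≤ (proj₁ (f e)) })

        module OneSpoke {z} (Xz : X z) (zw : z ~ w) (z≁A : ¬ Touches (A w) z) where

          z~v : z ~ v
          z~v = Probe.z~v Mw bA Xz zw z≁A sv.Xe sv.touch
            (λ (_ , Au , e) → sv.e∉C (A⊆E Ew Au) e) (sv.e∉C Ew)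

          -- The probe is aimed at an exit beyond `g`. Its path has to pass through `g`, but `z`
          -- sees only `w` and `v` on it.
          z≁B : ∀ {g} → B g → ¬ (z ~ g)
          z≁B {g} (Lg , g≢v , g∉E) zg = do
            sg ← sideOf Lg
            let module sg = Side sg
                touch-g : Touches sv.Far sg.e
                touch-g = let (u , (Lu , u∉) , e) = sg.touch in u , (Lu , λ Eu → u∉ (E∈ Eu)) , e
                A-g : ¬ Touches (A w) sg.e
                A-g = λ (_ , Au , e) → sg.e∉C (E∈ (A⊆E Ew Au)) e
                module Pr = Probe Mw bA Xz zw z≁A sg.Xe touch-g A-g (sg.e∉C (E∈ Ew))
                (k , k≤ , eq) = visits Pr.C {C₀ g} {λ u → (L u × u ≢ g × ¬ C₀ g u) ⊎ u ≡ sg.e} {g}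
                  (λ { (inj₂ eq) → inj₂ (inj₂ (inj₂ eq))
                     ; (inj₁ u∈) → locate sg (Pr.way-L u∈) })
                  (λ { c (inj₁ (Lu , u≢g , u∉)) → (λ { refl → u∉ c }) ,
                         λ e → [ u≢g , u∉ ]′ (proj₂ (proj₂ component) c Lu e)
                     ; c (inj₂ refl) → D∩X (L⊆D (proj₁ (source c))) sg.Xe , λ e → sg.e∉C c (~-sym e) })
                  (E∈ Ew) (inj₂ refl)
                k< = ≤∧≢⇒< k≤ λ k≡ → D∩X (L⊆D Lg) sg.Xe (trans (sym eq) (trans (cong Pr.C.at k≡) Pr.C.at-ℓ))
            [ (λ eq′ → g∉E (subst E (trans (sym eq′) eq) Ew)) , (λ eq′ → g≢v (trans (sym eq) eq′)) ]′
              (Pr.only-v k< (subst (z ~_) (sym eq) zg))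
            where
            E∈ : ∀ {u} → E u → C₀ g u
            E∈ Eu = let (m , Em , vm) = touch-root E-closed Lv E? Eu in
              Reach-trans (Reach-mono (λ Ez → E⊆L Ez , λ { refl → g∉E Ez }) (cE Eu Em))
                (step (E⊆L Em , (λ { refl → g∉E Em })) (~-sym vm) (stop (Lv , ≢-sym g≢v)))
            locate : (sg : Side g (C₀ g)) → ∀ {u} → L u →
              C₀ g u ⊎ (u ≡ g ⊎ ((L u × u ≢ g × ¬ C₀ g u) ⊎ u ≡ Side.e sg))
            locate sg {u} Lu with Side.C? sg u | u Finₚ.≟ g
            ... | yes c | _      = inj₁ c
            ... | no _  | yes eq = inj₂ (inj₁ eq)
            ... | no ¬c | no ne  = inj₂ (inj₂ (inj₁ (Lu , ne , ¬c)))

          contra : ⊥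
          contra = config (~-sym zw) (~-sym z~v) Xz (singleton (inj₂ refl))
            (λ { _ refl Au → ≢-sym (D∩X (L⊆D (proj₁ Au)) Xz) , λ e → z≁A (_ , Au , e) })
            (λ { _ refl Bu → ≢-sym (D∩X (L⊆D (proj₁ Bu)) Xz) , z≁B Bu })
            (λ { () z≤n }) (λ { () z≤n })

        -- If every neighbour of `E` counted in `heavyE` touched `A w`, then `A w` would be as heavy
        -- as `E`. One that does not must see `w`, and it becomes the third vertex of the triangle
        -- with a leg of length zero.
        one-spoke : (∀ {w′} → M w′ → w′ ≡ w) → ⊥
        one-spoke only = find heavyE
          where
          find : Heavy (pendantBound t) E → ⊥
          find (ys , uys , big , qs) = ¬¬-All (All.map (λ {z} (Xz , touch) → at z Xz touch) qs) λ all →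
            light Mw (ys , uys , big , All.zip (All.map proj₁ qs , all))
            where
            at : ∀ z → X z → Touches E z → ¬ ¬ Touches (A w) z
            at z Xz (u , Eu , zu) z≁A = do
              (w′ , Mw′ , u∉) ← cover Eu
              case u Finₚ.≟ w of λ
                { (yes refl) → OneSpoke.contra Xz zu z≁A
                ; (no u≢w) → z≁A (u , (E⊆L Eu , u≢w , subst (λ w → ¬ C₀ w u) (only Mw′) u∉) , zu) }

      centre-contra : leafBound t ≤ length zs → Unique zs → ⊥
      centre-contra leaf≤ uzs = do
        m₁ ← prune {suc (bulk t)} {t * suc (pendantBound t)} (Touches E)
               (zs , uzs , leaf≤ , All.zip (Xzs , touchL))
               λ m → concentrate (pendantBound t) (Many-mono (n≤1+n _) (λ ((Xz , _) , tE) → Xz , tE) m) λ (w , Mw , hA) → light Mw hA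
        m₂ ← prune {bulk t} {1} (_~ v) m₁
               λ m → few-at (L⊆D Lv) (Many-mono ≤-refl (λ (((Xz , _) , _) , e) → Xz , e) m)
        let heavyB = Many-mono ≤-refl (λ { (((Xz , u , Lu , zu) , ¬tE) , z≁v) → Xz ,
                       u , (Lu , (λ { refl → z≁v zu }) , λ Eu → ¬tE (u , Eu , zu)) , zu }) m₂
            (_ , _ , _ , Bz , _) = some heavyB
        (w , Mw , heavyA) ← concentrate (bulk t) (Many-mono (n≤1+n _) id heavyE)
        let (_ , _ , _ , Az , _) = some heavyA
        bA ← A-branch (proj₁ Mw) Az
        bE ← branch E-closed Lv cE (proj₁ Mw)
        cB ← Rest-conn Lv bE
        bB ← branch (Rest-closed E-closed E?) Lv cB Bz
        sw ← sideOf (E⊆L (proj₁ Mw))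
        yes (w′ , Mw′ , w′≢w) ← em {A = ∃[ w′ ] M w′ × w′ ≢ w}
          where no none → Assemble.one-spoke Mw heavyA heavyB bA bB sw
                  λ {w′} Mw′ → case w′ Finₚ.≟ w of λ
                    { (yes eq) → eq ; (no ne) → contradiction (w′ , Mw′ , ne) none }
        Assemble.two-spokes Mw heavyA heavyB bA bB sw Mw′ w′≢w

    tree-contra : leafBound t ≤ length zs → suc (pendantBound t) ≤ length zs → 2 ≤ length zs → Unique zs → ⊥
    tree-contra leaf≤ pendant≤ 2≤ uzs = do
      let (p , q , p≢q , Lp , Lq) = two zs 2≤ uzs Xzs touchL
      (v , Lv , _ , cLv) ← non-cut cL (Conn-｛｝ {p}) (λ { refl → Lp }) refl Lq p≢q
      m ← prune {pendantBound t} {1} (_~ v) (zs , uzs , pendant≤ , All.zip (Xzs , touchL))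
            λ m → few-at (L⊆D Lv) (Many-mono ≤-refl (λ ((Xz , _) , e) → Xz , e) m)
      -- As `v` is not a cut vertex, all of `L` except `v` is the pendant set to start from.
      (E , _ , (v′ , Lv′ , clE , cE , heavyE) , minE) ← minimal Pendant {L ∖ v}
        (v , Lv , (proj₁ , (λ (_ , v≢v) → v≢v refl) , λ {_} {z} _ Lz _ → case z Finₚ.≟ v of λ
            { (yes eq) → inj₁ eq ; (no ne) → inj₂ (Lz , ne) }) , cLv ,
         Many-mono ≤-refl (λ { ((Xz , u , Lu , zu) , z≁v) → Xz , u , (Lu , λ { refl → z≁v zu }) , zu }) m)
      sv ← side Lv′ clE cE
      centre-contra Lv′ cE heavyE sv minE leaf≤ uzs
      where
      two : ∀ zs → 2 ≤ length zs → Unique zs → All X zs → All (Touches L) zs →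
            ∃[ p ] ∃[ q ] p ≢ q × L p × L q
      two (_ ∷ []) (s≤s ()) _ _ _
      two (z ∷ z′ ∷ _) _ ((z≢z′ ∷ _) ∷ _) (Xz ∷ Xz′ ∷ _) ((p , Lp , zp) ∷ (q , Lq , zq) ∷ _) =
        p , q , (λ { refl → z≢z′ (D-one-X (L⊆D Lp) Xz Xz′ (~-sym zp) (~-sym zq)) }) , Lp , Lq

  contra : ∀ zs → Unique zs → All X zs → neighbourBound t ≤ length zs → ⊥
  contra zs uzs Xzs big = do
    (L , L⊆D , (cL , touchL) , minL) ← minimal (λ S → Conn S × All (Touches S) zs) {D}
      (D-conn , All.map (λ Xz → let (p , e , r) = fan-reach Xz in p , fan⊆D Xz (source r) , e) Xzs)
    tree-contra zs Xzs L L⊆D cL touchL minL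
      (≤-trans (m≤m+n (leafBound t) _) big)
      (≤-trans (≤-trans (m≤m+n (suc (pendantBound t)) 2) (m≤n+m _ (leafBound t))) big)
      (≤-trans (≤-trans (m≤n+m 2 (suc (pendantBound t))) (m≤n+m _ (leafBound t))) big) uzs

-- From the given paths to the sets `D` and `X`

AllPairs-lookup : ∀ {A : Set} {R : A → A → Set} {xs} → (∀ {u v} → R u v → R v u) → AllPairs R xs →
                  ∀ {u v} → u ∈ xs → v ∈ xs → u ≢ v → R u v
AllPairs-lookup s (r ∷ rs) (here refl) (here refl) u≢v = contradiction refl u≢v
AllPairs-lookup s (r ∷ rs) (here refl) (there v∈)  _   = All.lookup r v∈
AllPairs-lookup s (r ∷ rs) (there u∈)  (here refl) _   = s (All.lookup r u∈)
AllPairs-lookup s (r ∷ rs) (there u∈)  (there v∈)  u≢v = AllPairs-lookup s rs u∈ v∈ u≢v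

module FromPaths (G : Graph) (inC : InC G) {x y : V G} (x≢y : x ≢ y) (x≁y : ¬ E G x y)
  (no-hubs : ∀ z → E G x z → ¬ IsHub G z) {k : ℕ} (P : Fin k → Path G x y)
  (disjoint : ∀ r s → r ≢ s → ∀ i j → Interior (P r) i → Interior (P s) j →
              vtx (P r) i ≢ vtx (P s) j) where

  open Basics G

  C : (r : Fin k) → Chain (λ v → ∃[ i ] vtx (P r) i ≡ v) x y
  C r = fromPath (P r)
  module C r = Chain (C r)

  2≤ : ∀ r → 2 ≤ C.ℓ r
  2≤ r = 2≤length (C r) x≢y x≁y

  1≤ : ∀ r → 1 ≤ C.ℓ r
  1≤ r = <⇒≤ (2≤ r)

  z w : Fin k → V G
  z r = C.at r 1
  w r = C.at r (C.ℓ r ∸ 1)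

  x~z : ∀ r → x ~ z r
  x~z r = subst (_~ z r) (C.at-0 r) (C.link r (1≤ r))

  apart : ∀ {r s i j} → r ≢ s → 0 < i → i < C.ℓ r → 0 < j → j < C.ℓ s → C.at r i ≢ C.at s j
  apart {r} {s} r≢s 0<i i< 0<j j< eq =
    let (m , int , eq₁) = at-interior (P r) 0<i i< ; (m′ , int′ , eq₂) = at-interior (P s) 0<j j< in
    disjoint r s r≢s m m′ int int′ (trans eq₁ (trans eq (sym eq₂)))

  z-inj : ∀ {r s} → r ≢ s → z r ≢ z s
  z-inj r≢s = apart r≢s ≤-refl (2≤ _) ≤-refl (2≤ _)

  w-next : ∀ {r i} → i ≤ C.ℓ r → y ~ C.at r i → C.at r i ≡ w r
  w-next {r} {i} i≤ e with C.at-adj r ≤-refl i≤ (subst (_~ C.at r i) (sym (C.at-ℓ r)) e)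
  ... | inj₁ eq = contradiction i≤ (<⇒≱ (≤-reflexive eq))
  ... | inj₂ eq = cong (C.at r) (cong (_∸ 1) eq)

  module Chosen (I : List (Fin k)) {r₀} (r₀∈ : r₀ ∈ I)
    (z-stable : AllPairs (λ r s → ¬ (z r ~ z s)) I) (w-stable : AllPairs (λ r s → ¬ (w r ~ w s)) I) where

    -- Index 2 is the first one beyond `z r`; since `x` and `y` are distinct and non-adjacent, `y`
    -- is always included.
    OnPath : Fin k → Sub
    OnPath r v = ∃[ i ] 2 ≤ i × i ≤ C.ℓ r × C.at r i ≡ v

    D X : Sub
    D v = ∃[ r ] r ∈ I × OnPath r v
    X v = ∃[ r ] r ∈ I × z r ≡ v

    x∉D : ∀ {u} → D u → x ≢ u × ¬ (x ~ u)
    x∉D (r , _ , i , 2≤i , i≤ , refl) =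
      (λ eq → <⇒≢ (≤-trans (s≤s z≤n) 2≤i) (C.at-inj r z≤n i≤ (trans (C.at-0 r) eq))) ,
      λ e → case C.at-adj r z≤n i≤ (subst (_~ C.at r i) (sym (C.at-0 r)) e) of λ
        { (inj₁ refl) → <⇒≱ ≤-refl 2≤i ; (inj₂ ()) }

    stable : ∀ {f : Fin k → V G} → AllPairs (λ r s → ¬ (f r ~ f s)) I →
             ∀ {r s} → r ∈ I → s ∈ I → ¬ (f r ~ f s)
    stable ap {r} {s} r∈ s∈ e with r Finₚ.≟ s
    ... | yes refl = E-irr G e
    ... | no r≢s   = AllPairs-lookup (λ na → na ∘ ~-sym) ap r∈ s∈ r≢s e

    X-stable : ∀ {u v} → X u → X v → ¬ (u ~ v)
    X-stable (r , r∈ , refl) (s , s∈ , refl) = stable {z} z-stable r∈ s∈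

    x~X : ∀ {u} → X u → x ~ u
    x~X (r , _ , refl) = x~z r

    𝒜 : Apex G
    𝒜 = record
      { inC = inC ; x = x ; D = D ; X = X ; x~X = x~X ; X-stable = X-stable
      ; X-no-hub = λ Xu → no-hubs _ (x~X Xu) ; x∉D = x∉D ; D-one-X = one }
      where
      -- Two common neighbours in `X` would give a square with `x` and `d` as opposite corners.
      one : ∀ {d u v} → D d → X u → X v → d ~ u → d ~ v → u ≡ v
      one {d} {u} {v} Dd Xu Xv du dv with u Finₚ.≟ v
      ... | yes eq = eq
      ... | no u≢v = ⊥-elim (Forbidden.no-C4 G inC (x~X Xu) (x~X Xv) du dv
        (proj₁ (x∉D Dd)) (proj₂ (x∉D Dd)) u≢v (X-stable Xu Xv))

    to-y : ∀ {r i} → 2 ≤ i → i ≤ C.ℓ r → Reach (OnPath r) (C.at r i) y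
    to-y {r} {i} 2≤i i≤ = subst (Reach (OnPath r) (C.at r i)) (C.at-ℓ r)
      (Seg-reach (C r) (C.ℓ r) 2≤i i≤ ≤-refl ≤-refl)

    -- A path is induced and ends in `y`, so only its penultimate vertex sees `y`. On a path of
    -- length two that vertex lies in `X`, hence the union.
    next-to-y : ∀ {u} → (D ∪ X) u → y ~ u → ∃[ r ] r ∈ I × u ≡ w r
    next-to-y (inj₁ (r , r∈ , i , _ , i≤ , refl)) e = r , r∈ , w-next i≤ e
    next-to-y (inj₂ (r , r∈ , refl)) e = r , r∈ , w-next (1≤ r) e

    ℱ : ∀ {t} → ¬ HasClique G t → Fan G 𝒜
    ℱ {t} no-clique = record
      { y = y ; Dy = r₀ , r₀∈ , C.ℓ r₀ , 2≤ r₀ , ≤-refl , C.at-ℓ r₀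
      ; D-conn = Conn-via λ { (r , r∈ , i , 2≤i , i≤ , refl) →
          Reach-mono (λ on → r , r∈ , on) (to-y 2≤i i≤) }
      ; y-triangle = λ u∈ v∈ yu yv → case next-to-y u∈ yu , next-to-y v∈ yv of λ
          { ((r , r∈ , refl) , (s , s∈ , refl)) → stable {w} w-stable r∈ s∈ }
      ; fan = fan ; fan⊆D = λ { _ (r , r∈ , _ , on) → r , r∈ , on }
      ; fan-reach = λ { (r , r∈ , refl) → C.at r 2 , C.link r (2≤ r) ,
          Reach-mono (λ on → r , r∈ , refl , on) (to-y ≤-refl (2≤ r)) }
      ; fan-disjoint = λ _ _ → meet ; t = t ; no-clique = no-clique }
      where
      fan : V G → Sub
      fan u v = ∃[ r ] r ∈ I × z r ≡ u × OnPath r v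
      meet : ∀ {u u′ v} → u ≢ u′ → fan u v → fan u′ v → v ≡ y
      meet u≢u′ (r , _ , refl , i , 2≤i , i≤ , refl) (s , _ , refl , j , 2≤j , j≤ , eq)
        with m≤n⇒m<n∨m≡n i≤ | m≤n⇒m<n∨m≡n j≤
      ... | inj₂ refl | _         = C.at-ℓ r
      ... | _         | inj₂ refl = trans (sym eq) (C.at-ℓ s)
      ... | inj₁ i<   | inj₁ j<   = contradiction (sym eq)
        (apart (λ { refl → u≢u′ refl }) (<⇒≤ 2≤i) i< (<⇒≤ 2≤j) j<)

    few-chosen : ∀ {t} → ¬ HasClique G t → Unique I → length I ≢ neighbourBound t
    few-chosen {t} no-clique uI len = Contradiction.contra G 𝒜 (ℱ no-clique) (map z I)
      (AllPairsₚ.map⁺ (AllPairs.map z-inj uI))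
      (Allₚ.map⁺ (All.tabulate λ r∈ → _ , r∈ , refl))
      (≤-reflexive (trans (sym len) (sym (length-map z I))))

  few-paths : ∀ {t} → ¬ HasClique G t → k ≢ ram t (ram t (neighbourBound t))
  few-paths {t} no-clique eq
    with ramsey (λ r s → E-dec G (z r) (z s)) t _ (allFin k)
           (≤-reflexive (trans (sym eq) (sym (length-tabulate id))))
  ... | inj₁ (J , _ , len , cl) = no-clique
    (subst (HasClique G) (trans (length-map z J) len) (list-clique {map z J} (AllPairsₚ.map⁺ cl)))
  ... | inj₂ (J , J⊑ , len , zs)
    with ramsey (λ r s → E-dec G (w r) (w s)) t _ J (≤-reflexive (sym len))
  ... | inj₁ (I , _ , len′ , cl) = no-clique
    (subst (HasClique G) (trans (length-map w I) len′) (list-clique {map w I} (AllPairsₚ.map⁺ cl)))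
  -- `y` belongs to `D` by way of a chosen path, so at least one has to be chosen.
  ... | inj₂ ([] , _ , len′ , _) = contradiction len′
    (<⇒≢ (≤-trans (s≤s z≤n) (≤-trans (m≤n+m 2 (suc (pendantBound t))) (m≤n+m _ (leafBound t)))))
  ... | inj₂ (I@(_ ∷ _) , I⊑ , len′ , ws) =
    Chosen.few-chosen I (here refl) (AllPairs-⊑ I⊑ zs) ws no-clique
      (AllPairs-⊑ I⊑ (AllPairs-⊑ J⊑ (Uniqueₚ.allFin⁺ k))) len′

theorem3p6 : ∀ (t : ℕ) → 1 ≤ t → ∃[ k ] (∀ (G : Graph) → InCt t G →
    ∀ (x y : V G) → x ≢ y → ¬ E G x y → (∀ z → E G x z → ¬ IsHub G z) →
    ¬ DisjointPaths G x y k)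
theorem3p6 t _ = ram t (ram t (neighbourBound t)) , λ G (inC , no-clique) x y x≢y x≁y no-hubs (P , disjoint) →
  FromPaths.few-paths G inC x≢y x≁y no-hubs P disjoint {t} no-clique refl
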